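{- Let $q$ be an odd prime power. In $\mathrm{PG}(3,q^2)$, let $\mathcal H$ be a non-degenerate Hermitian surface and $\mathcal Q$ an irreducible quadric such that there is a point $P\in\mathcal H\cap\mathcal Q$ which is a nonsingular point of $\mathcal Q$ and at which $\mathcal H$ and $\mathcal Q$ have the same tangent plane. Suppose $|\mathcal H\cap\mathcal Q|=q^2+1$. Then $\mathcal Q$ is a hyperbolic quadric and $\Omega=\mathcal H\cap\mathcal Q$ is an elliptic quadric contained in a subgeometry $\mathrm{PG}(3,q)$ embedded in $\mathrm{PG}(3,q^2)$.
   Context: A subgeometry $\mathrm{PG}(3,q)$ of $\mathrm{PG}(3,q^2)$ is a Baer subgeometry, i.e. the image under a collineation of the set of points with coordinates in $\mathrm{GF}(q)$. -}

module Defs where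

open import Level using (0ℓ)
open import Data.Nat as ℕ using (ℕ; zero; suc)
open import Data.Nat.Divisibility using (_∣_)
open import Data.Nat.Primality using (Prime)
open import Data.Fin using (Fin; zero; suc)
open import Data.List using (List; []; _∷_; [_]; map; concatMap; filter; length)
open import Data.List.Relation.Unary.Unique.Propositional using (Unique)
open import Data.List.Membership.Propositional using (_∈_)
open import Data.Vec.Functional using (Vector) renaming (_∷_ to _∷ᵛ_)
open import Data.Product using (Σ; Σ-syntax; ∃; ∃-syntax; _×_; _,_)
open import Data.Sum using (_⊎_; inj₁; inj₂)
open import Data.Empty using (⊥)
open import Function using (_∘_; _⇔_)
open import Relation.Nullary using (¬_; Dec; yes; no)
open import Relation.Nullary.Decidable using (_×-dec_; _⊎-dec_)
open import Relation.Binary.PropositionalEquality using (_≡_; _≢_)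
open import Relation.Binary.Definitions using (DecidableEquality)
open import Algebra.Structures using (IsCommutativeRing)

IsOddPrimePower : ℕ → Set
IsOddPrimePower q =
  (∃[ p ] ∃[ k ] (Prime p × 1 ℕ.≤ k × q ≡ p ℕ.^ k)) × ¬ (2 ∣ q)

record FiniteField : Set₁ where
  infixl 6 _+_
  infixl 7 _*_
  field
    Carrier   : Set
    _+_ _*_   : Carrier → Carrier → Carrier
    -_        : Carrier → Carrier
    0# 1#     : Carrier
    isCommutativeRing : IsCommutativeRing _≡_ _+_ _*_ -_ 0# 1#
    0≢1       : 0# ≢ 1#
    inverse   : ∀ x → x ≢ 0# → ∃[ y ] (x * y ≡ 1#)
    _≟_       : DecidableEquality Carrier
    elements  : List Carrier
    elements-unique   : Unique elements
    elements-complete : ∀ x → x ∈ elements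

module _ (F : FiniteField) where
  open FiniteField F

  pow : Carrier → ℕ → Carrier
  pow x zero    = 1#
  pow x (suc n) = x * pow x n

  ∑ : ∀ {n} → (Fin n → Carrier) → Carrier
  ∑ {zero}  f = 0#
  ∑ {suc n} f = f zero + ∑ (f ∘ suc)

  Vec4 : Set
  Vec4 = Vector Carrier 4

  Matrix : Set
  Matrix = Fin 4 → Fin 4 → Carrier

  _·_ : Matrix → Vec4 → Vec4
  (M · x) i = ∑ λ j → M i j * x j

  _×ₛ_ : Carrier → Vec4 → Vec4
  (c ×ₛ x) i = c * x i

  NonZeroVec : Vec4 → Set
  NonZeroVec v = ¬ (∀ i → v i ≡ 0#)

  Invertible : Matrix → Set
  Invertible M = Σ[ N ∈ Matrix ] ((∀ i k → ∑ (λ j → M i j * N j k) ≡ I i k)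
                      × (∀ i k → ∑ (λ j → N i j * M j k) ≡ I i k))
    where
    I : Fin 4 → Fin 4 → Carrier
    I i k with i Data.Fin.≟ k
    ... | yes _ = 1#
    ... | no  _ = 0#

  IsAutomorphism : (Carrier → Carrier) → Set
  IsAutomorphism σ = (∀ x y → σ (x + y) ≡ σ x + σ y)
                   × (∀ x y → σ (x * y) ≡ σ x * σ y)
                   × σ 1# ≡ 1#
                   × Σ[ τ ∈ (Carrier → Carrier) ] ((∀ x → τ (σ x) ≡ x) × (∀ x → σ (τ x) ≡ x))

  -- all vectors of F^n, and counting points of PG(3,F) via normalised
  -- representatives (first nonzero coordinate equal to 1)
  allVecs : ∀ n → List (Vector Carrier n)
  allVecs zero    = [ (λ ()) ]
  allVecs (suc n) = concatMap (λ x → map (x ∷ᵛ_) (allVecs n)) elements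

  Normalised : ∀ {n} → Vector Carrier n → Set
  Normalised {zero}  v = ⊥
  Normalised {suc n} v = (v zero ≡ 1#) ⊎ (v zero ≡ 0# × Normalised (v ∘ suc))

  normalised? : ∀ {n} (v : Vector Carrier n) → Dec (Normalised v)
  normalised? {zero}  v = no λ ()
  normalised? {suc n} v = (v zero ≟ 1#) ⊎-dec ((v zero ≟ 0#) ×-dec normalised? (v ∘ suc))

  numPoints : (P : Vec4 → Set) → (∀ v → Dec (P v)) → ℕ
  numPoints P P? = length (filter (λ v → normalised? v ×-dec P? v) (allVecs 4))

  -- Quadrics of PG(3,F) (char F ≠ 2): given by a symmetric matrix B,
  -- Q(x) = Σ_{i,j} B_ij x_i x_j

  IsSymmetric : Matrix → Set
  IsSymmetric B = ∀ i j → B i j ≡ B j i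

  quadForm : Matrix → Vec4 → Carrier
  quadForm B x = ∑ λ i → ∑ λ j → B i j * x i * x j

  linForm : Vec4 → Vec4 → Carrier
  linForm u x = ∑ λ i → u i * x i

  IrreducibleQuadric : Matrix → Set
  IrreducibleQuadric B =
    ¬ (Σ[ u ∈ Vec4 ] Σ[ w ∈ Vec4 ] (∀ x → quadForm B x ≡ linForm u x * linForm w x))

  -- P is a nonsingular point of the quadric: the gradient 2BP is nonzero
  NonsingularPoint : Matrix → Vec4 → Set
  NonsingularPoint B P = NonZeroVec (B · P)

  IsHyperbolic : Matrix → Set
  IsHyperbolic B = Σ[ M ∈ Matrix ] (Invertible M × Σ[ c ∈ Carrier ] (c ≢ 0# ×
    (∀ x → quadForm B (M · x) ≡ c * (x zero * x (suc zero)
                                     + x (suc (suc zero)) * x (suc (suc (suc zero)))))))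

  -- Hermitian forms, with respect to the involution x ↦ x^q of F = GF(q²)

  module _ (q : ℕ) where

    conj : Carrier → Carrier
    conj x = pow x q

    InSubfield : Carrier → Set
    InSubfield x = pow x q ≡ x

    SubfieldVec : Vec4 → Set
    SubfieldVec x = ∀ i → InSubfield (x i)

    IsHermitian : Matrix → Set
    IsHermitian A = ∀ i j → A j i ≡ conj (A i j)

    hermForm : Matrix → Vec4 → Vec4 → Carrier
    hermForm A x y = ∑ λ i → ∑ λ j → A i j * x i * conj (y j)

    NonDegenerateHermitian : Matrix → Set
    NonDegenerateHermitian A = ∀ v → (∀ w → hermForm A w v ≡ 0#) → ∀ i → v i ≡ 0#

    OnH : Matrix → Vec4 → Set
    OnH A v = hermForm A v v ≡ 0#

    OnQ : Matrix → Vec4 → Set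
    OnQ B v = quadForm B v ≡ 0#

    OnHQ : Matrix → Matrix → Vec4 → Set
    OnHQ A B v = OnH A v × OnQ B v

    onHQ? : ∀ A B v → Dec (OnHQ A B v)
    onHQ? A B v = (hermForm A v v ≟ 0#) ×-dec (quadForm B v ≟ 0#)

    card-H∩Q : Matrix → Matrix → ℕ
    card-H∩Q A B = numPoints (OnHQ A B) (onHQ? A B)

    -- H and Q have the same tangent plane at P:
    -- tangent plane of H at P is  Σ_i X_i (Σ_j A_ij P_j^q) = 0,
    -- tangent plane of Q at P is  Σ_i X_i (Σ_j B_ij P_j) = 0.
    SameTangentPlane : Matrix → Matrix → Vec4 → Set
    SameTangentPlane A B P = Σ[ λ' ∈ Carrier ] (λ' ≢ 0# ×
      (∀ i → ∑ (λ j → A i j * conj (P j)) ≡ λ' * ∑ (λ j → B i j * P j)))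

    IsEllipticOverSubfield : Matrix → Set
    IsEllipticOverSubfield B' =
      Σ[ N ∈ Matrix ] ((∀ i j → InSubfield (N i j)) × Invertible N ×
      Σ[ c ∈ Carrier ] (InSubfield c × c ≢ 0# ×
      Σ[ d ∈ Carrier ] (InSubfield d × ¬ (Σ[ y ∈ Carrier ] (InSubfield y × y * y ≡ d)) ×
        (∀ x → SubfieldVec x →
           quadForm B' (N · x) ≡
             c * (x zero * x (suc zero)
                  + x (suc (suc zero)) * x (suc (suc zero))
                  + - (d * x (suc (suc (suc zero))) * x (suc (suc (suc zero)))))))))

    -- Ω = H ∩ Q is an elliptic quadric contained in a subgeometry PG(3,q):
    -- there is a collineation x ↦ M σ(x) (M invertible, σ a field
    -- automorphism) and an elliptic quadric {B' = 0} of PG(3,q) (the points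
    -- with GF(q) coordinates) whose image is exactly the point set of H ∩ Q.
    EllipticInBaerSubgeometry : Matrix → Matrix → Set
    EllipticInBaerSubgeometry A B =
      Σ[ M ∈ Matrix ] Σ[ σ ∈ (Carrier → Carrier) ] (Invertible M × IsAutomorphism σ ×
      Σ[ B' ∈ Matrix ] ((∀ i j → InSubfield (B' i j)) × IsSymmetric B' ×
        IsEllipticOverSubfield B' ×
        (∀ v → NonZeroVec v →
          (OnHQ A B v ⇔
            (Σ[ x ∈ Vec4 ] (SubfieldVec x × NonZeroVec x × quadForm B' x ≡ 0# ×
               Σ[ λ' ∈ Carrier ] (λ' ≢ 0# × (∀ i → v i ≡ (λ' ×ₛ (M · (σ ∘ x))) i))))))))

{-# OPTIONS --safe #-}

-- Rescale Q so that its polar form β and the form h of H satisfy β(x,P) = h(x,P) for all x, and complete P to a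
-- basis P, R, a, b with P, R a hyperbolic pair for β orthogonal to U = ⟨a,b⟩.  The points of Ω off the tangent
-- plane at P are then the zeros of a polynomial f of degree two over GF(q) on U ≅ GF(q)⁴, with leading form
-- φ = 2h − Tr β.  If φ(u) = 0, then f is affine along the translates of GF(q)u, so either f is invariant under
-- translation by u or it has more than q² zeros.  Hence the vectors isotropic for φ form its radical
-- W = {u : β(·,u) = h(·,u) on U}, which contains no GF(q²)-line because h is nondegenerate.  As every ternary
-- quadratic form over GF(q) is isotropic, W contains a GF(q²)-basis of U.  After moving R to a zero of f, the
-- forms β and h have the same Gram matrix on P, R and this basis; its entries lie in GF(q), its restriction to W
-- is anisotropic, and Ω is exactly the set of its isotropic GF(q)-points.  Over GF(q²) the quadric becomes
-- hyperbolic since every element of GF(q) is a square there.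

module Submission where

open import Defs
open import Level using (0ℓ)
open import Data.Nat as ℕ using (ℕ; zero; suc; _∸_; s≤s; z≤n)
open import Data.Nat.Base using (_!)
import Data.Nat.Properties as ℕ
open import Data.Nat.Divisibility as ℕ∣ using (_∣_; divides-refl)
open import Data.Nat.Primality using (Prime; euclidsLemma; prime⇒nonZero; prime⇒nonTrivial)
open import Data.Nat.Combinatorics using (_C_; k![n∸k]!∣n!; nCn≡1)
open import Data.Nat.Combinatorics.Specification using (nCk≡n!/k![n-k]!)
import Data.Nat.DivMod as ℕ/
import Data.Nat.Solver
open import Data.Integer as ℤ using (ℤ; -[1+_])
import Data.Integer.Properties as ℤ
open import Data.Fin as Fin using (Fin; toℕ; inject₁; fromℕ)
open import Data.Fin.Patterns using (0F; 1F; 2F; 3F)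
import Data.Fin.Properties as Fin
open import Data.Maybe using (Maybe; just; nothing)
import Data.Vec.Functional as Vector
open import Data.List using (List; []; _∷_; map; filter; foldr; length; _++_)
import Data.List.Properties as List
open import Data.List.Relation.Unary.All as All using (All; []; _∷_)
import Data.List.Relation.Unary.All.Properties as All
open import Data.List.Relation.Unary.Any as Any using (Any; here; there; satisfied)
import Data.List.Relation.Unary.Any.Properties as Any
open import Data.List.Relation.Unary.AllPairs as AllPairs using (AllPairs; []; _∷_)
import Data.List.Relation.Unary.AllPairs.Properties as AllPairs
open import Data.List.Relation.Unary.Unique.Propositional using (Unique)
import Data.List.Relation.Unary.Unique.Propositional.Properties as Unique
open import Data.List.Membership.Propositional using (_∈_; find; lose)
open import Data.List.Membership.Propositional.Properties using (∈-∃++; ∈-map⁺; ∈-map⁻; ∈-filter⁺)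
open import Data.List.Membership.Propositional.Properties.WithK using (unique∧set⇒bag)
open import Data.List.Relation.Binary.BagAndSetEquality using (∼bag⇒↭)
open import Data.List.Relation.Binary.Permutation.Propositional using (_↭_; ↭⇒↭ₛ)
open import Data.List.Relation.Binary.Permutation.Propositional.Properties using (shift; ∈-resp-↭; ↭-length)
import Data.List.Relation.Binary.Permutation.Setoid.Properties
open import Data.Product using (Σ-syntax; ∃-syntax; _×_; _,_; proj₁; proj₂)
open import Data.Sum using (_⊎_; inj₁; inj₂)
open import Data.Empty using (⊥; ⊥-elim)
open import Function using (_∘_; mk⇔; module Equivalence)
open import Relation.Nullary using (¬_; Dec; yes; no; contradiction)
open import Relation.Nullary.Decidable using (_×-dec_)
open import Relation.Binary.PropositionalEquality using (_≡_; _≢_; refl; sym; trans; cong; cong₂; subst; module ≡-Reasoning)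
import Relation.Binary.PropositionalEquality as ≡
open import Algebra.Bundles using (CommutativeRing; CommutativeSemiring)
open import Algebra.Structures using (IsCommutativeRing)
open import Algebra.Solver.Ring.AlmostCommutativeRing using (AlmostCommutativeRing; fromCommutativeRing; _-Raw-AlmostCommutative⟶_)
import Algebra.Solver.Ring
import Algebra.Properties.Ring
import Algebra.Properties.Semiring.Mult
import Algebra.Properties.Semiring.Mult.TCOptimised
import Algebra.Properties.Semiring.Exp
import Algebra.Properties.Monoid.Sum
import Algebra.Properties.CommutativeSemiring.Binomial

-- Tangency makes the problem affine: as `β` and `h` agree against `P`, a point of the quadric with
-- R-coordinate 1 has its `P`-coordinate fixed by its component in U, and that coordinate enters the
-- Hermitian form only through its trace. The obstacle is that f mixes squares, conjugate squares
-- and norms; identities are therefore proved with conjugates as independent variables, and reality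
-- is imposed afterwards by substitution. A line parallel to GF(q)u on which f has nonzero slope
-- carries exactly one zero, and with `P` added, q² + 1 such lines yield q² + 2 points, one too
-- many. The work is to find that many lines whenever the slope is not identically zero. The second
-- vector of W is sought in a three-dimensional GF(q)-complement of the first, where ternary
-- isotropy applies again. It applies a third time to produce the zero of f to which R is moved:
-- modulo W the polynomial is binary, its homogenisation is ternary, and the anisotropic leading
-- form leaves no zeros at infinity.

-- Polynomial identities with integer coefficients.

module IntegerCoefficients (R : CommutativeRing 0ℓ 0ℓ) where
  open CommutativeRing R renaming (refl to ≈-refl; sym to ≈-sym; trans to ≈-trans)
  open Algebra.Properties.Semiring.Mult.TCOptimised semiring renaming (_×_ to _×′_)
  open Algebra.Properties.Ring ring
  open import Relation.Binary.Reasoning.Setoid setoid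

  -- With the optimised multiple the images of 0, 1 and 2 reduce to `0#`, `1#` and `1# + 1#`, so
  -- solved identities match goals directly. Integers, unlike elements of an arbitrary ring, have an
  -- equality test that computes, which lets terms cancel during normalisation.
  fromℤ : ℤ → Carrier
  fromℤ (ℤ.+ n)      = n ×′ 1#
  fromℤ (-[1+ n ]) = - (suc n ×′ 1#)

  private
    cancel-suc : ∀ m n → m ×′ 1# - n ×′ 1# ≈ suc m ×′ 1# - suc n ×′ 1#
    cancel-suc m n = begin
      a - b                       ≈⟨ +-congʳ (+-identityˡ a) ⟨
      (0# + a) - b                ≈⟨ +-congʳ (+-congʳ (-‿inverseʳ 1#)) ⟨
      ((1# - 1#) + a) - b         ≈⟨ +-congʳ (+-assoc 1# (- 1#) a) ⟩
      (1# + (- 1# + a)) - b       ≈⟨ +-congʳ (+-congˡ (+-comm (- 1#) a)) ⟩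
      (1# + (a - 1#)) - b         ≈⟨ +-congʳ (+-assoc 1# a (- 1#)) ⟨
      ((1# + a) - 1#) - b         ≈⟨ +-assoc (1# + a) (- 1#) (- b) ⟩
      (1# + a) + (- 1# - b)       ≈⟨ +-congˡ (-‿+-comm 1# b) ⟩
      (1# + a) - (1# + b)         ≈⟨ +-cong (1+× m 1#) (-‿cong (1+× n 1#)) ⟨
      suc m ×′ 1# - suc n ×′ 1#   ∎
      where a = m ×′ 1#
            b = n ×′ 1#

    fromℤ-⊖ : ∀ m n → fromℤ (m ℤ.⊖ n) ≈ m ×′ 1# - n ×′ 1#
    fromℤ-⊖ zero    zero    = ≈-sym (-‿inverseʳ 0#)
    fromℤ-⊖ zero    (suc n) = ≈-sym (+-identityˡ _)
    fromℤ-⊖ (suc m) zero    = ≈-sym (≈-trans (+-congˡ -0#≈0#) (+-identityʳ _))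
    fromℤ-⊖ (suc m) (suc n) = begin
      fromℤ (suc m ℤ.⊖ suc n)      ≡⟨ cong fromℤ (ℤ.[1+m]⊖[1+n]≡m⊖n m n) ⟩
      fromℤ (m ℤ.⊖ n)              ≈⟨ fromℤ-⊖ m n ⟩
      m ×′ 1# - n ×′ 1#             ≈⟨ cancel-suc m n ⟩
      suc m ×′ 1# - suc n ×′ 1#     ∎

    +-homo : ∀ i j → fromℤ (i ℤ.+ j) ≈ fromℤ i + fromℤ j
    +-homo (ℤ.+ m)      (ℤ.+ n)      = ×-homo-+ 1# m n
    +-homo (ℤ.+ m)      (-[1+ n ]) = fromℤ-⊖ m (suc n)
    +-homo (-[1+ m ]) (ℤ.+ n)      = ≈-trans (fromℤ-⊖ n (suc m)) (+-comm _ _)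
    +-homo (-[1+ m ]) (-[1+ n ]) = begin
      - (suc (suc (m ℕ.+ n)) ×′ 1#)       ≡⟨ cong (λ t → - (t ×′ 1#)) (cong suc (sym (ℕ.+-suc m n))) ⟩
      - ((suc m ℕ.+ suc n) ×′ 1#)         ≈⟨ -‿cong (×-homo-+ 1# (suc m) (suc n)) ⟩
      - (suc m ×′ 1# + suc n ×′ 1#)        ≈⟨ -‿+-comm _ _ ⟨
      - (suc m ×′ 1#) - suc n ×′ 1#        ∎

    neg-homo : ∀ i → fromℤ (ℤ.- i) ≈ - fromℤ i
    neg-homo (ℤ.+ zero)    = ≈-sym -0#≈0#
    neg-homo (ℤ.+ suc n)   = ≈-refl
    neg-homo (-[1+ n ]) = ≈-sym (-‿involutive _)

    pos-homo : ∀ m j → fromℤ (ℤ.+ m ℤ.* j) ≈ (m ×′ 1#) * fromℤ j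
    pos-homo m (ℤ.+ n)      = ≈-trans (reflexive (cong fromℤ (sym (ℤ.pos-* m n)))) (×1-homo-* m n)
    pos-homo m (-[1+ n ]) = begin
      fromℤ (ℤ.+ m ℤ.* -[1+ n ])     ≡⟨ cong fromℤ (sym (ℤ.neg-distribʳ-* (ℤ.+ m) (ℤ.+ suc n))) ⟩
      fromℤ (ℤ.- (ℤ.+ m ℤ.* ℤ.+ suc n)) ≈⟨ neg-homo (ℤ.+ m ℤ.* ℤ.+ suc n) ⟩
      - fromℤ (ℤ.+ m ℤ.* ℤ.+ suc n)     ≈⟨ -‿cong (pos-homo m (ℤ.+ suc n)) ⟩
      - ((m ×′ 1#) * (suc n ×′ 1#))   ≈⟨ -‿distribʳ-* _ _ ⟩
      (m ×′ 1#) * - (suc n ×′ 1#)     ∎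

    *-homo : ∀ i j → fromℤ (i ℤ.* j) ≈ fromℤ i * fromℤ j
    *-homo (ℤ.+ m)      j = pos-homo m j
    *-homo (-[1+ m ]) j = begin
      fromℤ (-[1+ m ] ℤ.* j)      ≡⟨ cong fromℤ (sym (ℤ.neg-distribˡ-* (ℤ.+ suc m) j)) ⟩
      fromℤ (ℤ.- (ℤ.+ suc m ℤ.* j)) ≈⟨ neg-homo (ℤ.+ suc m ℤ.* j) ⟩
      - fromℤ (ℤ.+ suc m ℤ.* j)     ≈⟨ -‿cong (pos-homo (suc m) j) ⟩
      - ((suc m ×′ 1#) * fromℤ j)  ≈⟨ -‿distribˡ-* _ _ ⟩
      - (suc m ×′ 1#) * fromℤ j    ∎

  almostCommutativeRing : AlmostCommutativeRing 0ℓ 0ℓ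
  almostCommutativeRing = fromCommutativeRing R

  morphism : ℤ.+-*-rawRing -Raw-AlmostCommutative⟶ almostCommutativeRing
  morphism = record
    { ⟦_⟧    = fromℤ
    ; +-homo = +-homo
    ; *-homo = *-homo
    ; -‿homo = neg-homo
    ; 0-homo = ≈-refl
    ; 1-homo = ≈-refl
    }

  decideCoefficients : ∀ i j → Maybe (fromℤ i ≈ fromℤ j)
  decideCoefficients i j with i ℤ.≟ j
  ... | yes i≡j = just (reflexive (cong fromℤ i≡j))
  ... | no  _   = nothing

  open Algebra.Solver.Ring ℤ.+-*-rawRing almostCommutativeRing morphism decideCoefficients public
    using (solve; _:=_; _:+_; _:*_; _:-_; :-_; Polynomial; con)

  :0 :1 :2 : ∀ {n} → Polynomial n
  :0 = con (ℤ.+ 0)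
  :1 = con (ℤ.+ 1)
  :2 = con (ℤ.+ 2)

-- Elementary field arithmetic.

module FieldArithmetic (F : FiniteField) where
  open FiniteField F public
  open IsCommutativeRing isCommutativeRing public
    using (+-assoc; +-comm; *-assoc; *-comm; +-identityˡ; +-identityʳ; *-identityˡ; *-identityʳ; distribˡ; distribʳ; zeroˡ; zeroʳ; -‿inverseˡ; -‿inverseʳ)

  commutativeRing : CommutativeRing 0ℓ 0ℓ
  commutativeRing = record { isCommutativeRing = isCommutativeRing }

  open IntegerCoefficients commutativeRing public using (solve; _:=_; _:+_; _:*_; _:-_; :-_; :0; :1; :2)
  open Algebra.Properties.Ring (CommutativeRing.ring commutativeRing) public
    using (-‿involutive; -0#≈0#; -‿distribˡ-*; -‿distribʳ-*)

  _⁻¹ : ∀ {x} → x ≢ 0# → Carrier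
  _⁻¹ {x} x≢0 = proj₁ (inverse x x≢0)

  *-inverseʳ : ∀ {x} (x≢0 : x ≢ 0#) → x * x≢0 ⁻¹ ≡ 1#
  *-inverseʳ {x} x≢0 = proj₂ (inverse x x≢0)

  *-cancelˡ : ∀ {x y z} → x ≢ 0# → x * y ≡ x * z → y ≡ z
  *-cancelˡ {x} {y} {z} x≢0 xy≡xz = begin
    y               ≡⟨ *-identityˡ y ⟨
    1# * y          ≡⟨ cong (_* y) (*-inverseʳ x≢0) ⟨
    x * x≢0 ⁻¹ * y  ≡⟨ swap y ⟩
    x≢0 ⁻¹ * (x * y) ≡⟨ cong (x≢0 ⁻¹ *_) xy≡xz ⟩
    x≢0 ⁻¹ * (x * z) ≡⟨ swap z ⟨
    x * x≢0 ⁻¹ * z  ≡⟨ cong (_* z) (*-inverseʳ x≢0) ⟩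
    1# * z          ≡⟨ *-identityˡ z ⟩
    z               ∎
    where
    open ≡-Reasoning
    swap : ∀ w → x * x≢0 ⁻¹ * w ≡ x≢0 ⁻¹ * (x * w)
    swap = solve 3 (λ x i w → x :* i :* w := i :* (x :* w)) refl x (x≢0 ⁻¹)

  *-zero-product : ∀ {x y} → x ≢ 0# → x * y ≡ 0# → y ≡ 0#
  *-zero-product x≢0 xy≡0 = *-cancelˡ x≢0 (trans xy≡0 (sym (zeroʳ _)))

  *-nonzero : ∀ {x y} → x ≢ 0# → y ≢ 0# → x * y ≢ 0#
  *-nonzero x≢0 y≢0 xy≡0 = y≢0 (*-zero-product x≢0 xy≡0)

  ⁻¹-nonzero : ∀ {x} (x≢0 : x ≢ 0#) → x≢0 ⁻¹ ≢ 0#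
  ⁻¹-nonzero {x} x≢0 i≡0 = 0≢1 (trans (sym (zeroʳ x)) (trans (cong (x *_) (sym i≡0)) (*-inverseʳ x≢0)))

  -‿nonzero : ∀ {x} → x ≢ 0# → - x ≢ 0#
  -‿nonzero {x} x≢0 -x≡0 = x≢0 (trans (sym (-‿involutive x)) (trans (cong -_ -x≡0) -0#≈0#))

  x-y≡0⇒x≡y : ∀ {x y} → x + - y ≡ 0# → x ≡ y
  x-y≡0⇒x≡y {x} {y} d = trans (solve 2 (λ x y → x := (x :- y) :+ y) refl x y) (trans (cong (_+ y) d) (+-identityˡ y))

  +-cancelˡ : ∀ x {y z} → x + y ≡ x + z → y ≡ z
  +-cancelˡ x {y} {z} e = x-y≡0⇒x≡y (trans (solve 3 (λ x y z → y :- z := (x :+ y) :- (x :+ z)) refl x y z) (trans (cong (_+ - (x + z)) e) (-‿inverseʳ _)))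

  pow-+ : ∀ x m n → pow F x (m ℕ.+ n) ≡ pow F x m * pow F x n
  pow-+ x zero    n = sym (*-identityˡ _)
  pow-+ x (suc m) n = trans (cong (x *_) (pow-+ x m n)) (sym (*-assoc x _ _))

  pow-* : ∀ x m n → pow F x (m ℕ.* n) ≡ pow F (pow F x n) m
  pow-* x zero    n = refl
  pow-* x (suc m) n = trans (pow-+ x n (m ℕ.* n)) (cong (pow F x n *_) (pow-* x m n))

  pow-distrib-* : ∀ x y n → pow F (x * y) n ≡ pow F x n * pow F y n
  pow-distrib-* x y zero    = sym (*-identityˡ 1#)
  pow-distrib-* x y (suc n) = trans (cong (x * y *_) (pow-distrib-* x y n))
    (solve 4 (λ x y u v → x :* y :* (u :* v) := x :* u :* (y :* v)) refl x y (pow F x n) (pow F y n))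

  pow-1# : ∀ n → pow F 1# n ≡ 1#
  pow-1# zero    = refl
  pow-1# (suc n) = trans (*-identityˡ _) (pow-1# n)

  pow-nonzero : ∀ {x} n → x ≢ 0# → pow F x n ≢ 0#
  pow-nonzero zero    x≢0 = λ 1≡0 → 0≢1 (sym 1≡0)
  pow-nonzero (suc n) x≢0 = *-nonzero x≢0 (pow-nonzero n x≢0)

  pow-0# : ∀ {n} → n ≢ 0 → pow F 0# n ≡ 0#
  pow-0# {zero}  n≢0 = contradiction refl n≢0
  pow-0# {suc n} n≢0 = zeroˡ _

-- Binomial coefficients modulo a prime.

prime∤factorial : ∀ {p} → Prime p → ∀ j → j ℕ.< p → ¬ (p ∣ j !)
prime∤factorial {p} pp zero    _   p∣1 = ℕ.nonTrivial⇒≢1 {{prime⇒nonTrivial pp}} (ℕ∣.∣1⇒≡1 p∣1)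
prime∤factorial pp (suc j) j<p p∣ with euclidsLemma (suc j) (j !) pp p∣
... | inj₁ p∣1+j = ℕ∣.>⇒∤ j<p p∣1+j
... | inj₂ p∣j!  = prime∤factorial pp j (ℕ.<-trans (ℕ.n<1+n j) j<p) p∣j!

-- Multiplied by k!(p - k)! the coefficient becomes p!, which p divides, while p divides neither
-- factorial because 0 < k < p.
prime∣binomial : ∀ {p} → Prime p → ∀ k → 0 ℕ.< k → k ℕ.< p → p ∣ p C k
prime∣binomial {p} pp k 0<k k<p with euclidsLemma (p C k) (k ! ℕ.* (p ∸ k) !) pp p∣product
  where
  instance _ = k ℕ.!* (p ∸ k) !≢0
  product≡ : (p C k) ℕ.* (k ! ℕ.* (p ∸ k) !) ≡ p !
  product≡ = trans (cong (ℕ._* (k ! ℕ.* (p ∸ k) !)) (nCk≡n!/k![n-k]! (ℕ.<⇒≤ k<p))) (ℕ/.m/n*n≡m (k![n∸k]!∣n! (ℕ.<⇒≤ k<p)))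
  p∣p! : ∀ {p} → Prime p → p ∣ p !
  p∣p! {zero}  pp = contradiction refl (ℕ.≢-nonZero⁻¹ 0 {{prime⇒nonZero pp}})
  p∣p! {suc n} pp = ℕ∣.m∣m*n (n !)
  p∣product : p ∣ (p C k) ℕ.* (k ! ℕ.* (p ∸ k) !)
  p∣product = subst (p ∣_) (sym product≡) (p∣p! pp)
... | inj₁ p∣C = p∣C
... | inj₂ p∣kk with euclidsLemma (k !) ((p ∸ k) !) pp p∣kk
...   | inj₁ p∣k!   = contradiction p∣k! (prime∤factorial pp k k<p)
...   | inj₂ p∣p-k! = contradiction p∣p-k! (prime∤factorial pp (p ∸ k) (ℕ.∸-monoʳ-< 0<k (ℕ.<⇒≤ k<p)))

-- Finite fields: characteristic, orders of units, Frobenius map.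

module FiniteFieldTheory (F : FiniteField) where
  open FieldArithmetic F

  private
    commutativeSemiring : CommutativeSemiring 0ℓ 0ℓ
    commutativeSemiring = CommutativeRing.commutativeSemiring commutativeRing
    semiring = CommutativeSemiring.semiring commutativeSemiring

  open Algebra.Properties.Semiring.Mult semiring
    using (×1-homo-*; ×-assoc-*) renaming (_×_ to _×ⁿ_) public
  open Algebra.Properties.Semiring.Exp semiring using (_^_)
  private
    module Sum = Algebra.Properties.Monoid.Sum (CommutativeSemiring.+-monoid commutativeSemiring)
    module Binomial = Algebra.Properties.CommutativeSemiring.Binomial commutativeSemiring
    module CR = CommutativeRing commutativeRing
    module Perm = Data.List.Relation.Binary.Permutation.Setoid.Properties (≡.setoid Carrier)

  ×ⁿ-1# : ∀ n x → n ×ⁿ x ≡ (n ×ⁿ 1#) * x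
  ×ⁿ-1# zero    x = sym (zeroˡ x)
  ×ⁿ-1# (suc n) x = trans (cong₂ _+_ (sym (*-identityˡ x)) (×ⁿ-1# n x)) (sym (distribʳ x 1# (n ×ⁿ 1#)))

  -- Duplicate-free lists with the same members are permutations of each other; the right inverse
  -- `g` supplies surjectivity. Sums and products over a list can thus be compared before and after
  -- a translation or scaling.
  injection-permutes : ∀ {xs} (f : Carrier → Carrier) (g : Carrier → Carrier) →
    (∀ {x y} → f x ≡ f y → x ≡ y) → (∀ x → f (g x) ≡ x) → Unique xs →
    (∀ {x} → x ∈ xs → f x ∈ xs) → (∀ {x} → x ∈ xs → g x ∈ xs) → map f xs ↭ xs
  injection-permutes {xs} f g inj fg unique f-closed g-closed =
    ∼bag⇒↭ (unique∧set⇒bag (Unique.map⁺ inj unique) unique (mk⇔ to from))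
    where
    to : ∀ {y} → y ∈ map f xs → y ∈ xs
    to y∈ with ∈-map⁻ f y∈
    ... | _ , x∈xs , refl = f-closed x∈xs
    from : ∀ {y} → y ∈ xs → y ∈ map f xs
    from {y} y∈ = subst (_∈ map f xs) (fg y) (∈-map⁺ f (g-closed y∈))

  -- Translation by 1 permutes the field, so the sum of all elements equals itself plus |F| times 1.
  card×1≡0 : length elements ×ⁿ 1# ≡ 0#
  card×1≡0 = +-cancelˡ (sum elements) (trans (sym (sum-shift elements)) (trans (Perm.foldr-commMonoid CR.+-isCommutativeMonoid (↭⇒↭ₛ shifted)) (sym (+-identityʳ _))))
    where
    sum : List Carrier → Carrier
    sum = foldr _+_ 0#
    sum-shift : ∀ xs → sum (map (1# +_) xs) ≡ sum xs + length xs ×ⁿ 1#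
    sum-shift []       = sym (+-identityˡ 0#)
    sum-shift (x ∷ xs) = trans (cong (_+_ (1# + x)) (sum-shift xs))
      (solve 4 (λ o x s n → (o :+ x) :+ (s :+ n) := (x :+ s) :+ (o :+ n)) refl 1# x (sum xs) (length xs ×ⁿ 1#))
    shifted : map (1# +_) elements ↭ elements
    shifted = injection-permutes (1# +_) (- 1# +_) (+-cancelˡ 1#)
      (solve 1 (λ x → :1 :+ (:- :1 :+ x) := x) refl)
      elements-unique (λ _ → elements-complete _) (λ _ → elements-complete _)

  nonzero-elements : Σ[ xs ∈ List Carrier ] elements ↭ 0# ∷ xs
  nonzero-elements with ∈-∃++ (elements-complete 0#)
  ... | ys , zs , eq = ys ++ zs , subst (_↭ 0# ∷ ys ++ zs) (sym eq) (shift 0# ys zs)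

  units : List Carrier
  units = proj₁ nonzero-elements

  length-units : suc (length units) ≡ length elements
  length-units = sym (↭-length (proj₂ nonzero-elements))

  0∷units-unique : Unique (0# ∷ units)
  0∷units-unique = Perm.Unique-resp-↭ (↭⇒↭ₛ (proj₂ nonzero-elements)) elements-unique

  units-unique : Unique units
  units-unique with 0∷units-unique
  ... | _ ∷ u = u

  units-nonzero : All (_≢ 0#) units
  units-nonzero with 0∷units-unique
  ... | ne ∷ _ = All.map (λ 0≢x x≡0 → 0≢x (sym x≡0)) ne

  nonzero⇒unit : ∀ {x} → x ≢ 0# → x ∈ units
  nonzero⇒unit {x} x≢0 with ∈-resp-↭ (proj₂ nonzero-elements) (elements-complete x)
  ... | here x≡0 = contradiction x≡0 x≢0
  ... | there x∈ = x∈

  -- Multiplication by `x` permutes the units; compare the product of all units before and after,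
  -- and cancel it.
  pow-length-units : ∀ {x} → x ≢ 0# → pow F x (length units) ≡ 1#
  pow-length-units {x} x≢0 = *-cancelˡ (product-nonzero units-nonzero) (begin
    product units * pow F x (length units)  ≡⟨ *-comm _ _ ⟩
    pow F x (length units) * product units  ≡⟨ product-scale units ⟨
    product (map (x *_) units)              ≡⟨ Perm.foldr-commMonoid CR.*-isCommutativeMonoid (↭⇒↭ₛ scaled) ⟩
    product units                           ≡⟨ *-identityʳ _ ⟨
    product units * 1#                      ∎)
    where
    open ≡-Reasoning
    product : List Carrier → Carrier
    product = foldr _*_ 1#
    product-nonzero : ∀ {xs} → All (_≢ 0#) xs → product xs ≢ 0#
    product-nonzero []         1≡0 = 0≢1 (sym 1≡0)
    product-nonzero (x≢0 ∷ ne) = *-nonzero x≢0 (product-nonzero ne)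
    product-scale : ∀ xs → product (map (x *_) xs) ≡ pow F x (length xs) * product xs
    product-scale []       = sym (*-identityˡ 1#)
    product-scale (y ∷ xs) = trans (cong (x * y *_) (product-scale xs))
      (solve 4 (λ x y u v → x :* y :* (u :* v) := x :* u :* (y :* v)) refl x y (pow F x (length xs)) (product xs))
    scaled : map (x *_) units ↭ units
    scaled = injection-permutes (x *_) (x≢0 ⁻¹ *_) (*-cancelˡ x≢0)
      (λ y → trans (sym (*-assoc x _ y)) (trans (cong (_* y) (*-inverseʳ x≢0)) (*-identityˡ y)))
      units-unique
      (λ y∈ → nonzero⇒unit (*-nonzero x≢0 (All.lookup units-nonzero y∈)))
      (λ y∈ → nonzero⇒unit (*-nonzero (⁻¹-nonzero x≢0) (All.lookup units-nonzero y∈)))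

  pow-card : ∀ x → pow F x (length elements) ≡ x
  pow-card x with x ≟ 0#
  ... | yes refl = subst (λ n → pow F 0# n ≡ 0#) length-units (zeroˡ _)
  ... | no x≢0   = subst (λ n → pow F x n ≡ x) length-units (trans (cong (x *_) (pow-length-units x≢0)) (*-identityʳ x))

  ^≡pow : ∀ x n → x ^ n ≡ pow F x n
  ^≡pow x zero    = refl
  ^≡pow x (suc n) = cong (x *_) (^≡pow x n)

  -- Multiples of 1 multiply like their factors and a field has no zero divisors. Applied to |F| =
  -- q², a power of p, this identifies p as the characteristic.
  pow×1≡0⇒×1≡0 : ∀ p k → (p ℕ.^ k) ×ⁿ 1# ≡ 0# → p ×ⁿ 1# ≡ 0#
  pow×1≡0⇒×1≡0 p zero    e = contradiction (sym (trans (sym (+-identityʳ 1#)) e)) 0≢1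
  pow×1≡0⇒×1≡0 p (suc k) e with (p ×ⁿ 1#) ≟ 0#
  ... | yes z = z
  ... | no nz = pow×1≡0⇒×1≡0 p k (*-zero-product nz (trans (sym (×1-homo-* p (p ℕ.^ k))) e))

  module _ {p : ℕ} (p-prime : Prime p) (char : p ×ⁿ 1# ≡ 0#) where

    multiple×≡0 : ∀ {m} → p ∣ m → ∀ x → m ×ⁿ x ≡ 0#
    multiple×≡0 (divides-refl c) x = trans (×ⁿ-1# (c ℕ.* p) x) (trans (cong (_* x) (trans (×1-homo-* c p) (trans (cong ((c ×ⁿ 1#) *_) char) (zeroʳ _)))) (zeroˡ x))

    -- The inner binomial coefficients are multiples of p and vanish, leaving the two end terms.
    frobenius-+ : ∀ x y → pow F (x + y) p ≡ pow F x p + pow F y p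
    frobenius-+ x y = go p refl
      where
      open ≡-Reasoning
      -- Generalising the exponent allows it to be split as a successor, which separates the first,
      -- inner and last binomial terms.
      go : ∀ n → n ≡ p → pow F (x + y) n ≡ pow F x n + pow F y n
      go zero    eq = contradiction (sym eq) (ℕ.≢-nonZero⁻¹ p {{prime⇒nonZero p-prime}})
      go (suc n) refl = begin
        pow F (x + y) (suc n)                             ≡⟨ ^≡pow (x + y) (suc n) ⟨
        (x + y) ^ suc n                                   ≡⟨ Binomial.theorem (suc n) x y ⟩
        T Fin.zero + Sum.sum (λ i → T (Fin.suc i))        ≡⟨ cong (_+_ (T Fin.zero)) (Sum.sum-init-last (λ i → T (Fin.suc i))) ⟩
        T Fin.zero + (Sum.sum (λ i → T (Fin.suc (inject₁ i))) + T (fromℕ (suc n)))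
          ≡⟨ cong (λ s → T Fin.zero + (s + T (fromℕ (suc n)))) (trans (Sum.sum-cong-≗ middle) (Sum.sum-replicate-zero n)) ⟩
        T Fin.zero + (0# + T (fromℕ (suc n)))             ≡⟨ cong₂ (λ s t → s + (0# + t)) bottom top ⟩
        pow F y (suc n) + (0# + pow F x (suc n))          ≡⟨ solve 2 (λ a b → b :+ (:0 :+ a) := a :+ b) refl _ _ ⟩
        pow F x (suc n) + pow F y (suc n)                 ∎
        where
        T : Fin (suc (suc n)) → Carrier
        T = Binomial.binomialTerm x y (suc n)
        middle : ∀ i → T (Fin.suc (inject₁ i)) ≡ 0#
        middle i = multiple×≡0 (prime∣binomial p-prime (suc (toℕ (inject₁ i))) (s≤s z≤n) (s≤s (subst (ℕ._< n) (sym (Fin.toℕ-inject₁ i)) (Fin.toℕ<n i)))) _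
        bottom : T Fin.zero ≡ pow F y (suc n)
        bottom = trans (+-identityʳ _) (trans (*-identityˡ _) (^≡pow y (suc n)))
        top : T (fromℕ (suc n)) ≡ pow F x (suc n)
        top rewrite Fin.toℕ-fromℕ n | nCn≡1 (suc n) | ℕ.n∸n≡0 n = trans (+-identityʳ _) (trans (*-identityʳ _) (^≡pow x (suc n)))

    iterated-frobenius-+ : ∀ k x y → pow F (x + y) (p ℕ.^ k) ≡ pow F x (p ℕ.^ k) + pow F y (p ℕ.^ k)
    iterated-frobenius-+ zero    x y = trans (*-identityʳ _) (sym (cong₂ _+_ (*-identityʳ x) (*-identityʳ y)))
    iterated-frobenius-+ (suc k) x y = begin
      pow F (x + y) (p ℕ.* p ℕ.^ k)                               ≡⟨ pow-* (x + y) p (p ℕ.^ k) ⟩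
      pow F (pow F (x + y) (p ℕ.^ k)) p                           ≡⟨ cong (λ z → pow F z p) (iterated-frobenius-+ k x y) ⟩
      pow F (pow F x (p ℕ.^ k) + pow F y (p ℕ.^ k)) p             ≡⟨ frobenius-+ _ _ ⟩
      pow F (pow F x (p ℕ.^ k)) p + pow F (pow F y (p ℕ.^ k)) p   ≡⟨ cong₂ _+_ (pow-* x p (p ℕ.^ k)) (pow-* y p (p ℕ.^ k)) ⟨
      pow F x (p ℕ.* p ℕ.^ k) + pow F y (p ℕ.* p ℕ.^ k)           ∎
      where open ≡-Reasoning

-- Polynomial functions and the bound on their roots.

module PolynomialFunctions (F : FiniteField) where
  open FieldArithmetic F

  -- The index counts the coefficients of a Horner scheme, so it bounds the degree strictly; zero
  -- leading coefficients are allowed. Equations are pointwise because functions are not compared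
  -- extensionally.
  data IsPolynomial : ℕ → (Carrier → Carrier) → Set where
    empty  : ∀ {f} → (∀ x → f x ≡ 0#) → IsPolynomial 0 f
    horner : ∀ {n f g} c → IsPolynomial n g → (∀ x → f x ≡ c + x * g x) → IsPolynomial (suc n) f

  isPolynomial-resp : ∀ {n f g} → (∀ x → g x ≡ f x) → IsPolynomial n f → IsPolynomial n g
  isPolynomial-resp g≗f (empty f≗0)       = empty (λ x → trans (g≗f x) (f≗0 x))
  isPolynomial-resp g≗f (horner c p f≗)   = horner c p (λ x → trans (g≗f x) (f≗ x))

  isPolynomial-0 : ∀ n → IsPolynomial n (λ _ → 0#)
  isPolynomial-0 zero    = empty (λ _ → refl)
  isPolynomial-0 (suc n) = horner 0# (isPolynomial-0 n) (solve 1 (λ x → :0 := :0 :+ x :* :0) refl)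

  isPolynomial-const : ∀ n c → IsPolynomial (suc n) (λ _ → c)
  isPolynomial-const n c = horner c (isPolynomial-0 n) (solve 2 (λ c x → c := c :+ x :* :0) refl c)

  isPolynomial-+ : ∀ {n f g} → IsPolynomial n f → IsPolynomial n g → IsPolynomial n (λ x → f x + g x)
  isPolynomial-+ (empty f≗0) (empty g≗0) = empty (λ x → trans (cong₂ _+_ (f≗0 x) (g≗0 x)) (+-identityˡ 0#))
  isPolynomial-+ (horner {g = f′} c p f≗) (horner {g = g′} d r g≗) = horner (c + d) (isPolynomial-+ p r)
    (λ x → trans (cong₂ _+_ (f≗ x) (g≗ x)) (solve 5 (λ c d x u v → (c :+ x :* u) :+ (d :+ x :* v) := (c :+ d) :+ x :* (u :+ v)) refl c d x (f′ x) (g′ x)))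

  isPolynomial-scale : ∀ {n f} a → IsPolynomial n f → IsPolynomial n (λ x → a * f x)
  isPolynomial-scale a (empty f≗0) = empty (λ x → trans (cong (a *_) (f≗0 x)) (zeroʳ a))
  isPolynomial-scale a (horner {g = f′} c p f≗) = horner (a * c) (isPolynomial-scale a p)
    (λ x → trans (cong (a *_) (f≗ x)) (solve 4 (λ a c x u → a :* (c :+ x :* u) := a :* c :+ x :* (a :* u)) refl a c x (f′ x)))

  isPolynomial-pow* : ∀ {n f} m → IsPolynomial n f → IsPolynomial (m ℕ.+ n) (λ x → pow F x m * f x)
  isPolynomial-pow* zero    p = isPolynomial-resp (λ x → *-identityˡ _) p
  isPolynomial-pow* {f = f} (suc m) p = horner 0# (isPolynomial-pow* m p)
    (λ x → trans (*-assoc x _ _) (sym (+-identityˡ _)))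

  -- Serves to compose with the norm x ↦ x^(q+1): for n = q - 1 and m = q the count is q² - 1, the
  -- number of units, which is exactly what the root bound can afford.
  isPolynomial-∘-pow : ∀ {n f} m → IsPolynomial n f → IsPolynomial (n ℕ.* suc m) (λ x → f (pow F x (suc m)))
  isPolynomial-∘-pow m (empty f≗0) = empty (λ x → f≗0 (pow F x (suc m)))
  isPolynomial-∘-pow m (horner c p f≗) = isPolynomial-resp (λ x → f≗ (pow F x (suc m)))
    (isPolynomial-+ (isPolynomial-const _ c) (isPolynomial-pow* (suc m) (isPolynomial-∘-pow m p)))

  -- Synthetic division: the quotient of c + x h(x) by x - a is h(x) plus a times the quotient of h.
  divide : ∀ {n f} → IsPolynomial (suc n) f → ∀ a →
    Σ[ g ∈ (Carrier → Carrier) ] (IsPolynomial n g × (∀ x → f x ≡ f a + (x + - a) * g x))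
  divide (horner {g = h} c (empty h≗0) f≗) a = (λ _ → 0#) , isPolynomial-0 0 , λ x →
    trans (const x) (trans (solve 3 (λ c x a → c := c :+ (x :- a) :* :0) refl c x a) (cong (_+ (x + - a) * 0#) (sym (const a))))
    where
    const : ∀ x → _ ≡ c
    const x = trans (f≗ x) (trans (cong (λ t → c + x * t) (h≗0 x)) (solve 2 (λ c x → c :+ x :* :0 := c) refl c x))
  divide {f = f} (horner {g = h} c p@(horner _ _ _) f≗) a with divide p a
  ... | g , pg , h≗ = (λ x → h x + a * g x) , isPolynomial-+ p (weaken (isPolynomial-scale a pg)) , λ x → begin
    f x                                            ≡⟨ f≗ x ⟩
    c + x * h x                                    ≡⟨ solve 4 (λ c x a h → c :+ x :* h := c :+ (a :* h :+ (x :- a) :* h)) refl c x a (h x) ⟩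
    c + (a * h x + (x + - a) * h x)                ≡⟨ cong (λ t → c + (a * t + (x + - a) * h x)) (h≗ x) ⟩
    c + (a * (h a + (x + - a) * g x) + (x + - a) * h x)
      ≡⟨ solve 6 (λ c x a u g h → c :+ (a :* (u :+ (x :- a) :* g) :+ (x :- a) :* h) := (c :+ a :* u) :+ (x :- a) :* (h :+ a :* g)) refl c x a (h a) (g x) (h x) ⟩
    (c + a * h a) + (x + - a) * (h x + a * g x)    ≡⟨ cong (_+ (x + - a) * (h x + a * g x)) (f≗ a) ⟨
    f a + (x + - a) * (h x + a * g x)              ∎
    where
    open ≡-Reasoning
    weaken : ∀ {n f} → IsPolynomial n f → IsPolynomial (suc n) f
    weaken (empty f≗0) = horner 0# (isPolynomial-0 0) (λ x → trans (f≗0 x) (solve 1 (λ x → :0 := :0 :+ x :* :0) refl x))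
    weaken (horner c p f≗) = horner c (weaken p) f≗

  -- Each root splits off a linear factor and lowers the number of coefficients by one; the other
  -- roots, being distinct from it, are roots of the quotient.
  many-roots⇒zero : ∀ {n f} → IsPolynomial n f → ∀ {xs} → Unique xs → All (λ x → f x ≡ 0#) xs →
    n ℕ.≤ length xs → ∀ x → f x ≡ 0#
  many-roots⇒zero (empty f≗0) _ _ _ = f≗0
  many-roots⇒zero {f = f} p@(horner _ _ _) {a ∷ xs} (a∉xs ∷ unique) (fa≡0 ∷ roots) (s≤s n≤) x with divide p a
  ... | g , pg , f≗ = trans (f≗ x) (trans (cong₂ (λ s t → s + (x + - a) * t) fa≡0 (many-roots⇒zero pg unique (quotient-roots a∉xs roots) n≤ x)) (solve 2 (λ x a → :0 :+ (x :- a) :* :0 := :0) refl x a))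
    where
    quotient-roots : ∀ {ys} → All (a ≢_) ys → All (λ y → f y ≡ 0#) ys → All (λ y → g y ≡ 0#) ys
    quotient-roots [] [] = []
    quotient-roots {y ∷ _} (a≢y ∷ ns) (fy≡0 ∷ rs) =
      *-zero-product (λ y-a≡0 → a≢y (sym (x-y≡0⇒x≡y y-a≡0)))
        (trans (sym (+-identityˡ _)) (trans (cong (_+ (y + - a) * g y) (sym fa≡0)) (trans (sym (f≗ y)) fy≡0)))
      ∷ quotient-roots ns rs

-- The quadratic extension GF(q²) of GF(q).

¬2∣⇒odd : ∀ {q} → ¬ (2 ∣ q) → ∃[ m ] q ≡ suc (m ℕ.+ m)
¬2∣⇒odd {q} ¬2∣q with q ℕ/.% 2 in eq | ℕ/.m%n<n q 2 | ℕ/.m≡m%n+[m/n]*n q 2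
... | 0 | _ | _ = contradiction (ℕ∣.m%n≡0⇒n∣m q 2 eq) ¬2∣q
... | 1 | _ | q≡ = q ℕ/./ 2 , trans q≡ (cong suc (trans (ℕ.*-comm (q ℕ/./ 2) 2) (cong (q ℕ/./ 2 ℕ.+_) (ℕ.+-identityʳ _))))
... | suc (suc _) | s≤s (s≤s ()) | _

module QuadraticExtension (F : FiniteField) (q : ℕ) (q-oddPrimePower : IsOddPrimePower q) (card : length (FiniteField.elements F) ≡ q ℕ.* q) where
  open FieldArithmetic F public
  open FiniteFieldTheory F
  open PolynomialFunctions F

  infixl 9 _ᶜ
  _ᶜ : Carrier → Carrier
  x ᶜ = conj F q x

  K : Carrier → Set
  K = InSubfield F q

  private
    q-odd : ∃[ m ] q ≡ suc (m ℕ.+ m)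
    q-odd = ¬2∣⇒odd (proj₂ q-oddPrimePower)

    char-spec : ∃[ p ] ∃[ k ] (Prime p × p ×ⁿ 1# ≡ 0# × 1 ℕ.≤ k × q ≡ p ℕ.^ k)
    char-spec with proj₁ q-oddPrimePower
    ... | p , k , pp , 1≤k , q≡ = p , k , pp , pow×1≡0⇒×1≡0 p (k ℕ.+ k) (trans (cong (_×ⁿ 1#) (trans (ℕ.^-distribˡ-+-* p k k) (sym (trans card (cong₂ ℕ._*_ q≡ q≡))))) card×1≡0) , 1≤k , q≡

  -- If 2 vanished, q times 1 would be 1 because q is odd; but q is a positive power of the
  -- characteristic, so q times 1 is 0.
  1+1≢0 : 1# + 1# ≢ 0#
  1+1≢0 2≡0 = go char-spec
    where
    open ≡-Reasoning
    m = proj₁ q-odd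
    even : ∀ m → (m ℕ.+ m) ×ⁿ 1# ≡ (1# + 1#) * (m ×ⁿ 1#)
    even zero    = sym (zeroʳ _)
    even (suc m) rewrite ℕ.+-suc m m = trans (cong (λ t → 1# + (1# + t)) (even m)) (solve 1 (λ u → :1 :+ (:1 :+ :2 :* u) := :2 :* (:1 :+ u)) refl (m ×ⁿ 1#))
    go : ∃[ p ] ∃[ k ] (Prime p × p ×ⁿ 1# ≡ 0# × 1 ℕ.≤ k × q ≡ p ℕ.^ k) → ⊥
    go (p , suc k , pp , p≡0 , _ , q≡) = 0≢1 (begin
      0#                            ≡⟨ trans (cong (_* ((p ℕ.^ k) ×ⁿ 1#)) p≡0) (zeroˡ _) ⟨
      (p ×ⁿ 1#) * ((p ℕ.^ k) ×ⁿ 1#) ≡⟨ ×1-homo-* p (p ℕ.^ k) ⟨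
      (p ℕ.^ suc k) ×ⁿ 1#           ≡⟨ cong (_×ⁿ 1#) q≡ ⟨
      q ×ⁿ 1#                       ≡⟨ cong (_×ⁿ 1#) (proj₂ q-odd) ⟩
      1# + (m ℕ.+ m) ×ⁿ 1#          ≡⟨ cong (1# +_) (trans (even m) (trans (cong (_* (m ×ⁿ 1#)) 2≡0) (zeroˡ _))) ⟩
      1# + 0#                       ≡⟨ +-identityʳ 1# ⟩
      1#                            ∎)

  conj-+ : ∀ x y → (x + y) ᶜ ≡ x ᶜ + y ᶜ
  conj-+ x y =
    let p , k , pp , p≡0 , _ , q≡ = char-spec
    in subst (λ n → pow F (x + y) n ≡ pow F x n + pow F y n) (sym q≡) (iterated-frobenius-+ pp p≡0 k x y)

  conj-* : ∀ x y → (x * y) ᶜ ≡ x ᶜ * y ᶜ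
  conj-* x y = pow-distrib-* x y q

  -- Two applications raise x to the power q² = |F|, which fixes every element.
  conj-involutive : ∀ x → x ᶜ ᶜ ≡ x
  conj-involutive x = trans (sym (pow-* x q q)) (trans (cong (pow F x) (sym card)) (pow-card x))

  conj-1 : 1# ᶜ ≡ 1#
  conj-1 = pow-1# q

  conj-0 : 0# ᶜ ≡ 0#
  conj-0 = pow-0# (λ q≡0 → ℕ.1+n≢0 (trans (sym (proj₂ q-odd)) q≡0))

  conj-neg : ∀ x → (- x) ᶜ ≡ - (x ᶜ)
  conj-neg x = x-y≡0⇒x≡y (begin
    (- x) ᶜ + - - (x ᶜ)  ≡⟨ cong ((- x) ᶜ +_) (-‿involutive _) ⟩
    (- x) ᶜ + x ᶜ        ≡⟨ conj-+ (- x) x ⟨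
    (- x + x) ᶜ          ≡⟨ cong _ᶜ (-‿inverseˡ x) ⟩
    0# ᶜ                 ≡⟨ conj-0 ⟩
    0#                   ∎)
    where open ≡-Reasoning

  conj-nonzero : ∀ {x} → x ≢ 0# → x ᶜ ≢ 0#
  conj-nonzero = pow-nonzero q

  K-0 : K 0#
  K-0 = conj-0

  K-1 : K 1#
  K-1 = conj-1

  K-+ : ∀ {x y} → K x → K y → K (x + y)
  K-+ x∈K y∈K = trans (conj-+ _ _) (cong₂ _+_ x∈K y∈K)

  K-* : ∀ {x y} → K x → K y → K (x * y)
  K-* x∈K y∈K = trans (conj-* _ _) (cong₂ _*_ x∈K y∈K)

  K-neg : ∀ {x} → K x → K (- x)
  K-neg x∈K = trans (conj-neg _) (cong -_ x∈K)

  K-⁻¹ : ∀ {x} (x≢0 : x ≢ 0#) → K x → K (x≢0 ⁻¹)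
  K-⁻¹ {x} x≢0 x∈K = *-cancelˡ x≢0 (begin
    x * x≢0 ⁻¹ ᶜ     ≡⟨ cong (_* x≢0 ⁻¹ ᶜ) x∈K ⟨
    x ᶜ * x≢0 ⁻¹ ᶜ   ≡⟨ conj-* x _ ⟨
    (x * x≢0 ⁻¹) ᶜ   ≡⟨ cong _ᶜ (*-inverseʳ x≢0) ⟩
    1# ᶜ             ≡⟨ conj-1 ⟩
    1#               ≡⟨ *-inverseʳ x≢0 ⟨
    x * x≢0 ⁻¹       ∎)
    where open ≡-Reasoning

  K-trace : ∀ x → K (x + x ᶜ)
  K-trace x = trans (conj-+ _ _) (trans (cong (x ᶜ +_) (conj-involutive x)) (+-comm _ _))

  private
    -- r = q - 1
    r : ℕ
    r = proj₁ q-odd ℕ.+ proj₁ q-odd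

    q≡1+r : q ≡ suc r
    q≡1+r = proj₂ q-odd

    -- The factorisation q² - 1 = (q - 1)(q + 1), needed to write x^(q²-1) as a power of the norm of
    -- x.
    length-units≡ : length units ≡ r ℕ.* suc q
    length-units≡ = ℕ.suc-injective (trans length-units (trans card (subst (λ n → n ℕ.* n ≡ suc (r ℕ.* suc n)) (sym q≡1+r) (identity r))))
      where
      open Data.Nat.Solver.+-*-Solver renaming (solve to solveℕ; _:+_ to _:+ⁿ_; _:*_ to _:*ⁿ_; _:=_ to _:=ⁿ_; con to conⁿ)
      identity : ∀ r → suc r ℕ.* suc r ≡ suc (r ℕ.* suc (suc r))
      identity = solveℕ 1 (λ r → (conⁿ 1 :+ⁿ r) :*ⁿ (conⁿ 1 :+ⁿ r) :=ⁿ conⁿ 1 :+ⁿ r :*ⁿ (conⁿ 2 :+ⁿ r)) refl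

    r≢0 : r ≢ 0
    r≢0 r≡0 = nonempty (nonzero⇒unit (λ 1≡0 → 0≢1 (sym 1≡0))) (trans length-units≡ (cong (ℕ._* suc q) r≡0))
      where
      nonempty : ∀ {x} {xs : List Carrier} → x ∈ xs → length xs ≢ 0
      nonempty (here _)  ()
      nonempty (there _) ()

    -- The nonzero elements of `K` are roots while 0 is not; the nonzero value at 0 is what
    -- contradicts an excess of roots.
    monomial-1 : IsPolynomial (suc r) (λ x → pow F x r + - 1#)
    monomial-1 = isPolynomial-+ (isPolynomial-resp (λ x → sym (*-identityʳ _)) (subst (λ n → IsPolynomial n (λ x → pow F x r * 1#)) (ℕ.+-comm r 1) (isPolynomial-pow* r (isPolynomial-const 0 1#))))
      (isPolynomial-const r (- 1#))

    monomial-1-at-0 : pow F 0# r + - 1# ≢ 0#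
    monomial-1-at-0 e = 0≢1 (trans (sym (pow-0# r≢0)) (x-y≡0⇒x≡y e))

    K⇒pow-r : ∀ {x} → x ≢ 0# → K x → pow F x r ≡ 1#
    K⇒pow-r {x} x≢0 x∈K = *-cancelˡ x≢0 (trans (trans (cong (pow F x) (sym q≡1+r)) x∈K) (sym (*-identityʳ x)))

    r<length-units : suc r ℕ.≤ length units
    r<length-units = subst (suc r ℕ.≤_) (sym length-units≡) (subst (λ n → suc r ℕ.≤ r ℕ.* suc n) (sym q≡1+r) (bound r r≢0))
      where
      bound : ∀ r → r ≢ 0 → suc r ℕ.≤ r ℕ.* suc (suc r)
      bound zero    r≢0 = contradiction refl r≢0
      bound (suc r) _   = ℕ.≤-trans (ℕ.n≤1+n _) (ℕ.m≤m+n (suc (suc (suc r))) _)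

  abstract
    -- Otherwise all q² - 1 units would be roots of Y^(q-1) - 1, which has only q coefficients.
    ∃-outside-K : ∃[ x ] (x ᶜ ≢ x)
    ∃-outside-K with All.all? (λ x → (x ᶜ) ≟ x) units
    ... | no ¬all = satisfied (All.¬All⇒Any¬ (λ x → (x ᶜ) ≟ x) units ¬all)
    ... | yes all = contradiction (many-roots⇒zero monomial-1 units-unique roots r<length-units 0#) monomial-1-at-0
      where
      roots : All (λ x → pow F x r + - 1# ≡ 0#) units
      roots = All.zipWith (λ (x≢0 , x∈K) → trans (cong (_+ - 1#) (K⇒pow-r x≢0 x∈K)) (-‿inverseʳ 1#)) (units-nonzero , all)

  -- An element of trace zero. Together with 1 it is a basis of the field over `K`, and
  -- multiplication by it carries elements of trace zero into `K`.
  δ : Carrier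
  δ = proj₁ ∃-outside-K + - (proj₁ ∃-outside-K ᶜ)

  δ≢0 : δ ≢ 0#
  δ≢0 δ≡0 = proj₂ ∃-outside-K (sym (x-y≡0⇒x≡y δ≡0))

  conj-difference : ∀ x → (x + - (x ᶜ)) ᶜ ≡ - (x + - (x ᶜ))
  conj-difference x = trans (conj-+ _ _) (trans (cong (x ᶜ +_) (trans (conj-neg _) (cong -_ (conj-involutive x))))
    (solve 2 (λ x y → y :- x := :- (x :- y)) refl x (x ᶜ)))

  conj-δ : δ ᶜ ≡ - δ
  conj-δ = conj-difference _

  abstract
    -- For c ∈ K*, write Y^(q-1) - 1 = (Y - c) g(Y).  If c is not a norm, all q² - 1
    -- nonzero x are roots of g(x^(q+1)), which has only q² - 1 coefficients, yet g(0) ≠ 0.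
    norm-surjective : ∀ {c} → K c → ∃[ z ] z * z ᶜ ≡ c
    norm-surjective {c} c∈K with c ≟ 0#
    ... | yes refl = 0# , zeroˡ _
    ... | no c≢0 with Any.any? (λ z → (z * z ᶜ) ≟ c) units
    ...   | yes found = satisfied found
    ...   | no ¬found with divide monomial-1 c
    ...     | g , g-poly , g-spec = contradiction g0≡0 g0≢0
      where
      c-root : pow F c r + - 1# ≡ 0#
      c-root = trans (cong (_+ - 1#) (K⇒pow-r c≢0 c∈K)) (-‿inverseʳ 1#)
      factor : ∀ x → pow F x r + - 1# ≡ (x + - c) * g x
      factor x = trans (g-spec x) (trans (cong (_+ (x + - c) * g x) c-root) (+-identityˡ _))
      roots : All (λ x → g (pow F x (suc q)) ≡ 0#) units
      roots = All.zipWith (λ {x} (x≢0 , Nx≢c) → *-zero-product (λ e → Nx≢c (x-y≡0⇒x≡y e))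
        (trans (sym (factor (pow F x (suc q)))) (trans (cong (_+ - 1#) (trans (sym (pow-* x r (suc q))) (trans (cong (pow F x) (sym length-units≡)) (pow-length-units x≢0)))) (-‿inverseʳ 1#))))
        (units-nonzero , All.¬Any⇒All¬ units ¬found)
      g0≡0 : g 0# ≡ 0#
      g0≡0 = trans (cong g (sym (pow-0# {suc q} (λ ())))) (many-roots⇒zero (isPolynomial-∘-pow q g-poly) units-unique roots (ℕ.≤-reflexive (sym length-units≡)) 0#)
      g0≢0 : g 0# ≢ 0#
      g0≢0 e = monomial-1-at-0 (trans (factor 0#) (trans (cong ((0# + - c) *_) e) (zeroʳ _)))

    sqrt : ∀ {c} → K c → ∃[ s ] s * s ≡ c
    sqrt {c} c∈K with norm-surjective c∈K
    ... | z , Nz≡c = pow F z (suc m) , trans (sym (pow-+ z (suc m) (suc m))) (trans (cong (pow F z) suc-q≡) Nz≡c)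
      where
      m : ℕ
      m = proj₁ q-odd
      suc-q≡ : suc m ℕ.+ suc m ≡ suc q
      suc-q≡ = cong suc (trans (ℕ.+-suc m m) (sym q≡1+r))

-- Isotropy of ternary quadratic forms over GF(q).

module TernaryForms (F : FiniteField) (q : ℕ) (q-oddPrimePower : IsOddPrimePower q) (card : length (FiniteField.elements F) ≡ q ℕ.* q) where
  open QuadraticExtension F q q-oddPrimePower card

  abstract
    Isotropic-diagonal : Carrier → Carrier → Set
    Isotropic-diagonal m n = ∃[ x ] ∃[ y ] ∃[ z ] (K x × K y × K z × ¬ (x ≡ 0# × y ≡ 0# × z ≡ 0#) × x * x + m * (y * y) + n * (z * z) ≡ 0#)

    split-diagonal : ∀ {m n s} → K s → s * s ≡ - m → Isotropic-diagonal m n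
    split-diagonal {m} {n} {s} s∈K s²≡-m = s , 1# , 0# , s∈K , K-1 , K-0 , (λ (_ , 1≡0 , _) → 0≢1 (sym 1≡0)) ,
      trans (cong (λ t → t + m * (1# * 1#) + n * (0# * 0#)) s²≡-m) (solve 2 (λ m n → :- m :+ m :* (:1 :* :1) :+ n :* (:0 :* :0) := :0) refl m n)

    -- For x, y in `K` the norm of x + sy is x² + my². Taking x + sy = 2z with N(z) = -n gives the
    -- value -4n, which the third coordinate 2 cancels.
    nonsplit-diagonal : ∀ {m n s z} → K m → s ᶜ ≢ s → s * s ≡ - m → z * z ᶜ ≡ - n → Isotropic-diagonal m n
    nonsplit-diagonal {m} {n} {s} {z} m∈K s∉K s²≡-m Nz≡-n =
      z + z ᶜ , (z + - (z ᶜ)) * i , 1# + 1# , K-trace z , y∈K , K-+ K-1 K-1 , (λ (_ , _ , 2≡0) → 1+1≢0 2≡0) , equation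
      where
      open ≡-Reasoning
      conj-s² : (s ᶜ) * (s ᶜ) ≡ s * s
      conj-s² = trans (sym (conj-* s s)) (trans (cong _ᶜ s²≡-m) (trans (K-neg m∈K) (sym s²≡-m)))
      -- Both s and its conjugate are square roots of -m, and they differ.
      conj-s : s ᶜ ≡ - s
      conj-s = x-y≡0⇒x≡y (*-zero-product {s ᶜ + - s} (λ e → s∉K (x-y≡0⇒x≡y e))
        (trans (solve 2 (λ a b → (a :- b) :* (a :- (:- b)) := a :* a :- b :* b) refl (s ᶜ) s) (trans (cong (_+ - (s * s)) conj-s²) (-‿inverseʳ _))))
      s≢0 : s ≢ 0#
      s≢0 s≡0 = s∉K (trans (cong _ᶜ s≡0) (trans conj-0 (sym s≡0)))
      i : Carrier
      i = s≢0 ⁻¹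
      conj-i : i ᶜ ≡ - i
      conj-i = *-cancelˡ (-‿nonzero s≢0) (begin
        - s * i ᶜ   ≡⟨ cong (_* i ᶜ) conj-s ⟨
        s ᶜ * i ᶜ   ≡⟨ conj-* s i ⟨
        (s * i) ᶜ   ≡⟨ cong _ᶜ (*-inverseʳ s≢0) ⟩
        1# ᶜ        ≡⟨ conj-1 ⟩
        1#          ≡⟨ *-inverseʳ s≢0 ⟨
        s * i       ≡⟨ solve 2 (λ s i → s :* i := :- s :* :- i) refl s i ⟩
        - s * - i   ∎)
      y∈K : K ((z + - (z ᶜ)) * i)
      y∈K = trans (conj-* _ i) (trans (cong₂ _*_ (conj-difference z) conj-i) (solve 2 (λ d i → :- d :* :- i := d :* i) refl (z + - (z ᶜ)) i))
      m≡ : m ≡ - (s * s)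
      m≡ = trans (sym (-‿involutive m)) (cong -_ (sym s²≡-m))
      n≡ : n ≡ - (z * z ᶜ)
      n≡ = trans (sym (-‿involutive n)) (cong -_ (sym Nz≡-n))
      expand : ∀ s i z w → (z + w) * (z + w) + - (s * s) * ((z + - w) * i * ((z + - w) * i)) + - (z * w) * ((1# + 1#) * (1# + 1#))
        ≡ (z + - w) * (z + - w) * (1# + - ((s * i) * (s * i)))
      expand = solve 4 (λ s i z w → (z :+ w) :* (z :+ w) :+ :- (s :* s) :* ((z :- w) :* i :* ((z :- w) :* i)) :+ :- (z :* w) :* (:2 :* :2)
        := (z :- w) :* (z :- w) :* (:1 :- (s :* i) :* (s :* i))) refl
      equation : (z + z ᶜ) * (z + z ᶜ) + m * ((z + - (z ᶜ)) * i * ((z + - (z ᶜ)) * i)) + n * ((1# + 1#) * (1# + 1#)) ≡ 0#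
      equation = begin
        (z + z ᶜ) * (z + z ᶜ) + m * ((z + - (z ᶜ)) * i * ((z + - (z ᶜ)) * i)) + n * ((1# + 1#) * (1# + 1#))
          ≡⟨ cong₂ (λ u v → (z + z ᶜ) * (z + z ᶜ) + u * ((z + - (z ᶜ)) * i * ((z + - (z ᶜ)) * i)) + v * ((1# + 1#) * (1# + 1#))) m≡ n≡ ⟩
        (z + z ᶜ) * (z + z ᶜ) + - (s * s) * ((z + - (z ᶜ)) * i * ((z + - (z ᶜ)) * i)) + - (z * z ᶜ) * ((1# + 1#) * (1# + 1#))
          ≡⟨ expand s i z (z ᶜ) ⟩
        (z + - (z ᶜ)) * (z + - (z ᶜ)) * (1# + - ((s * i) * (s * i)))
          ≡⟨ cong (λ t → (z + - (z ᶜ)) * (z + - (z ᶜ)) * (1# + - (t * t))) (*-inverseʳ s≢0) ⟩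
        (z + - (z ᶜ)) * (z + - (z ᶜ)) * (1# + - (1# * 1#))
          ≡⟨ solve 1 (λ d → d :* d :* (:1 :- :1 :* :1) := :0) refl (z + - (z ᶜ)) ⟩
        0# ∎

    diagonal-isotropic : ∀ {m n} → K m → K n → Isotropic-diagonal m n
    diagonal-isotropic {m} {n} m∈K n∈K = split (sqrt (K-neg m∈K)) (norm-surjective (K-neg n∈K))
      where
      split : ∃[ s ] s * s ≡ - m → ∃[ z ] z * z ᶜ ≡ - n → Isotropic-diagonal m n
      split (s , s²≡-m) (z , Nz≡-n) with (s ᶜ) ≟ s
      ... | yes s∈K = split-diagonal s∈K s²≡-m
      ... | no s∉K  = nonsplit-diagonal m∈K s∉K s²≡-m Nz≡-n

    solve-linear : ∀ {a} (a≢0 : a ≢ 0#) b → a * (a≢0 ⁻¹ * b) ≡ b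
    solve-linear {a} a≢0 b = trans (sym (*-assoc a _ b)) (trans (cong (_* b) (*-inverseʳ a≢0)) (*-identityˡ b))

    -- Completing the square twice turns 16aA times the form into Y² + 4A X² + D Z², and a zero of
    -- that diagonal form is pulled back. The cases a = 0 and A = 0 have explicit zeros.
    ternary-isotropic : ∀ {a b c d e f} → K a → K b → K c → K d → K e → K f →
      ∃[ x ] ∃[ y ] ∃[ z ] (K x × K y × K z × ¬ (x ≡ 0# × y ≡ 0# × z ≡ 0#) ×
        a * (x * x) + b * (y * y) + c * (z * z) + d * (x * y) + e * (x * z) + f * (y * z) ≡ 0#)
    ternary-isotropic {a} {b} {c} {d} {e} {f} a∈K b∈K c∈K d∈K e∈K f∈K = result (a ≟ 0#) (A ≟ 0#)
      where
      open ≡-Reasoning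
      -- A, B and G are the coefficients in y and z left by the first completed square; D is the
      -- coefficient of z² left by the second.
      2# 4# A B G D : Carrier
      2# = 1# + 1#
      4# = 2# * 2#
      2∈K : K 2#
      2∈K = K-+ K-1 K-1
      4∈K : K 4#
      4∈K = K-* 2∈K 2∈K
      A = 4# * a * b + - (d * d)
      B = 4# * a * f + - (2# * d * e)
      G = 4# * a * c + - (e * e)
      D = 4# * A * G + - (B * B)
      A∈K : K A
      A∈K = K-+ (K-* (K-* 4∈K a∈K) b∈K) (K-neg (K-* d∈K d∈K))
      B∈K : K B
      B∈K = K-+ (K-* (K-* 4∈K a∈K) f∈K) (K-neg (K-* (K-* 2∈K d∈K) e∈K))
      G∈K : K G
      G∈K = K-+ (K-* (K-* 4∈K a∈K) c∈K) (K-neg (K-* e∈K e∈K))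
      D∈K : K D
      D∈K = K-+ (K-* (K-* 4∈K A∈K) G∈K) (K-neg (K-* B∈K B∈K))

      form : Carrier → Carrier → Carrier → Carrier
      form x y z = a * (x * x) + b * (y * y) + c * (z * z) + d * (x * y) + e * (x * z) + f * (y * z)

      4≢0 : 4# ≢ 0#
      4≢0 = *-nonzero 1+1≢0 1+1≢0

      square₁ : ∀ x y z → 4# * a * form x y z ≡ (2# * a * x + (d * y + e * z)) * (2# * a * x + (d * y + e * z)) + (A * (y * y) + B * (y * z) + G * (z * z))
      square₁ = solve 9 (λ a b c d e f x y z →
        :2 :* :2 :* a :* (a :* (x :* x) :+ b :* (y :* y) :+ c :* (z :* z) :+ d :* (x :* y) :+ e :* (x :* z) :+ f :* (y :* z))
        := (:2 :* a :* x :+ (d :* y :+ e :* z)) :* (:2 :* a :* x :+ (d :* y :+ e :* z))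
           :+ ((:2 :* :2 :* a :* b :- d :* d) :* (y :* y) :+ (:2 :* :2 :* a :* f :- :2 :* d :* e) :* (y :* z) :+ (:2 :* :2 :* a :* c :- e :* e) :* (z :* z)))
        refl a b c d e f

      square₂ : ∀ A B G y z → 4# * A * (A * (y * y) + B * (y * z) + G * (z * z)) ≡ (2# * A * y + B * z) * (2# * A * y + B * z) + (4# * A * G + - (B * B)) * (z * z)
      square₂ = solve 5 (λ A B G y z → :2 :* :2 :* A :* (A :* (y :* y) :+ B :* (y :* z) :+ G :* (z :* z))
        := (:2 :* A :* y :+ B :* z) :* (:2 :* A :* y :+ B :* z) :+ (:2 :* :2 :* A :* G :- B :* B) :* (z :* z)) refl

      Isotropic : Set
      Isotropic = ∃[ x ] ∃[ y ] ∃[ z ] (K x × K y × K z × ¬ (x ≡ 0# × y ≡ 0# × z ≡ 0#) × form x y z ≡ 0#)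

      case-a≡0 : a ≡ 0# → Isotropic
      case-a≡0 a≡0 = 1# , 0# , 0# , K-1 , K-0 , K-0 , (λ (1≡0 , _) → 0≢1 (sym 1≡0)) ,
        trans (solve 6 (λ a b c d e f → a :* (:1 :* :1) :+ b :* (:0 :* :0) :+ c :* (:0 :* :0) :+ d :* (:1 :* :0) :+ e :* (:1 :* :0) :+ f :* (:0 :* :0) := a) refl a b c d e f) a≡0

      case-A≡0 : a ≢ 0# → A ≡ 0# → Isotropic
      -- For z = 0 and A = 0, 4a times the form is the square of 2ax + dy, which vanishes at y = 1,
      -- x = -d/(2a).
      case-A≡0 a≢0 A≡0 = x , 1# , 0# , x∈K , K-1 , K-0 , (λ (_ , 1≡0 , _) → 0≢1 (sym 1≡0)) ,
        *-zero-product (*-nonzero 4≢0 a≢0) (begin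
          4# * a * form x 1# 0#    ≡⟨ square₁ x 1# 0# ⟩
          (2# * a * x + (d * 1# + e * 0#)) * (2# * a * x + (d * 1# + e * 0#)) + (A * (1# * 1#) + B * (1# * 0#) + G * (0# * 0#))
            ≡⟨ cong₂ (λ u v → (u + (d * 1# + e * 0#)) * (u + (d * 1# + e * 0#)) + (v * (1# * 1#) + B * (1# * 0#) + G * (0# * 0#))) (solve-linear 2a≢0 (- d)) A≡0 ⟩
          (- d + (d * 1# + e * 0#)) * (- d + (d * 1# + e * 0#)) + (0# * (1# * 1#) + B * (1# * 0#) + G * (0# * 0#))
            ≡⟨ solve 4 (λ d e B G → (:- d :+ (d :* :1 :+ e :* :0)) :* (:- d :+ (d :* :1 :+ e :* :0)) :+ (:0 :* (:1 :* :1) :+ B :* (:1 :* :0) :+ G :* (:0 :* :0)) := :0) refl d e B G ⟩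
          0# ∎)
        where
        2a≢0 : 2# * a ≢ 0#
        2a≢0 = *-nonzero 1+1≢0 a≢0
        x : Carrier
        x = 2a≢0 ⁻¹ * - d
        x∈K : K x
        x∈K = K-* (K-⁻¹ 2a≢0 (K-* 2∈K a∈K)) (K-neg d∈K)

      case-generic : a ≢ 0# → A ≢ 0# → Isotropic-diagonal (4# * A) D → Isotropic
      -- Y comes first because its square has coefficient 1 in the diagonal form, whereas that of X
      -- has coefficient 4A.
      case-generic a≢0 A≢0 (Y , X , Z , Y∈K , X∈K , Z∈K , nontrivial , zero-eq) = x , y , Z , x∈K , y∈K , Z∈K , nontrivial′ ,
        *-zero-product (*-nonzero (*-nonzero 4≢0 A≢0) (*-nonzero 4≢0 a≢0)) (begin
          4# * A * (4# * a) * form x y Z      ≡⟨ *-assoc (4# * A) (4# * a) (form x y Z) ⟩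
          4# * A * (4# * a * form x y Z)      ≡⟨ cong (4# * A *_) (trans (square₁ x y Z) (cong (λ u → u * u + R) X≡)) ⟩
          4# * A * (X * X + R)                ≡⟨ distribˡ (4# * A) (X * X) R ⟩
          4# * A * (X * X) + 4# * A * R       ≡⟨ cong (4# * A * (X * X) +_) (trans (square₂ A B G y Z) (cong (λ u → u * u + D * (Z * Z)) Y≡)) ⟩
          4# * A * (X * X) + (Y * Y + D * (Z * Z)) ≡⟨ solve 3 (λ u v w → u :+ (v :+ w) := v :+ u :+ w) refl _ _ _ ⟩
          Y * Y + 4# * A * (X * X) + D * (Z * Z)   ≡⟨ zero-eq ⟩
          0#                                  ∎)
        where
        2A≢0 : 2# * A ≢ 0#
        2A≢0 = *-nonzero 1+1≢0 A≢0
        2a≢0 : 2# * a ≢ 0#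
        2a≢0 = *-nonzero 1+1≢0 a≢0
        y : Carrier
        y = 2A≢0 ⁻¹ * (Y + - (B * Z))
        x : Carrier
        x = 2a≢0 ⁻¹ * (X + - (d * y + e * Z))
        R : Carrier
        R = A * (y * y) + B * (y * Z) + G * (Z * Z)
        y∈K : K y
        y∈K = K-* (K-⁻¹ 2A≢0 (K-* 2∈K A∈K)) (K-+ Y∈K (K-neg (K-* B∈K Z∈K)))
        x∈K : K x
        x∈K = K-* (K-⁻¹ 2a≢0 (K-* 2∈K a∈K)) (K-+ X∈K (K-neg (K-+ (K-* d∈K y∈K) (K-* e∈K Z∈K))))
        cancel : ∀ u v → u + - v + v ≡ u
        cancel = solve 2 (λ u v → u :- v :+ v := u) refl
        X≡ : 2# * a * x + (d * y + e * Z) ≡ X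
        X≡ = trans (cong (_+ (d * y + e * Z)) (solve-linear 2a≢0 _)) (cancel X _)
        Y≡ : 2# * A * y + B * Z ≡ Y
        Y≡ = trans (cong (_+ B * Z) (solve-linear 2A≢0 _)) (cancel Y _)
        nontrivial′ : ¬ (x ≡ 0# × y ≡ 0# × Z ≡ 0#)
        nontrivial′ (x≡0 , y≡0 , Z≡0) = nontrivial
          ( trans (sym Y≡) (trans (cong₂ (λ u v → 2# * A * u + B * v) y≡0 Z≡0) (solve 2 (λ A B → :2 :* A :* :0 :+ B :* :0 := :0) refl A B))
          , trans (sym X≡) (trans (cong (λ u → 2# * a * u + (d * y + e * Z)) x≡0) (trans (cong₂ (λ u v → 2# * a * 0# + (d * u + e * v)) y≡0 Z≡0) (solve 3 (λ a d e → :2 :* a :* :0 :+ (d :* :0 :+ e :* :0) := :0) refl a d e)))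
          , Z≡0 )

      result : Dec (a ≡ 0#) → Dec (A ≡ 0#) → Isotropic
      result (yes a≡0) _         = case-a≡0 a≡0
      result (no a≢0)  (yes A≡0) = case-A≡0 a≢0 A≡0
      result (no a≢0)  (no A≢0)  = case-generic a≢0 A≢0 (diagonal-isotropic (K-* 4∈K A∈K) D∈K)

-- Finite sums, linear systems and invertible matrices.

module LinearAlgebra (F : FiniteField) where
  open FieldArithmetic F

  ∑-cong : ∀ {n} {f g : Fin n → Carrier} → (∀ i → f i ≡ g i) → ∑ F f ≡ ∑ F g
  ∑-cong {zero}  f≗g = refl
  ∑-cong {suc n} f≗g = cong₂ _+_ (f≗g 0F) (∑-cong (f≗g ∘ Fin.suc))

  ∑-0 : ∀ n → ∑ F {n} (λ _ → 0#) ≡ 0#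
  ∑-0 zero    = refl
  ∑-0 (suc n) = trans (+-identityˡ _) (∑-0 n)

  ∑-+ : ∀ {n} (f g : Fin n → Carrier) → ∑ F (λ i → f i + g i) ≡ ∑ F f + ∑ F g
  ∑-+ {zero}  f g = sym (+-identityˡ 0#)
  ∑-+ {suc n} f g = trans (cong (f 0F + g 0F +_) (∑-+ (f ∘ Fin.suc) (g ∘ Fin.suc)))
    (solve 4 (λ a b c d → (a :+ b) :+ (c :+ d) := (a :+ c) :+ (b :+ d)) refl _ _ _ _)

  ∑-*ˡ : ∀ {n} a (f : Fin n → Carrier) → ∑ F (λ i → a * f i) ≡ a * ∑ F f
  ∑-*ˡ {zero}  a f = sym (zeroʳ a)
  ∑-*ˡ {suc n} a f = trans (cong (a * f 0F +_) (∑-*ˡ a (f ∘ Fin.suc))) (sym (distribˡ a _ _))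

  ∑-*ʳ : ∀ {n} a (f : Fin n → Carrier) → ∑ F (λ i → f i * a) ≡ ∑ F f * a
  ∑-*ʳ a f = trans (∑-cong (λ i → *-comm (f i) a)) (trans (∑-*ˡ a f) (*-comm a _))

  ∑-swap : ∀ {m n} (f : Fin m → Fin n → Carrier) → ∑ F (λ i → ∑ F (f i)) ≡ ∑ F (λ j → ∑ F (λ i → f i j))
  ∑-swap {zero}  {n} f = sym (∑-0 n)
  ∑-swap {suc m} f = trans (cong (∑ F (f 0F) +_) (∑-swap (f ∘ Fin.suc))) (sym (∑-+ (f 0F) _))

  -- Gaussian elimination on the first column: without a pivot the first unit vector is a solution;
  -- otherwise the pivot row removes one unknown and one equation.
  underdetermined : ∀ {m n} → m ℕ.< n → (A : Fin m → Fin n → Carrier) →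
    Σ[ x ∈ (Fin n → Carrier) ] (¬ (∀ j → x j ≡ 0#) × (∀ i → ∑ F (λ j → A i j * x j) ≡ 0#))
  underdetermined {m} {suc n} m<1+n A with Fin.all? (λ i → A i 0F ≟ 0#)
  ... | yes first-column≡0 = e₀ , (λ e₀≡0 → 0≢1 (sym (e₀≡0 0F))) , λ i →
      trans (cong₂ _+_ (trans (*-identityʳ _) (first-column≡0 i)) (trans (∑-cong (λ j → zeroʳ (A i (Fin.suc j)))) (∑-0 n))) (+-identityˡ 0#)
    where
    e₀ : Fin (suc n) → Carrier
    e₀ Fin.zero    = 1#
    e₀ (Fin.suc _) = 0#
  underdetermined {zero}  {suc n} _ A | no ¬all = contradiction (λ ()) ¬all
  underdetermined {suc m} {suc n} (s≤s m<n) A | no ¬all = x , x-nonzero , x-solves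
    where
    open ≡-Reasoning
    pivot = Fin.¬∀⟶∃¬ (suc m) _ (λ i → A i 0F ≟ 0#) ¬all
    p = proj₁ pivot
    a≢0 = proj₂ pivot
    reduced = underdetermined m<n (λ i j → A (Fin.punchIn p i) (Fin.suc j) + - (A (Fin.punchIn p i) 0F * a≢0 ⁻¹) * A p (Fin.suc j))
    y = proj₁ reduced
    tail : Fin (suc m) → Carrier
    tail i = ∑ F (λ j → A i (Fin.suc j) * y j)
    x : Fin (suc n) → Carrier
    x Fin.zero    = - (a≢0 ⁻¹ * tail p)
    x (Fin.suc j) = y j
    x-nonzero : ¬ (∀ j → x j ≡ 0#)
    x-nonzero x≡0 = proj₁ (proj₂ reduced) (x≡0 ∘ Fin.suc)
    x-solves-other : ∀ i → A (Fin.punchIn p i) 0F * x 0F + tail (Fin.punchIn p i) ≡ 0#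
    x-solves-other i = begin
      b * - (a≢0 ⁻¹ * tail p) + tail i′      ≡⟨ solve 4 (λ b c s t → b :* :- (c :* s) :+ t := t :+ :- (b :* c) :* s) refl b (a≢0 ⁻¹) (tail p) (tail i′) ⟩
      tail i′ + - (b * a≢0 ⁻¹) * tail p      ≡⟨ cong (tail i′ +_) (∑-*ˡ (- (b * a≢0 ⁻¹)) (λ j → A p (Fin.suc j) * y j)) ⟨
      tail i′ + ∑ F (λ j → - (b * a≢0 ⁻¹) * (A p (Fin.suc j) * y j)) ≡⟨ ∑-+ (λ j → A i′ (Fin.suc j) * y j) (λ j → - (b * a≢0 ⁻¹) * (A p (Fin.suc j) * y j)) ⟨
      ∑ F (λ j → A i′ (Fin.suc j) * y j + - (b * a≢0 ⁻¹) * (A p (Fin.suc j) * y j))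
        ≡⟨ ∑-cong (λ j → solve 4 (λ u c v w → u :* w :+ c :* (v :* w) := (u :+ c :* v) :* w) refl (A i′ (Fin.suc j)) (- (b * a≢0 ⁻¹)) (A p (Fin.suc j)) (y j)) ⟩
      ∑ F (λ j → (A i′ (Fin.suc j) + - (b * a≢0 ⁻¹) * A p (Fin.suc j)) * y j) ≡⟨ proj₂ (proj₂ reduced) i ⟩
      0#                                     ∎
      where
      i′ = Fin.punchIn p i
      b = A i′ 0F
    x-solves : ∀ i → A i 0F * x 0F + tail i ≡ 0#
    x-solves i with p Fin.≟ i
    ... | yes refl = begin
      A p 0F * - (a≢0 ⁻¹ * tail p) + tail p   ≡⟨ solve 3 (λ a c t → a :* :- (c :* t) :+ t := (:1 :- a :* c) :* t) refl (A p 0F) (a≢0 ⁻¹) (tail p) ⟩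
      (1# + - (A p 0F * a≢0 ⁻¹)) * tail p     ≡⟨ cong (λ u → (1# + - u) * tail p) (*-inverseʳ a≢0) ⟩
      (1# + - 1#) * tail p                    ≡⟨ solve 1 (λ t → (:1 :- :1) :* t := :0) refl (tail p) ⟩
      0#                                      ∎
    ... | no p≢i = subst (λ k → A k 0F * x 0F + tail k ≡ 0#) (Fin.punchIn-punchOut p≢i) (x-solves-other (Fin.punchOut p≢i))

  identityMatrix : Matrix F
  identityMatrix i k with i Fin.≟ k
  ... | yes _ = 1#
  ... | no  _ = 0#

  ∑-identityˡ : ∀ i (v : Vec4 F) → ∑ F (λ j → identityMatrix i j * v j) ≡ v i
  ∑-identityˡ 0F v = solve 4 (λ a b c d → :1 :* a :+ (:0 :* b :+ (:0 :* c :+ (:0 :* d :+ :0))) := a) refl (v 0F) (v 1F) (v 2F) (v 3F)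
  ∑-identityˡ 1F v = solve 4 (λ a b c d → :0 :* a :+ (:1 :* b :+ (:0 :* c :+ (:0 :* d :+ :0))) := b) refl (v 0F) (v 1F) (v 2F) (v 3F)
  ∑-identityˡ 2F v = solve 4 (λ a b c d → :0 :* a :+ (:0 :* b :+ (:1 :* c :+ (:0 :* d :+ :0))) := c) refl (v 0F) (v 1F) (v 2F) (v 3F)
  ∑-identityˡ 3F v = solve 4 (λ a b c d → :0 :* a :+ (:0 :* b :+ (:0 :* c :+ (:1 :* d :+ :0))) := d) refl (v 0F) (v 1F) (v 2F) (v 3F)

  ∑-identityʳ : ∀ k (v : Vec4 F) → ∑ F (λ j → v j * identityMatrix j k) ≡ v k
  ∑-identityʳ 0F v = solve 4 (λ a b c d → a :* :1 :+ (b :* :0 :+ (c :* :0 :+ (d :* :0 :+ :0))) := a) refl (v 0F) (v 1F) (v 2F) (v 3F)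
  ∑-identityʳ 1F v = solve 4 (λ a b c d → a :* :0 :+ (b :* :1 :+ (c :* :0 :+ (d :* :0 :+ :0))) := b) refl (v 0F) (v 1F) (v 2F) (v 3F)
  ∑-identityʳ 2F v = solve 4 (λ a b c d → a :* :0 :+ (b :* :0 :+ (c :* :1 :+ (d :* :0 :+ :0))) := c) refl (v 0F) (v 1F) (v 2F) (v 3F)
  ∑-identityʳ 3F v = solve 4 (λ a b c d → a :* :0 :+ (b :* :0 :+ (c :* :0 :+ (d :* :1 :+ :0))) := d) refl (v 0F) (v 1F) (v 2F) (v 3F)

  InjectiveMatrix : Matrix F → Set
  InjectiveMatrix M = ∀ x → (∀ i → _·_ F M x i ≡ 0#) → ∀ i → x i ≡ 0#

  -- With -v as an extra column there are more unknowns than equations. Injectivity makes the extra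
  -- unknown nonzero in any nontrivial solution, and dividing by it solves the original system.
  injective⇒surjective : ∀ {M} → InjectiveMatrix M → ∀ (v : Vec4 F) → Σ[ x ∈ Vec4 F ] (∀ i → _·_ F M x i ≡ v i)
  injective⇒surjective {M} injective v = x , x-solves
    where
    open ≡-Reasoning
    augmented : Fin 4 → Fin 5 → Carrier
    augmented i Fin.zero    = - v i
    augmented i (Fin.suc j) = M i j
    solution = underdetermined (ℕ.n<1+n 4) augmented
    t = proj₁ solution 0F
    y = proj₁ solution ∘ Fin.suc
    solves : ∀ i → - v i * t + _·_ F M y i ≡ 0#
    solves = proj₂ (proj₂ solution)
    t≢0 : t ≢ 0#
    t≢0 t≡0 = proj₁ (proj₂ solution) all-zero
      where
      y≡0 : ∀ i → y i ≡ 0#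
      y≡0 = injective y (λ i → trans (sym (trans (cong (λ u → - v i * u + _·_ F M y i) t≡0) (trans (cong (_+ _·_ F M y i) (zeroʳ _)) (+-identityˡ _)))) (solves i))
      all-zero : ∀ j → proj₁ solution j ≡ 0#
      all-zero Fin.zero    = t≡0
      all-zero (Fin.suc j) = y≡0 j
    x : Vec4 F
    x j = y j * t≢0 ⁻¹
    x-solves : ∀ i → _·_ F M x i ≡ v i
    x-solves i = begin
      ∑ F (λ j → M i j * (y j * t≢0 ⁻¹))   ≡⟨ ∑-cong (λ j → sym (*-assoc (M i j) (y j) (t≢0 ⁻¹))) ⟩
      ∑ F (λ j → M i j * y j * t≢0 ⁻¹)     ≡⟨ ∑-*ʳ (t≢0 ⁻¹) (λ j → M i j * y j) ⟩
      _·_ F M y i * t≢0 ⁻¹                 ≡⟨ cong (_* t≢0 ⁻¹) (trans (solve 2 (λ m w → m := (:- w :+ m) :+ w) refl _ (v i * t)) (trans (cong (_+ v i * t) (trans (cong (_+ _·_ F M y i) (-‿distribˡ-* (v i) t)) (solves i))) (+-identityˡ _))) ⟩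
      v i * t * t≢0 ⁻¹                     ≡⟨ *-assoc (v i) t _ ⟩
      v i * (t * t≢0 ⁻¹)                   ≡⟨ cong (v i *_) (*-inverseʳ t≢0) ⟩
      v i * 1#                             ≡⟨ *-identityʳ (v i) ⟩
      v i                                  ∎

  -- `Invertible` refers to an identity matrix local to its definition, which reduces only after a
  -- split on `i Fin.≟ k`; the same split identifies it with `identityMatrix`.
  inverse⇒invertible : ∀ {M} N → (∀ i k → ∑ F (λ j → M i j * N j k) ≡ identityMatrix i k) →
    (∀ i k → ∑ F (λ j → N i j * M j k) ≡ identityMatrix i k) → Invertible F M
  proj₁ (inverse⇒invertible N MN NM) = N
  proj₁ (proj₂ (inverse⇒invertible N MN NM)) i k with i Fin.≟ k | MN i k
  ... | yes _ | e = e
  ... | no  _ | e = e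
  proj₂ (proj₂ (inverse⇒invertible N MN NM)) i k with i Fin.≟ k | NM i k
  ... | yes _ | e = e
  ... | no  _ | e = e

  -- Surjectivity gives a right inverse N column by column; then M(NM - I) = 0, and injectivity
  -- makes N a left inverse.
  injective⇒invertible : ∀ {M} → InjectiveMatrix M → Invertible F M
  injective⇒invertible {M} injective = inverse⇒invertible {M} N MN NM
    where
    open ≡-Reasoning
    column : ∀ k → Σ[ x ∈ Vec4 F ] (∀ i → _·_ F M x i ≡ identityMatrix i k)
    column k = injective⇒surjective {M} injective (λ i → identityMatrix i k)
    N : Matrix F
    N j k = proj₁ (column k) j
    MN : ∀ i k → ∑ F (λ j → M i j * N j k) ≡ identityMatrix i k
    MN i k = proj₂ (column k) i
    NM : ∀ i k → ∑ F (λ j → N i j * M j k) ≡ identityMatrix i k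
    NM i k = x-y≡0⇒x≡y (injective difference kernel i)
      where
      difference : Vec4 F
      difference l = ∑ F (λ j → N l j * M j k) + - identityMatrix l k
      kernel : ∀ i → _·_ F M difference i ≡ 0#
      kernel i = begin
        ∑ F (λ l → M i l * (∑ F (λ j → N l j * M j k) + - identityMatrix l k))
          ≡⟨ ∑-cong (λ l → trans (distribˡ (M i l) (∑ F (λ j → N l j * M j k)) (- identityMatrix l k)) (cong₂ _+_ (trans (sym (∑-*ˡ (M i l) (λ j → N l j * M j k))) (∑-cong (λ j → sym (*-assoc (M i l) (N l j) (M j k))))) (solve 2 (λ m u → m :* :- u := :- :1 :* (m :* u)) refl (M i l) (identityMatrix l k)))) ⟩
        ∑ F (λ l → ∑ F (λ j → M i l * N l j * M j k) + - 1# * (M i l * identityMatrix l k)) ≡⟨ ∑-+ (λ l → ∑ F (λ j → M i l * N l j * M j k)) (λ l → - 1# * (M i l * identityMatrix l k)) ⟩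
        ∑ F (λ l → ∑ F (λ j → M i l * N l j * M j k)) + ∑ F (λ l → - 1# * (M i l * identityMatrix l k))
          ≡⟨ cong₂ _+_ (∑-swap (λ l j → M i l * N l j * M j k)) (trans (∑-*ˡ (- 1#) (λ l → M i l * identityMatrix l k)) (cong (- 1# *_) (∑-identityʳ k (M i)))) ⟩
        ∑ F (λ j → ∑ F (λ l → M i l * N l j * M j k)) + - 1# * M i k
          ≡⟨ cong (_+ - 1# * M i k) (trans (∑-cong (λ j → trans (∑-*ʳ (M j k) (λ l → M i l * N l j)) (cong (_* M j k) (MN i j)))) (∑-identityˡ i (λ j → M j k))) ⟩
        M i k + - 1# * M i k   ≡⟨ solve 1 (λ m → m :+ :- :1 :* m := :0) refl (M i k) ⟩
        0#                     ∎

-- Counting points of projective space.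

-- Deleting the partner of the first element leaves partners for all others, since no y serves two
-- of them. A relation replaces a map because vectors are matched only up to pointwise equality and
-- scalars.
pigeonhole : ∀ {A B : Set} (R : A → B → Set) {xs ys} → AllPairs (λ x x′ → ∀ y → R x y → ¬ R x′ y) xs →
  All (λ x → Any (R x) ys) xs → length xs ℕ.≤ length ys
pigeonhole R [] [] = z≤n
pigeonhole {B = B} R {x ∷ xs} {ys} (separated ∷ pairs) (image ∷ images) =
  ℕ.≤-trans (s≤s (pigeonhole R pairs (All.zipWith (λ (sep , im) → avoid image sep im) (separated , images)))) (ℕ.≤-reflexive (sym (length-remove image)))
  where
  remove : ∀ {P : B → Set} {ys} → Any P ys → List B
  remove {ys = _ ∷ ys} (here _)  = ys
  remove {ys = y ∷ _}  (there i) = y ∷ remove i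
  length-remove : ∀ {P : B → Set} {ys} (i : Any P ys) → length ys ≡ suc (length (remove i))
  length-remove (here _)  = refl
  length-remove (there i) = cong suc (length-remove i)
  avoid : ∀ {P Q : B → Set} {ys} (i : Any P ys) → (∀ y → P y → ¬ Q y) → Any Q ys → Any Q (remove i)
  avoid (here p)  ¬Q (here q)  = contradiction q (¬Q _ p)
  avoid (here _)  ¬Q (there j) = j
  avoid (there i) ¬Q (here q)  = here q
  avoid (there i) ¬Q (there j) = there (avoid i ¬Q j)

module PointCounting (F : FiniteField) where
  open FieldArithmetic F

  allVecs-complete : ∀ n (v : Fin n → Carrier) → Any (λ w → ∀ i → w i ≡ v i) (allVecs F n)
  allVecs-complete zero    v = here (λ ())
  allVecs-complete (suc n) v = Any.concatMap⁺ _ (Any.map (λ v₀≡x → Any.map⁺ (Any.map (extend v₀≡x) (allVecs-complete n (v ∘ Fin.suc)))) (elements-complete (v 0F)))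
    where
    extend : ∀ {x w} → v 0F ≡ x → (∀ i → w i ≡ v (Fin.suc i)) → ∀ i → Vector._∷_ x w i ≡ v i
    extend v₀≡x w≗v Fin.zero    = sym v₀≡x
    extend v₀≡x w≗v (Fin.suc i) = w≗v i

  normalised-resp : ∀ {n} {v w : Fin n → Carrier} → (∀ i → w i ≡ v i) → Normalised F v → Normalised F w
  normalised-resp {suc n} w≗v (inj₁ v₀≡1)         = inj₁ (trans (w≗v 0F) v₀≡1)
  normalised-resp {suc n} w≗v (inj₂ (v₀≡0 , rest)) = inj₂ (trans (w≗v 0F) v₀≡0 , normalised-resp (w≗v ∘ Fin.suc) rest)

  normalise : ∀ {n} (v : Fin n → Carrier) → ¬ (∀ i → v i ≡ 0#) → ∃[ c ] (c ≢ 0# × Normalised F (λ i → c * v i))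
  normalise {zero}  v v≢0 = contradiction (λ ()) v≢0
  normalise {suc n} v v≢0 with v 0F ≟ 0#
  ... | no v₀≢0 = v₀≢0 ⁻¹ , ⁻¹-nonzero v₀≢0 , inj₁ (trans (*-comm _ _) (*-inverseʳ v₀≢0))
  ... | yes v₀≡0 =
    let c , c≢0 , normalised = normalise (v ∘ Fin.suc) (λ rest≡0 → v≢0 λ { Fin.zero → v₀≡0 ; (Fin.suc i) → rest≡0 i })
    in c , c≢0 , inj₂ (trans (cong (c *_) v₀≡0) (zeroʳ c) , normalised)

  Multiple : Vec4 F → Vec4 F → Set
  Multiple v w = ∃[ c ] (c ≢ 0# × (∀ i → w i ≡ c * v i))

  -- With a scalar on each side, two vectors with a common multiple are related without any
  -- division.
  Proportional : Vec4 F → Vec4 F → Set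
  Proportional v w = ∃[ c ] ∃[ d ] (c ≢ 0# × d ≢ 0# × (∀ i → c * v i ≡ d * w i))

  -- Each vector has a normalised multiple in the enumeration, and two vectors sharing one would be
  -- proportional. This makes the given cardinality a bound on every explicit list of distinct
  -- points.
  numPoints-≥ : ∀ {P : Vec4 F → Set} (P? : ∀ v → Dec (P v)) → (∀ {v w} → Multiple v w → P v → P w) →
    ∀ {vs} → All (λ v → NonZeroVec F v × P v) vs → AllPairs (λ v w → ¬ Proportional v w) vs →
    length vs ℕ.≤ numPoints F P P?
  numPoints-≥ {P} P? P-resp points distinct = pigeonhole Multiple
    (AllPairs.map (λ ¬prop z (c , c≢0 , z≗cv) (d , d≢0 , z≗dw) → ¬prop (c , d , c≢0 , d≢0 , λ i → trans (sym (z≗cv i)) (z≗dw i))) distinct)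
    (All.map (λ (v≢0 , Pv) → representative v≢0 Pv) points)
    where
    representative : ∀ {v} → NonZeroVec F v → P v → Any (Multiple v) (filter (λ w → normalised? F w ×-dec P? w) (allVecs F 4))
    representative {v} v≢0 Pv =
      let c , c≢0 , normalised = normalise v v≢0
          w , w∈ , w≗cv        = find (allVecs-complete 4 (λ i → c * v i))
          multiple             = c , c≢0 , w≗cv
      in lose (∈-filter⁺ (λ w → normalised? F w ×-dec P? w) w∈ (normalised-resp w≗cv normalised , P-resp multiple Pv)) multiple

-- Bilinear forms and linear combinations.

module Forms (F : FiniteField) where
  open FieldArithmetic F
  open LinearAlgebra F

  vec : Carrier → Carrier → Carrier → Carrier → Vec4 F
  vec a b c d 0F = a
  vec a b c d 1F = b
  vec a b c d 2F = c
  vec a b c d 3F = d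

  abstract
    -- Kept opaque so that forms are compared by their arguments and not as expanded sums of sixteen
    -- products; `form-explicit` opens it where coordinates are needed.
    form : Matrix F → Vec4 F → Vec4 F → Carrier
    form M x y = ∑ F λ i → ∑ F λ j → M i j * x i * y j

    combination : (Fin 4 → Vec4 F) → Vec4 F → Vec4 F
    combination e = _·_ F (λ i j → e j i)

  Independent : (Fin 4 → Vec4 F) → Set
  Independent e = ∀ x → (∀ i → combination e x i ≡ 0#) → ∀ i → x i ≡ 0#

  abstract
    independent⇒invertible : ∀ {e} → Independent e → Invertible F (λ i j → e j i)
    independent⇒invertible {e} independent = injective⇒invertible {λ i j → e j i} independent

    independent⇒spanning : ∀ {e} → Independent e → ∀ (v : Vec4 F) → Σ[ x ∈ Vec4 F ] (∀ i → combination e x i ≡ v i)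
    independent⇒spanning {e} independent = injective⇒surjective {λ i j → e j i} independent

    form-cong : ∀ M {x x′ y y′} → (∀ i → x i ≡ x′ i) → (∀ i → y i ≡ y′ i) → form M x y ≡ form M x′ y′
    form-cong M x≗ y≗ = ∑-cong λ i → ∑-cong λ j → cong₂ (λ u v → M i j * u * v) (x≗ i) (y≗ j)

    form-matrix-cong : ∀ {M N} → (∀ i j → M i j ≡ N i j) → ∀ x y → form M x y ≡ form N x y
    form-matrix-cong M≗N x y = ∑-cong λ i → ∑-cong λ j → cong (λ m → m * x i * y j) (M≗N i j)

    form-transpose : ∀ M x y → form M x y ≡ form (λ i j → M j i) y x
    form-transpose M x y = trans (∑-swap (λ i j → M i j * x i * y j))
      (∑-cong λ j → ∑-cong λ i → solve 3 (λ m x y → m :* x :* y := m :* y :* x) refl (M i j) (x i) (y j))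

    form-scale : ∀ M a b x y → form M (λ i → a * x i) (λ i → b * y i) ≡ a * b * form M x y
    form-scale M a b x y = trans (∑-cong λ i → trans (∑-cong λ j → solve 5 (λ m a x b y → m :* (a :* x) :* (b :* y) := a :* b :* (m :* x :* y)) refl (M i j) a (x i) b (y j))
      (∑-*ˡ (a * b) (λ j → M i j * x i * y j))) (∑-*ˡ (a * b) (λ i → ∑ F (λ j → M i j * x i * y j)))

    form-zeroˡ : ∀ M y → form M (λ _ → 0#) y ≡ 0#
    form-zeroˡ M y = trans (∑-cong λ i → trans (∑-cong λ j → solve 2 (λ m y → m :* :0 :* y := :0) refl (M i j) (y j)) (∑-0 4)) (∑-0 4)

    form-lineˡ : ∀ M c x y z → form M (λ i → x i + c * y i) z ≡ form M x z + c * form M y z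
    form-lineˡ M c x y z = begin
      (∑ F λ i → ∑ F λ j → M i j * (x i + c * y i) * z j)
        ≡⟨ (∑-cong λ i → trans (∑-cong λ j → solve 5 (λ m x c y z → m :* (x :+ c :* y) :* z := m :* x :* z :+ c :* (m :* y :* z)) refl (M i j) (x i) c (y i) (z j))
             (trans (∑-+ (λ j → M i j * x i * z j) (λ j → c * (M i j * y i * z j))) (cong (∑ F (λ j → M i j * x i * z j) +_) (∑-*ˡ c (λ j → M i j * y i * z j))))) ⟩
      (∑ F λ i → ∑ F (λ j → M i j * x i * z j) + c * ∑ F (λ j → M i j * y i * z j))
        ≡⟨ trans (∑-+ (λ i → ∑ F (λ j → M i j * x i * z j)) (λ i → c * ∑ F (λ j → M i j * y i * z j))) (cong (form M x z +_) (∑-*ˡ c (λ i → ∑ F (λ j → M i j * y i * z j)))) ⟩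
      form M x z + c * form M y z ∎
      where open ≡-Reasoning

    form-row : ∀ M x y → form M x y ≡ ∑ F λ i → _·_ F M y i * x i
    form-row M x y = ∑-cong λ i → trans (∑-cong λ j → solve 3 (λ m x y → m :* x :* y := m :* y :* x) refl (M i j) (x i) (y j)) (∑-*ʳ (x i) (λ j → M i j * y j))

    form-matrix-scale : ∀ M c x y → form (λ i j → c * M i j) x y ≡ c * form M x y
    form-matrix-scale M c x y = trans (∑-cong λ i → trans (∑-cong λ j → solve 4 (λ c m x y → c :* m :* x :* y := c :* (m :* x :* y)) refl c (M i j) (x i) (y j))
      (∑-*ˡ c (λ j → M i j * x i * y j))) (∑-*ˡ c (λ i → ∑ F (λ j → M i j * x i * y j)))

    form-combinationˡ : ∀ M e x z → form M (combination e x) z ≡ ∑ F λ k → x k * form M (e k) z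
    form-combinationˡ M e x z = begin
      (∑ F λ i → ∑ F λ j → M i j * (∑ F λ k → e k i * x k) * z j)
        ≡⟨ (∑-cong λ i → trans (∑-cong (λ j → expand i j)) (∑-swap (λ j k → x k * (M i j * e k i * z j)))) ⟩
      (∑ F λ i → ∑ F λ k → ∑ F λ j → x k * (M i j * e k i * z j))
        ≡⟨ ∑-swap (λ i k → ∑ F λ j → x k * (M i j * e k i * z j)) ⟩
      (∑ F λ k → ∑ F λ i → ∑ F λ j → x k * (M i j * e k i * z j))
        ≡⟨ (∑-cong λ k → trans (∑-cong λ i → ∑-*ˡ (x k) (λ j → M i j * e k i * z j)) (∑-*ˡ (x k) (λ i → ∑ F λ j → M i j * e k i * z j))) ⟩
      (∑ F λ k → x k * form M (e k) z) ∎
      where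
      open ≡-Reasoning
      expand : ∀ i j → M i j * (∑ F λ k → e k i * x k) * z j ≡ ∑ F λ k → x k * (M i j * e k i * z j)
      expand i j = trans (cong (_* z j) (sym (∑-*ˡ (M i j) (λ k → e k i * x k)))) (trans (sym (∑-*ʳ (z j) (λ k → M i j * (e k i * x k))))
        (∑-cong λ k → solve 4 (λ m e x z → m :* (e :* x) :* z := x :* (m :* e :* z)) refl (M i j) (e k i) (x k) (z j)))

    form-combinationʳ : ∀ M e x z → form M z (combination e x) ≡ ∑ F λ k → x k * form M z (e k)
    form-combinationʳ M e x z = trans (form-transpose M z (combination e x)) (trans (form-combinationˡ (λ i j → M j i) e x z)
      (∑-cong λ k → cong (x k *_) (sym (form-transpose M z (e k)))))

    -- Two separate bases are allowed so that the conjugate basis can stand on the right, which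
    -- makes the same change of coordinates valid for Hermitian forms.
    form-gram : ∀ M e e′ x y → form M (combination e x) (combination e′ y) ≡ form (λ k l → form M (e k) (e′ l)) x y
    form-gram M e e′ x y = trans (form-combinationˡ M e x (combination e′ y)) (∑-cong λ k →
      trans (cong (x k *_) (form-combinationʳ M e′ y (e k))) (trans (sym (∑-*ˡ (x k) (λ l → y l * form M (e k) (e′ l))))
        (∑-cong λ l → solve 3 (λ x y g → x :* (y :* g) := g :* x :* y) refl (x k) (y l) (form M (e k) (e′ l)))))

    combination-combination : ∀ e t x i → combination (λ k → combination e (t k)) x i ≡ combination e (combination t x) i
    combination-combination e t x i = begin
      (∑ F λ k → (∑ F λ j → e j i * t k j) * x k)   ≡⟨ (∑-cong λ k → trans (sym (∑-*ʳ (x k) (λ j → e j i * t k j))) (∑-cong λ j → *-assoc (e j i) (t k j) (x k))) ⟩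
      (∑ F λ k → ∑ F λ j → e j i * (t k j * x k))   ≡⟨ ∑-swap (λ k j → e j i * (t k j * x k)) ⟩
      (∑ F λ j → ∑ F λ k → e j i * (t k j * x k))   ≡⟨ (∑-cong λ j → ∑-*ˡ (e j i) (λ k → t k j * x k)) ⟩
      (∑ F λ j → e j i * (∑ F λ k → t k j * x k))   ∎
      where open ≡-Reasoning

    combination-scale : ∀ e c x i → c * combination e x i ≡ combination e (λ j → c * x j) i
    combination-scale e c x i = trans (sym (∑-*ˡ c (λ j → e j i * x j))) (∑-cong λ j → solve 3 (λ c e x → c :* (e :* x) := e :* (c :* x)) refl c (e j i) (x j))

    form-explicit : ∀ M x y → form M x y ≡ ∑ F λ i → ∑ F λ j → M i j * x i * y j
    form-explicit M x y = refl

    combination-explicit : ∀ e x i → combination e x i ≡ ∑ F λ j → e j i * x j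
    combination-explicit e x i = refl

    quadForm≡form : ∀ M x → quadForm F M x ≡ form M x x
    quadForm≡form M x = refl

    combination-injective : ∀ {e} → Independent e → ∀ x y →
      (∀ i → combination e x i ≡ combination e y i) → ∀ j → x j ≡ y j
    combination-injective {e} independent x y eq j = x-y≡0⇒x≡y (independent (λ j → x j + - y j) kernel j)
      where
      kernel : ∀ i → combination e (λ j → x j + - y j) i ≡ 0#
      kernel i = trans (∑-cong λ j → trans (distribˡ (e j i) (x j) (- y j)) (cong (e j i * x j +_) (solve 2 (λ e y → e :* :- y := :- :1 :* (e :* y)) refl (e j i) (y j))))
        (trans (∑-+ (λ j → e j i * x j) (λ j → - 1# * (e j i * y j))) (trans (cong₂ _+_ (eq i) (∑-*ˡ (- 1#) (λ j → e j i * y j)))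
          (solve 1 (λ u → u :+ :- :1 :* u := :0) refl (combination e y i))))

-- The tangent configuration and its frames.

-- The situation after rescaling, with tangency factor 1. The cardinality appears as a bound on
-- lists of pairwise non-proportional common points, the form in which it contradicts large
-- families.
record Configuration : Set₁ where
  field
    F               : FiniteField
    q               : ℕ
    q-oddPrimePower : IsOddPrimePower q
    card            : length (FiniteField.elements F) ≡ q ℕ.* q
    A B             : Matrix F
    A-hermitian     : IsHermitian F q A
    A-nondegenerate : NonDegenerateHermitian F q A
    B-symmetric     : IsSymmetric F B
    P               : Vec4 F
    P-isotropic     : quadForm F B P ≡ FiniteField.0# F
    tangent         : ∀ i → ∑ F (λ j → FiniteField._*_ F (A i j) (conj F q (P j))) ≡ ∑ F (λ j → FiniteField._*_ F (B i j) (P j))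
    few-points      : ∀ {vs} → All (λ v → NonZeroVec F v × OnHQ F q A B v) vs →
                      AllPairs (λ v w → ¬ PointCounting.Proportional F v w) vs → length vs ℕ.≤ q ℕ.* q ℕ.+ 1

module TangentForms (𝓒 : Configuration) where
  open Configuration 𝓒 public using (F; q; A; B; P; A-nondegenerate; few-points)
  open Configuration 𝓒 using (q-oddPrimePower; card; A-hermitian; B-symmetric; P-isotropic; tangent)
  open QuadraticExtension F q q-oddPrimePower card public
  open LinearAlgebra F public
  open Forms F public
  open PointCounting F public using (Proportional)

  -- Writing the Hermitian form as a bilinear form at a conjugated second vector lets the lemmas on
  -- `form` serve both.
  β h : Vec4 F → Vec4 F → Carrier
  β x y = form B x y
  h x y = form A x (λ i → y i ᶜ)

  conj-∑ : ∀ {n} (f : Fin n → Carrier) → (∑ F f) ᶜ ≡ ∑ F (λ i → f i ᶜ)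
  conj-∑ {zero}  f = conj-0
  conj-∑ {suc n} f = trans (conj-+ (f 0F) _) (cong (f 0F ᶜ +_) (conj-∑ (f ∘ Fin.suc)))

  β-sym : ∀ x y → β x y ≡ β y x
  β-sym x y = trans (form-transpose B x y) (form-matrix-cong (λ i j → B-symmetric j i) y x)

  h-sym : ∀ x y → h y x ≡ h x y ᶜ
  h-sym x y = sym (begin
    h x y ᶜ
      ≡⟨ cong _ᶜ (form-explicit A x (λ i → y i ᶜ)) ⟩
    (∑ F λ i → ∑ F λ j → A i j * x i * y j ᶜ) ᶜ
      ≡⟨ trans (conj-∑ (λ i → ∑ F λ j → A i j * x i * y j ᶜ)) (∑-cong λ i → conj-∑ (λ j → A i j * x i * y j ᶜ)) ⟩
    (∑ F λ i → ∑ F λ j → (A i j * x i * y j ᶜ) ᶜ)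
      ≡⟨ (∑-cong λ i → ∑-cong λ j → trans (trans (conj-* (A i j * x i) (y j ᶜ)) (cong₂ _*_ (conj-* (A i j) (x i)) (conj-involutive (y j))))
           (trans (solve 3 (λ a x y → a :* x :* y := a :* y :* x) refl (A i j ᶜ) (x i ᶜ) (y j)) (cong (λ a → a * y j * x i ᶜ) (sym (A-hermitian i j))))) ⟩
    (∑ F λ i → ∑ F λ j → A j i * y j * x i ᶜ)   ≡⟨ trans (∑-swap (λ i j → A j i * y j * x i ᶜ)) (sym (form-explicit A y (λ i → x i ᶜ))) ⟩
    h y x                                       ∎)
    where open ≡-Reasoning

  hermForm≡h : ∀ x y → hermForm F q A x y ≡ h x y
  hermForm≡h x y = sym (form-explicit A x (λ i → y i ᶜ))

  h-cong : ∀ {x x′ y y′} → (∀ i → x i ≡ x′ i) → (∀ i → y i ≡ y′ i) → h x y ≡ h x′ y′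
  h-cong x≗ y≗ = form-cong A x≗ (λ i → cong _ᶜ (y≗ i))

  -- Both sides evaluate the equation of the common tangent plane at x.
  h-P≡β-P : ∀ x → h x P ≡ β x P
  h-P≡β-P x = trans (form-explicit A x (λ j → P j ᶜ)) (trans (∑-cong λ i → trans (pull A (λ j → P j ᶜ) i) (trans (cong (_* x i) (tangent i)) (sym (pull B P i)))) (sym (form-explicit B x P)))
    where
    pull : ∀ M y i → ∑ F (λ j → M i j * x i * y j) ≡ ∑ F (λ j → M i j * y j) * x i
    pull M y i = trans (∑-cong λ j → solve 3 (λ m x y → m :* x :* y := m :* y :* x) refl (M i j) (x i) (y j)) (∑-*ʳ (x i) (λ j → M i j * y j))

  -- The first vector agrees with `P` only pointwise, because after a change of frame it is a linear
  -- combination of the old vectors.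
  record Frame : Set where
    field
      e           : Fin 4 → Vec4 F
      e₀≗P        : ∀ i → e 0F i ≡ P i
      β₀₁         : β (e 0F) (e 1F) ≡ 1#
      β₁₁         : β (e 1F) (e 1F) ≡ 0#
      β₂₀         : β (e 2F) (e 0F) ≡ 0#
      β₃₀         : β (e 3F) (e 0F) ≡ 0#
      β₂₁         : β (e 2F) (e 1F) ≡ 0#
      β₃₁         : β (e 3F) (e 1F) ≡ 0#
      independent : Independent e

  module InFrame (𝓕 : Frame) where
    open Frame 𝓕 public

    vector : Vec4 F → Vec4 F
    vector = combination e

    α₁ α₂ α₃ η₁ η₂ η₃ ρ₁ ρ₂ r : Carrier
    α₁ = β (e 2F) (e 2F)
    α₂ = β (e 2F) (e 3F)
    α₃ = β (e 3F) (e 3F)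
    η₁ = h (e 2F) (e 2F)
    η₂ = h (e 2F) (e 3F)
    η₃ = h (e 3F) (e 3F)
    ρ₁ = h (e 2F) (e 1F)
    ρ₂ = h (e 3F) (e 1F)
    r  = h (e 1F) (e 1F)

    -- Row 0 and column 0 are the same in both matrices: this is the tangency at `P`.
    β-gram h-gram : Matrix F
    β-gram 0F = vec 0# 1# 0# 0#
    β-gram 1F = vec 1# 0# 0# 0#
    β-gram 2F = vec 0# 0# α₁ α₂
    β-gram 3F = vec 0# 0# α₂ α₃
    h-gram 0F = vec 0# 1# 0# 0#
    h-gram 1F = vec 1# r (ρ₁ ᶜ) (ρ₂ ᶜ)
    h-gram 2F = vec 0# ρ₁ η₁ η₂
    h-gram 3F = vec 0# ρ₂ (η₂ ᶜ) η₃

    β₀₀ : β (e 0F) (e 0F) ≡ 0#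
    β₀₀ = trans (form-cong B e₀≗P e₀≗P) (trans (sym (quadForm≡form B P)) P-isotropic)

    flip : ∀ {x y c} → β x y ≡ c → β y x ≡ c
    flip {x} {y} eq = trans (β-sym y x) eq

    h-e₀ : ∀ {x c} → β x (e 0F) ≡ c → h x (e 0F) ≡ c
    h-e₀ {x} eq = trans (h-cong {x} (λ _ → refl) e₀≗P) (trans (h-P≡β-P x) (trans (form-cong B (λ _ → refl) (λ i → sym (e₀≗P i))) eq))

    h-e₀′ : ∀ {x c} → c ᶜ ≡ c → β x (e 0F) ≡ c → h (e 0F) x ≡ c
    h-e₀′ {x} c∈K eq = trans (h-sym x (e 0F)) (trans (cong _ᶜ (h-e₀ {x} eq)) c∈K)

    β-gram-correct : ∀ k l → β (e k) (e l) ≡ β-gram k l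
    β-gram-correct 0F 0F = β₀₀
    β-gram-correct 0F 1F = β₀₁
    β-gram-correct 0F 2F = flip {e 2F} β₂₀
    β-gram-correct 0F 3F = flip {e 3F} β₃₀
    β-gram-correct 1F 0F = flip {e 0F} β₀₁
    β-gram-correct 1F 1F = β₁₁
    β-gram-correct 1F 2F = flip {e 2F} β₂₁
    β-gram-correct 1F 3F = flip {e 3F} β₃₁
    β-gram-correct 2F 0F = β₂₀
    β-gram-correct 2F 1F = β₂₁
    β-gram-correct 2F 2F = refl
    β-gram-correct 2F 3F = refl
    β-gram-correct 3F 0F = β₃₀
    β-gram-correct 3F 1F = β₃₁
    β-gram-correct 3F 2F = β-sym (e 3F) (e 2F)
    β-gram-correct 3F 3F = refl

    h-gram-correct : ∀ k l → h (e k) (e l) ≡ h-gram k l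
    h-gram-correct 0F 0F = h-e₀ {e 0F} β₀₀
    h-gram-correct 0F 1F = h-e₀′ {e 1F} conj-1 (flip {e 0F} β₀₁)
    h-gram-correct 0F 2F = h-e₀′ {e 2F} conj-0 β₂₀
    h-gram-correct 0F 3F = h-e₀′ {e 3F} conj-0 β₃₀
    h-gram-correct 1F 0F = h-e₀ {e 1F} (flip {e 0F} β₀₁)
    h-gram-correct 1F 1F = refl
    h-gram-correct 1F 2F = h-sym (e 2F) (e 1F)
    h-gram-correct 1F 3F = h-sym (e 3F) (e 1F)
    h-gram-correct 2F 0F = h-e₀ {e 2F} β₂₀
    h-gram-correct 2F 1F = refl
    h-gram-correct 2F 2F = refl
    h-gram-correct 2F 3F = refl
    h-gram-correct 3F 0F = h-e₀ {e 3F} β₃₀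
    h-gram-correct 3F 1F = refl
    h-gram-correct 3F 2F = h-sym (e 2F) (e 3F)
    h-gram-correct 3F 3F = refl

    β-coordinates : ∀ x y → β (vector x) (vector y) ≡
      x 0F * y 1F + x 1F * y 0F + (α₁ * (x 2F * y 2F) + α₂ * (x 2F * y 3F + x 3F * y 2F) + α₃ * (x 3F * y 3F))
    β-coordinates x y = trans (form-gram B e e x y) (trans (form-matrix-cong β-gram-correct x y) (trans (form-explicit β-gram x y) (explicit α₁ α₂ α₃ (x 0F) (x 1F) (x 2F) (x 3F) (y 0F) (y 1F) (y 2F) (y 3F))))
      where
      explicit : ∀ a b c x₀ x₁ x₂ x₃ y₀ y₁ y₂ y₃ →
        (0# * x₀ * y₀ + (1# * x₀ * y₁ + (0# * x₀ * y₂ + (0# * x₀ * y₃ + 0#)))) + ((1# * x₁ * y₀ + (0# * x₁ * y₁ + (0# * x₁ * y₂ + (0# * x₁ * y₃ + 0#)))) +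
        ((0# * x₂ * y₀ + (0# * x₂ * y₁ + (a * x₂ * y₂ + (b * x₂ * y₃ + 0#)))) + ((0# * x₃ * y₀ + (0# * x₃ * y₁ + (b * x₃ * y₂ + (c * x₃ * y₃ + 0#)))) + 0#)))
        ≡ x₀ * y₁ + x₁ * y₀ + (a * (x₂ * y₂) + b * (x₂ * y₃ + x₃ * y₂) + c * (x₃ * y₃))
      explicit = solve 11 (λ a b c x₀ x₁ x₂ x₃ y₀ y₁ y₂ y₃ →
        (:0 :* x₀ :* y₀ :+ (:1 :* x₀ :* y₁ :+ (:0 :* x₀ :* y₂ :+ (:0 :* x₀ :* y₃ :+ :0)))) :+ ((:1 :* x₁ :* y₀ :+ (:0 :* x₁ :* y₁ :+ (:0 :* x₁ :* y₂ :+ (:0 :* x₁ :* y₃ :+ :0)))) :+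
        ((:0 :* x₂ :* y₀ :+ (:0 :* x₂ :* y₁ :+ (a :* x₂ :* y₂ :+ (b :* x₂ :* y₃ :+ :0)))) :+ ((:0 :* x₃ :* y₀ :+ (:0 :* x₃ :* y₁ :+ (b :* x₃ :* y₂ :+ (c :* x₃ :* y₃ :+ :0)))) :+ :0)))
        := x₀ :* y₁ :+ x₁ :* y₀ :+ (a :* (x₂ :* y₂) :+ b :* (x₂ :* y₃ :+ x₃ :* y₂) :+ c :* (x₃ :* y₃))) refl

    conj-vector : ∀ y i → vector y i ᶜ ≡ combination (λ k j → e k j ᶜ) (λ j → y j ᶜ) i
    conj-vector y i = trans (cong _ᶜ (combination-explicit e y i)) (trans (conj-∑ (λ j → e j i * y j)) (trans (∑-cong λ j → conj-* (e j i) (y j)) (sym (combination-explicit (λ k j → e k j ᶜ) (λ j → y j ᶜ) i))))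

    h-coordinates : ∀ x y → h (vector x) (vector y) ≡
      x 0F * y 1F ᶜ + x 1F * y 0F ᶜ + r * (x 1F * y 1F ᶜ)
      + (ρ₁ * (x 2F * y 1F ᶜ) + ρ₁ ᶜ * (x 1F * y 2F ᶜ) + (ρ₂ * (x 3F * y 1F ᶜ) + ρ₂ ᶜ * (x 1F * y 3F ᶜ)))
      + (η₁ * (x 2F * y 2F ᶜ) + (η₂ * (x 2F * y 3F ᶜ) + η₂ ᶜ * (x 3F * y 2F ᶜ)) + η₃ * (x 3F * y 3F ᶜ))
    h-coordinates x y = trans (form-cong A {vector x} (λ _ → refl) (conj-vector y)) (trans (form-gram A e (λ k j → e k j ᶜ) x (λ j → y j ᶜ))
      (trans (form-matrix-cong h-gram-correct x (λ j → y j ᶜ))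
        (trans (form-explicit h-gram x (λ j → y j ᶜ)) (explicit r ρ₁ (ρ₁ ᶜ) ρ₂ (ρ₂ ᶜ) η₁ η₂ (η₂ ᶜ) η₃ (x 0F) (x 1F) (x 2F) (x 3F) (y 0F ᶜ) (y 1F ᶜ) (y 2F ᶜ) (y 3F ᶜ)))))
      where
      explicit : ∀ r ρ ρ′ σ σ′ a b b′ c x₀ x₁ x₂ x₃ y₀ y₁ y₂ y₃ →
        (0# * x₀ * y₀ + (1# * x₀ * y₁ + (0# * x₀ * y₂ + (0# * x₀ * y₃ + 0#)))) + ((1# * x₁ * y₀ + (r * x₁ * y₁ + (ρ′ * x₁ * y₂ + (σ′ * x₁ * y₃ + 0#)))) +
        ((0# * x₂ * y₀ + (ρ * x₂ * y₁ + (a * x₂ * y₂ + (b * x₂ * y₃ + 0#)))) + ((0# * x₃ * y₀ + (σ * x₃ * y₁ + (b′ * x₃ * y₂ + (c * x₃ * y₃ + 0#)))) + 0#)))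
        ≡ x₀ * y₁ + x₁ * y₀ + r * (x₁ * y₁) + (ρ * (x₂ * y₁) + ρ′ * (x₁ * y₂) + (σ * (x₃ * y₁) + σ′ * (x₁ * y₃)))
          + (a * (x₂ * y₂) + (b * (x₂ * y₃) + b′ * (x₃ * y₂)) + c * (x₃ * y₃))
      explicit = solve 17 (λ r ρ ρ′ σ σ′ a b b′ c x₀ x₁ x₂ x₃ y₀ y₁ y₂ y₃ →
        (:0 :* x₀ :* y₀ :+ (:1 :* x₀ :* y₁ :+ (:0 :* x₀ :* y₂ :+ (:0 :* x₀ :* y₃ :+ :0)))) :+ ((:1 :* x₁ :* y₀ :+ (r :* x₁ :* y₁ :+ (ρ′ :* x₁ :* y₂ :+ (σ′ :* x₁ :* y₃ :+ :0)))) :+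
        ((:0 :* x₂ :* y₀ :+ (ρ :* x₂ :* y₁ :+ (a :* x₂ :* y₂ :+ (b :* x₂ :* y₃ :+ :0)))) :+ ((:0 :* x₃ :* y₀ :+ (σ :* x₃ :* y₁ :+ (b′ :* x₃ :* y₂ :+ (c :* x₃ :* y₃ :+ :0)))) :+ :0)))
        := x₀ :* y₁ :+ x₁ :* y₀ :+ r :* (x₁ :* y₁) :+ (ρ :* (x₂ :* y₁) :+ ρ′ :* (x₁ :* y₂) :+ (σ :* (x₃ :* y₁) :+ σ′ :* (x₁ :* y₃)))
          :+ (a :* (x₂ :* y₂) :+ (b :* (x₂ :* y₃) :+ b′ :* (x₃ :* y₂)) :+ c :* (x₃ :* y₃))) refl

-- The affine part of the intersection.

module AffinePoints (𝓒 : Configuration) where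
  open TangentForms 𝓒
  open Configuration 𝓒 using (card)

  module InFrameCounting (𝓕 : Frame) where
    open InFrame 𝓕 public

    2# : Carrier
    2# = 1# + 1#

    2∈K : K 2#
    2∈K = K-+ K-1 K-1

    -- The quadratic form of `β` on U, at the vector ye₂ + xe₃.
    Q : Carrier → Carrier → Carrier
    Q y x = α₁ * (y * y) + α₂ * (y * x + x * y) + α₃ * (x * x)

    -- Half the Hermitian form at the point (-Q(y,x), 2, 2y, 2x) of the quadric, with y′ and x′ in place of ȳ and x̄.
    f-poly : Carrier → Carrier → Carrier → Carrier → Carrier
    f-poly y y′ x x′ = - (α₁ * (y * y) + α₂ * (y * x + x * y) + α₃ * (x * x)) + - (α₁ ᶜ * (y′ * y′) + α₂ ᶜ * (y′ * x′ + x′ * y′) + α₃ ᶜ * (x′ * x′))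
      + 2# * (η₁ * (y * y′) + (η₂ * (y * x′) + η₂ ᶜ * (x * y′)) + η₃ * (x * x′) + (ρ₁ * y + ρ₁ ᶜ * y′ + (ρ₂ * x + ρ₂ ᶜ * x′)) + r)

    f : Carrier → Carrier → Carrier
    f y x = f-poly y (y ᶜ) x (x ᶜ)

    -- The R-coordinate 2 avoids a division: the hyperbolic pair contributes -4Q(y, x), which
    -- cancels Q(2y, 2x).
    coordinates : Carrier → Carrier → Vec4 F
    coordinates y x = vec (- Q y x) 2# (2# * y) (2# * x)

    conj-Q : ∀ y x → Q y x ᶜ ≡ α₁ ᶜ * (y ᶜ * y ᶜ) + α₂ ᶜ * (y ᶜ * x ᶜ + x ᶜ * y ᶜ) + α₃ ᶜ * (x ᶜ * x ᶜ)
    conj-Q y x = trans (conj-+ _ _) (cong₂ _+_ (trans (conj-+ _ _) (cong₂ _+_ (conj-*² α₁ y y)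
      (trans (conj-* α₂ _) (cong (α₂ ᶜ *_) (trans (conj-+ _ _) (cong₂ _+_ (conj-* y x) (conj-* x y))))))) (conj-*² α₃ x x))
      where
      conj-*² : ∀ a y x → (a * (y * x)) ᶜ ≡ a ᶜ * (y ᶜ * x ᶜ)
      conj-*² a y x = trans (conj-* a _) (cong (a ᶜ *_) (conj-* y x))

    point-on-Q : ∀ y x → β (vector (coordinates y x)) (vector (coordinates y x)) ≡ 0#
    point-on-Q y x = trans (β-coordinates (coordinates y x) (coordinates y x))
      (solve 5 (λ a b c y x → let Q = a :* (y :* y) :+ b :* (y :* x :+ x :* y) :+ c :* (x :* x) in
        :- Q :* :2 :+ :2 :* :- Q :+ (a :* ((:2 :* y) :* (:2 :* y)) :+ b :* ((:2 :* y) :* (:2 :* x) :+ (:2 :* x) :* (:2 :* y)) :+ c :* ((:2 :* x) :* (:2 :* x))) := :0) refl α₁ α₂ α₃ y x)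

    h-point : ∀ y x → h (vector (coordinates y x)) (vector (coordinates y x)) ≡ 2# * f y x
    h-point y x = trans (h-coordinates (coordinates y x) (coordinates y x)) (trans
      (conjugates (trans (conj-neg (Q y x)) (cong -_ (conj-Q y x))) 2∈K (trans (conj-* 2# y) (cong (_* y ᶜ) 2∈K)) (trans (conj-* 2# x) (cong (_* x ᶜ) 2∈K)))
      (explicit (Q y x) _ r ρ₁ (ρ₁ ᶜ) ρ₂ (ρ₂ ᶜ) η₁ η₂ (η₂ ᶜ) η₃ y (y ᶜ) x (x ᶜ)))
      where
      H : Carrier → Carrier → Carrier → Carrier → Carrier
      H y₀ y₁ y₂ y₃ = - Q y x * y₁ + 2# * y₀ + r * (2# * y₁)
        + (ρ₁ * (2# * y * y₁) + ρ₁ ᶜ * (2# * y₂) + (ρ₂ * (2# * x * y₁) + ρ₂ ᶜ * (2# * y₃)))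
        + (η₁ * (2# * y * y₂) + (η₂ * (2# * y * y₃) + η₂ ᶜ * (2# * x * y₂)) + η₃ * (2# * x * y₃))
      conjugates : ∀ {a a′ b b′ c c′ d d′} → a ≡ a′ → b ≡ b′ → c ≡ c′ → d ≡ d′ → H a b c d ≡ H a′ b′ c′ d′
      conjugates refl refl refl refl = refl
      explicit : ∀ Q Q′ r ρ ρ′ σ σ′ a b b′ c y y′ x x′ →
        - Q * 2# + 2# * - Q′ + r * (2# * 2#)
        + (ρ * (2# * y * 2#) + ρ′ * (2# * (2# * y′)) + (σ * (2# * x * 2#) + σ′ * (2# * (2# * x′))))
        + (a * (2# * y * (2# * y′)) + (b * (2# * y * (2# * x′)) + b′ * (2# * x * (2# * y′))) + c * (2# * x * (2# * x′)))
        ≡ 2# * (- Q + - Q′ + 2# * (a * (y * y′) + (b * (y * x′) + b′ * (x * y′)) + c * (x * x′) + (ρ * y + ρ′ * y′ + (σ * x + σ′ * x′)) + r))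
      explicit = solve 15 (λ Q Q′ r ρ ρ′ σ σ′ a b b′ c y y′ x x′ →
        :- Q :* :2 :+ :2 :* :- Q′ :+ r :* (:2 :* :2)
        :+ (ρ :* (:2 :* y :* :2) :+ ρ′ :* (:2 :* (:2 :* y′)) :+ (σ :* (:2 :* x :* :2) :+ σ′ :* (:2 :* (:2 :* x′))))
        :+ (a :* (:2 :* y :* (:2 :* y′)) :+ (b :* (:2 :* y :* (:2 :* x′)) :+ b′ :* (:2 :* x :* (:2 :* y′))) :+ c :* (:2 :* x :* (:2 :* x′)))
        := :2 :* (:- Q :+ :- Q′ :+ :2 :* (a :* (y :* y′) :+ (b :* (y :* x′) :+ b′ :* (x :* y′)) :+ c :* (x :* x′) :+ (ρ :* y :+ ρ′ :* y′ :+ (σ :* x :+ σ′ :* x′)) :+ r))) refl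

    -- Twice the value is a Hermitian h(v, v), which conjugation fixes, and 2 is a nonzero element
    -- of `K`.
    f∈K : ∀ y x → K (f y x)
    f∈K y x = *-cancelˡ 1+1≢0 (begin
      2# * f y x ᶜ     ≡⟨ cong (_* f y x ᶜ) 2∈K ⟨
      2# ᶜ * f y x ᶜ   ≡⟨ conj-* 2# (f y x) ⟨
      (2# * f y x) ᶜ   ≡⟨ cong _ᶜ (h-point y x) ⟨
      h v v ᶜ          ≡⟨ h-sym v v ⟨
      h v v            ≡⟨ h-point y x ⟩
      2# * f y x       ∎)
      where
      open ≡-Reasoning
      v : Vec4 F
      v = vector (coordinates y x)

    e₀-coordinates : Vec4 F
    e₀-coordinates = vec 1# 0# 0# 0#

    onHQ : ∀ v → β v v ≡ 0# → h v v ≡ 0# → OnHQ F q A B v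
    onHQ v βv hv = trans (hermForm≡h v v) hv , trans (quadForm≡form B v) βv

    vector-nonzero : ∀ {x} i → x i ≢ 0# → NonZeroVec F (vector x)
    vector-nonzero {x} i xi≢0 vanishes = xi≢0 (independent x vanishes i)

    proportional-coordinates : ∀ {x y} → Proportional (vector x) (vector y) → ∃[ c ] ∃[ d ] (c ≢ 0# × d ≢ 0# × (∀ j → c * x j ≡ d * y j))
    proportional-coordinates {x} {y} (c , d , c≢0 , d≢0 , eq) = c , d , c≢0 , d≢0 ,
      combination-injective independent (λ j → c * x j) (λ j → d * y j) (λ i → trans (sym (combination-scale e c x i)) (trans (eq i) (combination-scale e d y i)))

    -- `Maybe Carrier` has q² + 1 elements. That many distinct zeros of `f`, together with `P`,
    -- whose R-coordinate is 0, would be q² + 2 common points.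
    no-large-family : (g : Maybe Carrier → Carrier × Carrier) → (∀ m n → g m ≡ g n → m ≡ n) →
      (∀ m → f (proj₁ (g m)) (proj₂ (g m)) ≡ 0#) → ⊥
    no-large-family g g-injective g-zero = ℕ.<-irrefl refl (subst (ℕ._≤ q ℕ.* q ℕ.+ 1) length≡ (few-points on-intersection distinct))
      where
      indices : List (Maybe Carrier)
      indices = nothing ∷ map just elements
      indices-unique : Unique indices
      indices-unique = All.map⁺ (All.universal (λ _ ()) elements) ∷ Unique.map⁺ (λ { refl → refl }) elements-unique
      X : Maybe Carrier → Vec4 F
      X m = coordinates (proj₁ (g m)) (proj₂ (g m))
      points : List (Vec4 F)
      points = vector e₀-coordinates ∷ map (vector ∘ X) indices
      length≡ : length points ≡ suc (q ℕ.* q ℕ.+ 1)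
      length≡ = cong suc (trans (cong suc (trans (List.length-map _ (map just elements)) (trans (List.length-map just elements) card))) (ℕ.+-comm 1 (q ℕ.* q)))
      e₀-on-H : h (vector e₀-coordinates) (vector e₀-coordinates) ≡ 0#
      e₀-on-H = trans (h-coordinates e₀-coordinates e₀-coordinates)
        (trans (vanish conj-0) (solve 10 (λ e r ρ ρ′ σ σ′ a b b′ c → :1 :* :0 :+ :0 :* e :+ r :* (:0 :* :0)
          :+ (ρ :* (:0 :* :0) :+ ρ′ :* (:0 :* :0) :+ (σ :* (:0 :* :0) :+ σ′ :* (:0 :* :0)))
          :+ (a :* (:0 :* :0) :+ (b :* (:0 :* :0) :+ b′ :* (:0 :* :0)) :+ c :* (:0 :* :0)) := :0) refl (1# ᶜ) r ρ₁ (ρ₁ ᶜ) ρ₂ (ρ₂ ᶜ) η₁ η₂ (η₂ ᶜ) η₃))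
        where
        H : Carrier → Carrier
        H z = 1# * z + 0# * 1# ᶜ + r * (0# * z)
          + (ρ₁ * (0# * z) + ρ₁ ᶜ * (0# * z) + (ρ₂ * (0# * z) + ρ₂ ᶜ * (0# * z)))
          + (η₁ * (0# * z) + (η₂ * (0# * z) + η₂ ᶜ * (0# * z)) + η₃ * (0# * z))
        vanish : ∀ {z} → z ≡ 0# → H z ≡ H 0#
        vanish refl = refl
      e₀-on-Q : β (vector e₀-coordinates) (vector e₀-coordinates) ≡ 0#
      e₀-on-Q = trans (β-coordinates e₀-coordinates e₀-coordinates)
        (solve 3 (λ a b c → :1 :* :0 :+ :0 :* :1 :+ (a :* (:0 :* :0) :+ b :* (:0 :* :0 :+ :0 :* :0) :+ c :* (:0 :* :0)) := :0) refl α₁ α₂ α₃)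
      on-intersection : All (λ v → NonZeroVec F v × OnHQ F q A B v) points
      on-intersection = (vector-nonzero {e₀-coordinates} 0F (λ 1≡0 → 0≢1 (sym 1≡0)) , onHQ _ e₀-on-Q e₀-on-H)
        ∷ All.map⁺ (All.universal (λ m → vector-nonzero {X m} 1F 1+1≢0 ,
            onHQ _ (point-on-Q _ _) (trans (h-point _ _) (trans (cong (2# *_) (g-zero m)) (zeroʳ 2#)))) indices)
      affine-distinct : ∀ {m n} → m ≢ n → ¬ Proportional (vector (X m)) (vector (X n))
      affine-distinct {m} {n} m≢n prop =
        let c , d , c≢0 , d≢0 , eq = proportional-coordinates {X m} {X n} prop
            -- Both vectors have R-coordinate 2, so the two scalars agree.
            c≡d : c ≡ d
            c≡d = *-cancelˡ 1+1≢0 (trans (*-comm 2# c) (trans (eq 1F) (*-comm d 2#)))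
            same : ∀ {u v} → c * (2# * u) ≡ d * (2# * v) → u ≡ v
            same {u} {v} e = *-cancelˡ 1+1≢0 (*-cancelˡ c≢0 (trans e (cong (_* (2# * v)) (sym c≡d))))
        in m≢n (g-injective m n (cong₂ _,_ (same (eq 2F)) (same (eq 3F))))
      at-infinity-distinct : ∀ m → ¬ Proportional (vector e₀-coordinates) (vector (X m))
      at-infinity-distinct m prop =
        let c , d , c≢0 , d≢0 , eq = proportional-coordinates {e₀-coordinates} {X m} prop
        in *-nonzero d≢0 1+1≢0 (trans (sym (eq 1F)) (zeroʳ c))
      distinct : AllPairs (λ v w → ¬ Proportional v w) points
      distinct = All.map⁺ (All.universal at-infinity-distinct indices) ∷ AllPairs.map⁺ (AllPairs.map affine-distinct indices-unique)

-- Translations by isotropic vectors.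

module IsotropicTranslations (𝓒 : Configuration) where
  open TangentForms 𝓒
  open AffinePoints 𝓒

  module InFrameTranslations (𝓕 : Frame) where
    open InFrameCounting 𝓕 public

    η₁∈K : K η₁
    η₁∈K = sym (h-sym (e 2F) (e 2F))

    -- The values of h - β at (e₂, e₂) and (e₃, e₂); both vanish exactly when h(·, e₂) = β(·, e₂) on
    -- U.
    A₁ A₂ : Carrier
    A₁ = η₁ + - α₁
    A₂ = η₂ ᶜ + - α₂

    Z : Carrier → Carrier → Carrier
    Z y x = y * A₁ + x * A₂ + ρ₁

    -- Half the slope of `f` in the direction e₂, when e₂ is isotropic for φ.
    L : Carrier → Carrier → Carrier
    L y x = Z y x + Z y x ᶜ

    conj-A₁ : A₁ ᶜ ≡ η₁ + - (α₁ ᶜ)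
    conj-A₁ = trans (conj-+ _ _) (cong₂ _+_ η₁∈K (conj-neg α₁))

    conj-A₂ : A₂ ᶜ ≡ η₂ + - (α₂ ᶜ)
    conj-A₂ = trans (conj-+ _ _) (cong₂ _+_ (conj-involutive η₂) (conj-neg α₂))

    conj-Z : ∀ y x → Z y x ᶜ ≡ y ᶜ * A₁ ᶜ + x ᶜ * A₂ ᶜ + ρ₁ ᶜ
    conj-Z y x = trans (conj-+ _ _) (cong (_+ ρ₁ ᶜ) (trans (conj-+ _ _) (cong₂ _+_ (conj-* y A₁) (conj-* x A₂))))

    -- The hypothesis is φ(e₂) = 0; it removes the term in s² from f(y + s, x).
    module _ (isotropic : 2# * η₁ ≡ α₁ + α₁ ᶜ) where

      f-translate : ∀ {s} → K s → ∀ y x → f (y + s) x ≡ f y x + s * (2# * L y x)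
      f-translate {s} s∈K y x = begin
        f-poly (y + s) ((y + s) ᶜ) x (x ᶜ)   ≡⟨ cong (λ t → f-poly (y + s) t x (x ᶜ)) (trans (conj-+ y s) (cong (y ᶜ +_) s∈K)) ⟩
        f-poly (y + s) (y ᶜ + s) x (x ᶜ)     ≡⟨ expand s y (y ᶜ) x (x ᶜ) α₁ (α₁ ᶜ) α₂ (α₂ ᶜ) (α₃) (α₃ ᶜ) η₁ η₂ (η₂ ᶜ) η₃ ρ₁ (ρ₁ ᶜ) ρ₂ (ρ₂ ᶜ) r ⟩
        f y x + s * (2# * ((y * A₁ + x * A₂ + ρ₁) + (y ᶜ * (η₁ + - (α₁ ᶜ)) + x ᶜ * (η₂ + - (α₂ ᶜ)) + ρ₁ ᶜ))) + s * s * (2# * η₁ + - (α₁ + α₁ ᶜ))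
          ≡⟨ cong₂ (λ u v → f y x + s * (2# * (Z y x + u)) + s * s * v)
               (sym (trans (conj-Z y x) (cong₂ (λ u v → y ᶜ * u + x ᶜ * v + ρ₁ ᶜ) conj-A₁ conj-A₂)))
               (trans (cong (_+ - (α₁ + α₁ ᶜ)) isotropic) (-‿inverseʳ _)) ⟩
        f y x + s * (2# * L y x) + s * s * 0#   ≡⟨ solve 2 (λ u s → u :+ s :* s :* :0 := u) refl _ s ⟩
        f y x + s * (2# * L y x)                ∎
        where
        open ≡-Reasoning
        expand : ∀ s y y′ x x′ a a′ b b′ c c′ n m m′ l ρ ρ′ σ σ′ r →
          let f = λ y y′ → - (a * (y * y) + b * (y * x + x * y) + c * (x * x)) + - (a′ * (y′ * y′) + b′ * (y′ * x′ + x′ * y′) + c′ * (x′ * x′))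
                + 2# * (n * (y * y′) + (m * (y * x′) + m′ * (x * y′)) + l * (x * x′) + (ρ * y + ρ′ * y′ + (σ * x + σ′ * x′)) + r) in
          f (y + s) (y′ + s) ≡ f y y′ + s * (2# * ((y * (n + - a) + x * (m′ + - b) + ρ) + (y′ * (n + - a′) + x′ * (m + - b′) + ρ′))) + s * s * (2# * n + - (a + a′))
        expand = solve 20 (λ s y y′ x x′ a a′ b b′ c c′ n m m′ l ρ ρ′ σ σ′ r →
          let f = λ y y′ → :- (a :* (y :* y) :+ b :* (y :* x :+ x :* y) :+ c :* (x :* x)) :+ :- (a′ :* (y′ :* y′) :+ b′ :* (y′ :* x′ :+ x′ :* y′) :+ c′ :* (x′ :* x′))
                :+ :2 :* (n :* (y :* y′) :+ (m :* (y :* x′) :+ m′ :* (x :* y′)) :+ l :* (x :* x′) :+ (ρ :* y :+ ρ′ :* y′ :+ (σ :* x :+ σ′ :* x′)) :+ r) in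
          f (y :+ s) (y′ :+ s) := f y y′ :+ s :* (:2 :* ((y :* (n :- a) :+ x :* (m′ :- b) :+ ρ) :+ (y′ :* (n :- a′) :+ x′ :* (m :- b′) :+ ρ′))) :+ s :* s :* (:2 :* n :- (a :+ a′))) refl

      -- Along y + `K` the function is affine with coefficients in `K`, so a nonzero slope yields a
      -- parameter in `K` at which it vanishes.
      zero-on-line : ∀ y x → L y x ≢ 0# → ∃[ s ] (K s × f (y + s) x ≡ 0#)
      zero-on-line y x L≢0 = s , s∈K , trans (f-translate s∈K y x) (begin
        f y x + - (2L≢0 ⁻¹ * f y x) * (2# * L y x)      ≡⟨ solve 3 (λ u i l → u :+ :- (i :* u) :* l := u :* (:1 :- l :* i)) refl (f y x) (2L≢0 ⁻¹) (2# * L y x) ⟩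
        f y x * (1# + - ((2# * L y x) * 2L≢0 ⁻¹))       ≡⟨ cong (λ t → f y x * (1# + - t)) (*-inverseʳ 2L≢0) ⟩
        f y x * (1# + - 1#)                             ≡⟨ solve 1 (λ u → u :* (:1 :- :1) := :0) refl (f y x) ⟩
        0#                                              ∎)
        where
        open ≡-Reasoning
        2L≢0 : 2# * L y x ≢ 0#
        2L≢0 = *-nonzero 1+1≢0 L≢0
        s : Carrier
        s = - (2L≢0 ⁻¹ * f y x)
        s∈K : K s
        s∈K = K-neg (K-* (K-⁻¹ 2L≢0 (K-* 2∈K (K-trace (Z y x)))) (f∈K y x))

      -- The pair (t, x) names the line (δt + `K`, x) parallel to e₂. Each line with nonzero slope
      -- carries a zero, and t is recovered from the imaginary part of that zero, so q² + 1 lines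
      -- give q² + 1 zeros.
      no-transverse-family : (t x : Maybe Carrier → Carrier) → (∀ m → K (t m)) → (∀ m → L (δ * t m) (x m) ≢ 0#) →
        (∀ m n → t m ≡ t n → x m ≡ x n → m ≡ n) → ⊥
      no-transverse-family t x t∈K L≢0 injective = no-large-family (λ m → δ * t m + s m , x m)
        (λ m n eq → injective m n (imaginary-part (t∈K m) (s∈K m) (t∈K n) (s∈K n) (cong proj₁ eq)) (cong proj₂ eq))
        (λ m → proj₂ (proj₂ (zero-on-line (δ * t m) (x m) (L≢0 m))))
        where
        s : Maybe Carrier → Carrier
        s m = proj₁ (zero-on-line (δ * t m) (x m) (L≢0 m))
        s∈K : ∀ m → K (s m)
        s∈K m = proj₁ (proj₂ (zero-on-line (δ * t m) (x m) (L≢0 m)))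
        conj-line : ∀ {t s} → K t → K s → (δ * t + s) ᶜ ≡ - δ * t + s
        conj-line {t} {s} t∈K s∈K = trans (conj-+ _ s) (cong₂ _+_ (trans (conj-* δ t) (cong₂ _*_ conj-δ t∈K)) s∈K)
        imaginary-part : ∀ {t s t′ s′} → K t → K s → K t′ → K s′ → δ * t + s ≡ δ * t′ + s′ → t ≡ t′
        imaginary-part {t} {s} {t′} {s′} t∈K s∈K t′∈K s′∈K eq = *-cancelˡ (*-nonzero 1+1≢0 δ≢0) (begin
          2# * δ * t                              ≡⟨ solve 3 (λ d t s → :2 :* d :* t := (d :* t :+ s) :- (:- d :* t :+ s)) refl δ t s ⟩
          (δ * t + s) + - (- δ * t + s)           ≡⟨ cong₂ (λ u v → u + - v) eq (trans (sym (conj-line t∈K s∈K)) (trans (cong _ᶜ eq) (conj-line t′∈K s′∈K))) ⟩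
          (δ * t′ + s′) + - (- δ * t′ + s′)       ≡⟨ solve 3 (λ d t s → :2 :* d :* t := (d :* t :+ s) :- (:- d :* t :+ s)) refl δ t′ s′ ⟨
          2# * δ * t′                             ∎)
          where open ≡-Reasoning

      -- The part of `L` that depends on x alone: on the line named by (t, x) the value is γt +
      -- w(x).
      w : Carrier → Carrier
      w x = (x * A₂ + ρ₁) + (x * A₂ + ρ₁) ᶜ

      -- The trace of `A₁` is φ(e₂). Its vanishing makes `γ` an element of `K`.
      A₁-trace : A₁ ᶜ ≡ - A₁
      A₁-trace = x-y≡0⇒x≡y (trans (cong (_+ - - A₁) conj-A₁) (trans (solve 3 (λ n a a′ → (n :- a′) :- (:- (n :- a)) := :2 :* n :- (a :+ a′)) refl η₁ α₁ (α₁ ᶜ))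
        (trans (cong (_+ - (α₁ + α₁ ᶜ)) isotropic) (-‿inverseʳ _))))

      γ : Carrier
      γ = 2# * (δ * A₁)

      γ∈K : K γ
      γ∈K = K-* 2∈K (trans (conj-* δ A₁) (trans (cong₂ _*_ conj-δ A₁-trace) (solve 2 (λ d a → :- d :* :- a := d :* a) refl δ A₁)))

      L-transverse : ∀ {t} → K t → ∀ x → L (δ * t) x ≡ γ * t + w x
      L-transverse {t} t∈K x = trans (cong (Z (δ * t) x +_) (trans (conj-Z (δ * t) x) (cong₂ (λ u v → u * v + x ᶜ * A₂ ᶜ + ρ₁ ᶜ) (trans (conj-* δ t) (cong₂ _*_ conj-δ t∈K)) A₁-trace)))
        (trans (solve 8 (λ d t a x b c x′b′ c′ → (d :* t :* a :+ x :* b :+ c) :+ (:- d :* t :* :- a :+ x′b′ :+ c′) := :2 :* (d :* a) :* t :+ ((x :* b :+ c) :+ (x′b′ :+ c′)))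
                 refl δ t A₁ x A₂ ρ₁ (x ᶜ * A₂ ᶜ) (ρ₁ ᶜ))
               (cong (λ u → γ * t + ((x * A₂ + ρ₁) + u)) (sym (trans (conj-+ _ _) (cong (_+ ρ₁ ᶜ) (conj-* x A₂))))))

      -- If `A₁` is nonzero, so is `γ`, and for every x some t gives `L` any prescribed value in
      -- `K`. The value 1 for all q² choices of x, and the value -1 for x = 0, make q² + 1 lines.
      A₁≡0 : A₁ ≡ 0#
      A₁≡0 with A₁ ≟ 0#
      ... | yes eq = eq
      ... | no A₁≢0 = ⊥-elim (no-transverse-family (λ m → γ≢0 ⁻¹ * (c m + - w (x m))) x
          (λ m → K-* (K-⁻¹ γ≢0 γ∈K) (K-+ (c∈K m) (K-neg (K-trace _))))
          (λ m L≡0 → c≢0 m (trans (sym (value m)) L≡0)) injective)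
        where
        γ≢0 : γ ≢ 0#
        γ≢0 = *-nonzero 1+1≢0 (*-nonzero δ≢0 A₁≢0)
        c x : Maybe Carrier → Carrier
        c nothing  = - 1#
        c (just _) = 1#
        x nothing  = 0#
        x (just z) = z
        c∈K : ∀ m → K (c m)
        c∈K nothing  = K-neg K-1
        c∈K (just _) = K-1
        1≢0 : 1# ≢ 0#
        1≢0 1≡0 = 0≢1 (sym 1≡0)
        c≢0 : ∀ m → c m ≢ 0#
        c≢0 nothing  = -‿nonzero 1≢0
        c≢0 (just _) = 1≢0
        value : ∀ m → L (δ * (γ≢0 ⁻¹ * (c m + - w (x m)))) (x m) ≡ c m
        value m = trans (L-transverse (K-* (K-⁻¹ γ≢0 γ∈K) (K-+ (c∈K m) (K-neg (K-trace _)))) (x m))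
          (trans (solve 4 (λ g i c w → g :* (i :* (c :- w)) :+ w := (g :* i) :* (c :- w) :+ w) refl γ (γ≢0 ⁻¹) (c m) (w (x m)))
            (trans (cong (λ u → u * (c m + - w (x m)) + w (x m)) (*-inverseʳ γ≢0)) (solve 2 (λ c w → :1 :* (c :- w) :+ w := c) refl (c m) (w (x m)))))
        same-c : ∀ m n → γ≢0 ⁻¹ * (c m + - w (x m)) ≡ γ≢0 ⁻¹ * (c n + - w (x n)) → x m ≡ x n → c m ≡ c n
        same-c m n t≡ x≡ = +-cancelˡ (- w (x n)) (trans (+-comm _ _) (trans (trans (cong (λ u → c m + - w u) (sym x≡)) (*-cancelˡ (⁻¹-nonzero γ≢0) t≡)) (+-comm _ _)))
        1≢-1 : 1# ≢ - 1#
        1≢-1 eq = 1+1≢0 (trans (cong (1# +_) eq) (-‿inverseʳ 1#))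
        injective : ∀ m n → γ≢0 ⁻¹ * (c m + - w (x m)) ≡ γ≢0 ⁻¹ * (c n + - w (x n)) → x m ≡ x n → m ≡ n
        injective nothing  nothing  _  _  = refl
        injective nothing  (just z) t≡ x≡ = ⊥-elim (1≢-1 (sym (same-c nothing (just z) t≡ x≡)))
        injective (just z) nothing  t≡ x≡ = ⊥-elim (1≢-1 (same-c (just z) nothing t≡ x≡))
        injective (just z) (just _) _  x≡ = cong just x≡

      L-flat : ∀ {t} → K t → ∀ x → L (δ * t) x ≡ w x
      L-flat {t} t∈K x = trans (L-transverse t∈K x) (trans (cong (λ a → 2# * (δ * a) * t + w x) A₁≡0) (solve 3 (λ d t w → :2 :* (d :* :0) :* t :+ w := w) refl δ t (w x)))

      -- With `A₁` zero, `L` is w(x), and passing from z to z + 1/A₂ raises it by 2. Hence one of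
      -- the two has nonzero slope; the label t = 0 or 1 records which was taken and keeps the lines
      -- distinct. The label t = 2 supplies one line more.
      A₂≡0 : A₂ ≡ 0#
      A₂≡0 with A₂ ≟ 0#
      ... | yes eq = eq
      ... | no A₂≢0 = ⊥-elim (no-transverse-family t x t∈K L≢0 injective)
        where
        shifted : ∀ z → w (z + A₂≢0 ⁻¹) ≡ w z + 2#
        shifted z = trans (cong (λ u → u + u ᶜ) step) (trans (cong ((z * A₂ + ρ₁) + 1# +_) (trans (conj-+ (z * A₂ + ρ₁) 1#) (cong ((z * A₂ + ρ₁) ᶜ +_) conj-1)))
          (solve 2 (λ u v → (u :+ :1) :+ (v :+ :1) := (u :+ v) :+ :2) refl (z * A₂ + ρ₁) ((z * A₂ + ρ₁) ᶜ)))
          where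
          step : (z + A₂≢0 ⁻¹) * A₂ + ρ₁ ≡ (z * A₂ + ρ₁) + 1#
          step = trans (solve 4 (λ z i a c → (z :+ i) :* a :+ c := (z :* a :+ c) :+ a :* i) refl z (A₂≢0 ⁻¹) A₂ ρ₁) (cong ((z * A₂ + ρ₁) +_) (*-inverseʳ A₂≢0))
        good : Carrier → Carrier × Carrier
        good z with w z ≟ 0#
        ... | yes _ = 1# , z + A₂≢0 ⁻¹
        ... | no  _ = 0# , z
        good-t : ∀ z → proj₁ (good z) ≡ 1# ⊎ proj₁ (good z) ≡ 0#
        good-t z with w z ≟ 0#
        ... | yes _ = inj₁ refl
        ... | no  _ = inj₂ refl
        good-w : ∀ z → w (proj₂ (good z)) ≢ 0#
        good-w z with w z ≟ 0#
        ... | yes w≡0 = λ eq → 1+1≢0 (trans (sym (+-identityˡ 2#)) (trans (cong (_+ 2#) (sym w≡0)) (trans (sym (shifted z)) eq)))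
        ... | no  w≢0 = w≢0
        good-injective : ∀ z z′ → proj₁ (good z) ≡ proj₁ (good z′) → proj₂ (good z) ≡ proj₂ (good z′) → z ≡ z′
        good-injective z z′ with w z ≟ 0# | w z′ ≟ 0#
        ... | yes _ | yes _ = λ _ eq → +-cancelˡ (A₂≢0 ⁻¹) (trans (+-comm _ _) (trans eq (+-comm _ _)))
        ... | yes _ | no  _ = λ eq _ → ⊥-elim (0≢1 (sym eq))
        ... | no  _ | yes _ = λ eq _ → ⊥-elim (0≢1 eq)
        ... | no  _ | no  _ = λ _ eq → eq
        t x : Maybe Carrier → Carrier
        t nothing  = 2#
        t (just z) = proj₁ (good z)
        x nothing  = proj₂ (good 0#)
        x (just z) = proj₂ (good z)
        t∈K : ∀ m → K (t m)
        t∈K nothing = 2∈K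
        t∈K (just z) with good-t z
        ... | inj₁ eq = subst K (sym eq) K-1
        ... | inj₂ eq = subst K (sym eq) K-0
        L≢0 : ∀ m → L (δ * t m) (x m) ≢ 0#
        L≢0 nothing  eq = good-w 0# (trans (sym (L-flat (t∈K nothing) (x nothing))) eq)
        L≢0 (just z) eq = good-w z (trans (sym (L-flat (t∈K (just z)) (x (just z)))) eq)
        2≢good : ∀ z → 2# ≢ proj₁ (good z)
        2≢good z eq with good-t z
        ... | inj₁ t≡1 = 0≢1 (sym (+-cancelˡ 1# (trans (trans eq t≡1) (sym (+-identityʳ 1#)))))
        ... | inj₂ t≡0 = 1+1≢0 (trans eq t≡0)
        injective : ∀ m n → t m ≡ t n → x m ≡ x n → m ≡ n
        injective nothing  nothing  _  _  = refl
        injective nothing  (just z) t≡ _  = ⊥-elim (2≢good z t≡)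
        injective (just z) nothing  t≡ _  = ⊥-elim (2≢good z (sym t≡))
        injective (just z) (just z′) t≡ x≡ = cong just (good-injective z z′ t≡ x≡)

      -- With `A₁` and `A₂` zero, `L` is constantly this trace. Were it nonzero, every line would
      -- qualify; t = 0 for all x and one line with t = 1 are already too many.
      ρ₁-trace : ρ₁ + ρ₁ ᶜ ≡ 0#
      ρ₁-trace with (ρ₁ + ρ₁ ᶜ) ≟ 0#
      ... | yes eq = eq
      ... | no Tr≢0 = ⊥-elim (no-transverse-family t x t∈K L≢0 injective)
        where
        t x : Maybe Carrier → Carrier
        t nothing  = 1#
        t (just _) = 0#
        x nothing  = 0#
        x (just z) = z
        t∈K : ∀ m → K (t m)
        t∈K nothing  = K-1
        t∈K (just _) = K-0
        w-constant : ∀ z → w z ≡ ρ₁ + ρ₁ ᶜ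
        w-constant z = cong (λ u → u + u ᶜ) (trans (cong (λ a → z * a + ρ₁) A₂≡0) (solve 2 (λ z c → z :* :0 :+ c := c) refl z ρ₁))
        L≢0 : ∀ m → L (δ * t m) (x m) ≢ 0#
        L≢0 m eq = Tr≢0 (trans (sym (w-constant (x m))) (trans (sym (L-flat (t∈K m) (x m))) eq))
        injective : ∀ m n → t m ≡ t n → x m ≡ x n → m ≡ n
        injective nothing  nothing  _  _  = refl
        injective nothing  (just _) t≡ _  = ⊥-elim (0≢1 (sym t≡))
        injective (just _) nothing  t≡ _  = ⊥-elim (0≢1 t≡)
        injective (just _) (just _) _  x≡ = cong just x≡

-- Changes of frame.

module FrameChanges (𝓒 : Configuration) where
  open TangentForms 𝓒

  basis : Vec4 F → Vec4 F → Vec4 F → Fin 4 → Vec4 F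
  basis t₁ t₂ t₃ 0F = vec 1# 0# 0# 0#
  basis t₁ t₂ t₃ 1F = t₁
  basis t₁ t₂ t₃ 2F = t₂
  basis t₁ t₂ t₃ 3F = t₃

  module Rebase (𝓕 : Frame) where
    open InFrame 𝓕

    b : Vec4 F → Vec4 F → Carrier
    b x y = x 0F * y 1F + x 1F * y 0F + (α₁ * (x 2F * y 2F) + α₂ * (x 2F * y 3F + x 3F * y 2F) + α₃ * (x 3F * y 3F))

    -- The new vectors are given by coordinates in the old frame, so every orthogonality condition
    -- becomes a polynomial identity for `b`.
    rebase : ∀ t₁ t₂ t₃ → let t = basis t₁ t₂ t₃ in
      b (t 0F) t₁ ≡ 1# → b t₁ t₁ ≡ 0# → b t₂ (t 0F) ≡ 0# → b t₃ (t 0F) ≡ 0# → b t₂ t₁ ≡ 0# → b t₃ t₁ ≡ 0# → Independent t → Frame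
    rebase t₁ t₂ t₃ b₀₁ b₁₁ b₂₀ b₃₀ b₂₁ b₃₁ t-independent = record
      { e           = λ k → vector (t k)
      ; e₀≗P        = λ i → trans (first i) (e₀≗P i)
      ; β₀₁         = trans (β-coordinates (t 0F) t₁) b₀₁
      ; β₁₁         = trans (β-coordinates t₁ t₁) b₁₁
      ; β₂₀         = trans (β-coordinates t₂ (t 0F)) b₂₀
      ; β₃₀         = trans (β-coordinates t₃ (t 0F)) b₃₀
      ; β₂₁         = trans (β-coordinates t₂ t₁) b₂₁
      ; β₃₁         = trans (β-coordinates t₃ t₁) b₃₁
      ; independent = λ x vanishes → t-independent x (independent (combination t x) (λ i → trans (sym (combination-combination (Frame.e 𝓕) t x i)) (vanishes i)))
      }
      where
      t : Fin 4 → Vec4 F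
      t = basis t₁ t₂ t₃
      first : ∀ i → vector (t 0F) i ≡ Frame.e 𝓕 0F i
      first i = trans (combination-explicit (Frame.e 𝓕) (t 0F) i)
        (solve 4 (λ a b c d → a :* :1 :+ (b :* :0 :+ (c :* :0 :+ (d :* :0 :+ :0))) := a) refl (Frame.e 𝓕 0F i) (Frame.e 𝓕 1F i) (Frame.e 𝓕 2F i) (Frame.e 𝓕 3F i))

    -- A nonsingular 2 × 2 matrix acts on U while the hyperbolic pair stays, so no orthogonality
    -- relation is disturbed.
    replace-plane : ∀ y x y′ x′ → y * x′ + - (x * y′) ≢ 0# → Frame
    replace-plane y x y′ x′ det≢0 = rebase t₁ t₂ t₃
      (solve 3 (λ a b c → :1 :* :1 :+ :0 :* :0 :+ (a :* (:0 :* :0) :+ b :* (:0 :* :0 :+ :0 :* :0) :+ c :* (:0 :* :0)) := :1) refl α₁ α₂ α₃)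
      (solve 3 (λ a b c → :0 :* :1 :+ :1 :* :0 :+ (a :* (:0 :* :0) :+ b :* (:0 :* :0 :+ :0 :* :0) :+ c :* (:0 :* :0)) := :0) refl α₁ α₂ α₃)
      (⊥e₀ y x) (⊥e₀ y′ x′) (⊥e₁ y x) (⊥e₁ y′ x′) t-independent
      where
      t₁ t₂ t₃ : Vec4 F
      t₁ = vec 0# 1# 0# 0#
      t₂ = vec 0# 0# y x
      t₃ = vec 0# 0# y′ x′
      ⊥e₀ : ∀ y x → b (vec 0# 0# y x) (vec 1# 0# 0# 0#) ≡ 0#
      ⊥e₀ = solve 5 (λ a b c y x → :0 :* :0 :+ :0 :* :1 :+ (a :* (y :* :0) :+ b :* (y :* :0 :+ x :* :0) :+ c :* (x :* :0)) := :0) refl α₁ α₂ α₃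
      ⊥e₁ : ∀ y x → b (vec 0# 0# y x) (vec 0# 1# 0# 0#) ≡ 0#
      ⊥e₁ = solve 5 (λ a b c y x → :0 :* :1 :+ :0 :* :0 :+ (a :* (y :* :0) :+ b :* (y :* :0 :+ x :* :0) :+ c :* (x :* :0)) := :0) refl α₁ α₂ α₃
      t-independent : Independent (basis t₁ t₂ t₃)
      t-independent z vanishes = λ { 0F → z₀ ; 1F → z₁ ; 2F → z₂ ; 3F → z₃ }
        where
        at : ∀ i → ∑ F (λ j → basis t₁ t₂ t₃ j i * z j) ≡ 0#
        at i = trans (sym (combination-explicit (basis t₁ t₂ t₃) z i)) (vanishes i)
        z₀ : z 0F ≡ 0#
        z₀ = trans (solve 4 (λ a b c d → a := :1 :* a :+ (:0 :* b :+ (:0 :* c :+ (:0 :* d :+ :0)))) refl (z 0F) (z 1F) (z 2F) (z 3F)) (at 0F)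
        z₁ : z 1F ≡ 0#
        z₁ = trans (solve 4 (λ a b c d → b := :0 :* a :+ (:1 :* b :+ (:0 :* c :+ (:0 :* d :+ :0)))) refl (z 0F) (z 1F) (z 2F) (z 3F)) (at 1F)
        -- Cramer's rule for the two coordinates in the plane.
        z₂ : z 2F ≡ 0#
        z₂ = *-zero-product det≢0 (trans (solve 8 (λ y x y′ x′ a b c d → (y :* x′ :- x :* y′) :* c
          := x′ :* (:0 :* a :+ (:0 :* b :+ (y :* c :+ (y′ :* d :+ :0)))) :- y′ :* (:0 :* a :+ (:0 :* b :+ (x :* c :+ (x′ :* d :+ :0))))) refl y x y′ x′ (z 0F) (z 1F) (z 2F) (z 3F))
          (trans (cong₂ (λ u v → x′ * u + - (y′ * v)) (at 2F) (at 3F)) (solve 2 (λ u v → u :* :0 :- v :* :0 := :0) refl x′ y′)))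
        z₃ : z 3F ≡ 0#
        z₃ = *-zero-product det≢0 (trans (solve 8 (λ y x y′ x′ a b c d → (y :* x′ :- x :* y′) :* d
          := y :* (:0 :* a :+ (:0 :* b :+ (x :* c :+ (x′ :* d :+ :0)))) :- x :* (:0 :* a :+ (:0 :* b :+ (y :* c :+ (y′ :* d :+ :0))))) refl y x y′ x′ (z 0F) (z 1F) (z 2F) (z 3F))
          (trans (cong₂ (λ u v → y * u + - (x * v)) (at 3F) (at 2F)) (solve 2 (λ u v → u :* :0 :- v :* :0 := :0) refl y x)))

    β-plane : ∀ y x z w → β (vector (vec 0# 0# y x)) (vector (vec 0# 0# z w)) ≡ α₁ * (y * z) + α₂ * (y * w + x * z) + α₃ * (x * w)
    β-plane y x z w = trans (β-coordinates (vec 0# 0# y x) (vec 0# 0# z w)) (solve 1 (λ u → :0 :* :0 :+ :0 :* :0 :+ u := u) refl _)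

    h-plane : ∀ y x z w → h (vector (vec 0# 0# y x)) (vector (vec 0# 0# z w)) ≡ η₁ * (y * z ᶜ) + (η₂ * (y * w ᶜ) + η₂ ᶜ * (x * z ᶜ)) + η₃ * (x * w ᶜ)
    h-plane y x z w = trans (h-coordinates (vec 0# 0# y x) (vec 0# 0# z w)) (trans
      (cong (λ o → 0# * o + 0# * o + r * (0# * o) + (ρ₁ * (y * o) + ρ₁ ᶜ * (0# * z ᶜ) + (ρ₂ * (x * o) + ρ₂ ᶜ * (0# * w ᶜ))) + (η₁ * (y * z ᶜ) + (η₂ * (y * w ᶜ) + η₂ ᶜ * (x * z ᶜ)) + η₃ * (x * w ᶜ))) conj-0)
      (solve 10 (λ r ρ ρ′ σ σ′ y x z w u → :0 :* :0 :+ :0 :* :0 :+ r :* (:0 :* :0) :+ (ρ :* (y :* :0) :+ ρ′ :* (:0 :* z) :+ (σ :* (x :* :0) :+ σ′ :* (:0 :* w))) :+ u := u) refl r ρ₁ (ρ₁ ᶜ) ρ₂ (ρ₂ ᶜ) y x (z ᶜ) (w ᶜ) _))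

    h-plane-e₁ : ∀ y x → h (vector (vec 0# 0# y x)) (vector (vec 0# 1# 0# 0#)) ≡ ρ₁ * y + ρ₂ * x
    h-plane-e₁ y x = trans (h-coordinates (vec 0# 0# y x) (vec 0# 1# 0# 0#)) (trans
      (cong₂ (λ o i → 0# * i + 0# * o + r * (0# * i) + (ρ₁ * (y * i) + ρ₁ ᶜ * (0# * o) + (ρ₂ * (x * i) + ρ₂ ᶜ * (0# * o))) + (η₁ * (y * o) + (η₂ * (y * o) + η₂ ᶜ * (x * o)) + η₃ * (x * o))) conj-0 conj-1)
      (solve 11 (λ r ρ ρ′ σ σ′ a b b′ c y x → :0 :* :1 :+ :0 :* :0 :+ r :* (:0 :* :1) :+ (ρ :* (y :* :1) :+ ρ′ :* (:0 :* :0) :+ (σ :* (x :* :1) :+ σ′ :* (:0 :* :0))) :+ (a :* (y :* :0) :+ (b :* (y :* :0) :+ b′ :* (x :* :0)) :+ c :* (x :* :0))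
        := ρ :* y :+ σ :* x) refl r ρ₁ (ρ₁ ᶜ) ρ₂ (ρ₂ ᶜ) η₁ η₂ (η₂ ᶜ) η₃ y x))

    h-e₁-e₁ : h (vector (vec 0# 1# 0# 0#)) (vector (vec 0# 1# 0# 0#)) ≡ r
    h-e₁-e₁ = trans (h-coordinates (vec 0# 1# 0# 0#) (vec 0# 1# 0# 0#)) (trans
      (cong₂ (λ o i → 0# * i + 1# * o + r * (1# * i) + (ρ₁ * (0# * i) + ρ₁ ᶜ * (1# * o) + (ρ₂ * (0# * i) + ρ₂ ᶜ * (1# * o))) + (η₁ * (0# * o) + (η₂ * (0# * o) + η₂ ᶜ * (0# * o)) + η₃ * (0# * o))) conj-0 conj-1)
      (solve 9 (λ r ρ ρ′ σ σ′ a b b′ c → :0 :* :1 :+ :1 :* :0 :+ r :* (:1 :* :1) :+ (ρ :* (:0 :* :1) :+ ρ′ :* (:1 :* :0) :+ (σ :* (:0 :* :1) :+ σ′ :* (:1 :* :0))) :+ (a :* (:0 :* :0) :+ (b :* (:0 :* :0) :+ b′ :* (:0 :* :0)) :+ c :* (:0 :* :0))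
        := r) refl r ρ₁ (ρ₁ ᶜ) ρ₂ (ρ₂ ᶜ) η₁ η₂ (η₂ ᶜ) η₃))

-- Isotropic vectors of the plane U.

module IsotropicPlanes (𝓒 : Configuration) where
  open TangentForms 𝓒
  open IsotropicTranslations 𝓒
  open FrameChanges 𝓒
  open Configuration 𝓒 using (q-oddPrimePower; card)
  open TernaryForms F q q-oddPrimePower card using (ternary-isotropic)
  module At = InFrameTranslations

  zero-pair? : ∀ y x → Dec (y ≡ 0# × x ≡ 0#)
  zero-pair? y x = (y ≟ 0#) ×-dec (x ≟ 0#)

  -- The conditions φ(e₂) = 0 and φ(e₃) = 0.
  Isotropic₁ Isotropic₂ : Frame → Set
  Isotropic₁ 𝓕 = (1# + 1#) * At.η₁ 𝓕 ≡ At.α₁ 𝓕 + At.α₁ 𝓕 ᶜ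
  Isotropic₂ 𝓕 = (1# + 1#) * At.η₃ 𝓕 ≡ At.α₃ 𝓕 + At.α₃ 𝓕 ᶜ

  double-zero : ∀ {x} → x ≡ - x → x ≡ 0#
  double-zero {x} x≡-x = *-zero-product 1+1≢0 (trans (solve 1 (λ x → :2 :* x := x :+ x) refl x) (trans (cong (x +_) x≡-x) (-‿inverseʳ x)))

  -- If e₂ and δe₂ are both isotropic for 2h − Tr β, both lie in the radical, which forces h(e₂, ·) = 0 on the
  -- plane e₂, e₃; then e₂ − ρ₁e₀ is in the radical of h.
  isotropic-line⇒⊥ : ∀ 𝓕 → At.η₁ 𝓕 ≡ 0# → At.α₁ 𝓕 + At.α₁ 𝓕 ᶜ ≡ 0# → ⊥
  isotropic-line⇒⊥ 𝓕 η₁≡0 Trα₁≡0 = 0≢1 (sym (independent radical-coordinates radical-vanishes 2F))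
    where
    open At 𝓕
    open Rebase 𝓕
    isotropic : Isotropic₁ 𝓕
    isotropic = trans (cong (2# *_) η₁≡0) (trans (zeroʳ 2#) (sym Trα₁≡0))
    α₁≡0 : α₁ ≡ 0#
    α₁≡0 = trans (sym (x-y≡0⇒x≡y (A₁≡0 isotropic))) η₁≡0
    η₂ᶜ≡α₂ : η₂ ᶜ ≡ α₂
    η₂ᶜ≡α₂ = x-y≡0⇒x≡y (A₂≡0 isotropic)
    𝓖 : Frame
    𝓖 = replace-plane δ 0# 0# 1# (λ det≡0 → δ≢0 (trans (solve 1 (λ d → d := d :* :1 :- :0 :* :0) refl δ) det≡0))
    𝓖-η₁ : At.η₁ 𝓖 ≡ 0#
    𝓖-η₁ = trans (h-plane δ 0# δ 0#) (trans (cong₂ (λ n o → n * (δ * δ ᶜ) + (η₂ * (δ * o) + η₂ ᶜ * (0# * δ ᶜ)) + η₃ * (0# * o)) η₁≡0 conj-0)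
      (solve 5 (λ d d′ b b′ c → :0 :* (d :* d′) :+ (b :* (d :* :0) :+ b′ :* (:0 :* d′)) :+ c :* (:0 :* :0) := :0) refl δ (δ ᶜ) η₂ (η₂ ᶜ) η₃))
    𝓖-α₁ : At.α₁ 𝓖 ≡ 0#
    𝓖-α₁ = trans (β-plane δ 0# δ 0#) (trans (cong (λ a → a * (δ * δ) + α₂ * (δ * 0# + 0# * δ) + α₃ * (0# * 0#)) α₁≡0)
      (solve 3 (λ d b c → :0 :* (d :* d) :+ b :* (d :* :0 :+ :0 :* d) :+ c :* (:0 :* :0) := :0) refl δ α₂ α₃))
    𝓖-isotropic : Isotropic₁ 𝓖
    𝓖-isotropic = trans (cong (2# *_) 𝓖-η₁) (trans (zeroʳ 2#) (sym (trans (cong (λ a → a + a ᶜ) 𝓖-α₁) (trans (+-identityˡ _) conj-0))))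
    𝓖-η₂ : At.η₂ 𝓖 ≡ δ * η₂
    𝓖-η₂ = trans (h-plane δ 0# 0# 1#) (trans (cong₂ (λ o i → η₁ * (δ * o) + (η₂ * (δ * i) + η₂ ᶜ * (0# * o)) + η₃ * (0# * i)) conj-0 conj-1)
      (solve 5 (λ d a b b′ c → a :* (d :* :0) :+ (b :* (d :* :1) :+ b′ :* (:0 :* :0)) :+ c :* (:0 :* :1) := d :* b) refl δ η₁ η₂ (η₂ ᶜ) η₃))
    𝓖-α₂ : At.α₂ 𝓖 ≡ δ * α₂
    𝓖-α₂ = trans (β-plane δ 0# 0# 1#) (solve 4 (λ d a b c → a :* (d :* :0) :+ b :* (d :* :1 :+ :0 :* :0) :+ c :* (:0 :* :1) := d :* b) refl δ α₁ α₂ α₃)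
    α₂≡0 : α₂ ≡ 0#
    -- For e₂ the radical condition reads h(e₃, e₂) = β(e₃, e₂) = α₂. Replacing e₂ by δe₂ multiplies
    -- the Hermitian side by the conjugate -δ and the bilinear side by δ.
    α₂≡0 = *-zero-product δ≢0 (double-zero (begin
      δ * α₂            ≡⟨ 𝓖-α₂ ⟨
      At.α₂ 𝓖            ≡⟨ x-y≡0⇒x≡y (At.A₂≡0 𝓖 𝓖-isotropic) ⟨
      At.η₂ 𝓖 ᶜ          ≡⟨ cong _ᶜ 𝓖-η₂ ⟩
      (δ * η₂) ᶜ        ≡⟨ conj-* δ η₂ ⟩
      δ ᶜ * η₂ ᶜ        ≡⟨ cong₂ _*_ conj-δ η₂ᶜ≡α₂ ⟩
      - δ * α₂          ≡⟨ -‿distribˡ-* δ α₂ ⟨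
      - (δ * α₂)        ∎))
      where open ≡-Reasoning
    η₂ᶜ≡0 : η₂ ᶜ ≡ 0#
    η₂ᶜ≡0 = trans η₂ᶜ≡α₂ α₂≡0
    radical-coordinates : Vec4 F
    radical-coordinates = vec (- ρ₁) 0# 1# 0#
    h-radical : ∀ x → h (vector x) (vector radical-coordinates) ≡ 0#
    h-radical x = trans (h-coordinates x radical-coordinates) (trans (substitute conj-0 conj-1 (conj-neg ρ₁) η₁≡0 η₂ᶜ≡0)
      (solve 11 (λ x₀ x₁ x₂ x₃ r ρ ρ′ σ σ′ u c → x₀ :* :0 :+ x₁ :* :- ρ′ :+ r :* (x₁ :* :0) :+ (ρ :* (x₂ :* :0) :+ ρ′ :* (x₁ :* :1) :+ (σ :* (x₃ :* :0) :+ σ′ :* (x₁ :* :0)))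
        :+ (:0 :* (x₂ :* :1) :+ (u :* (x₂ :* :0) :+ :0 :* (x₃ :* :1)) :+ c :* (x₃ :* :0)) := :0)
        refl (x 0F) (x 1F) (x 2F) (x 3F) r ρ₁ (ρ₁ ᶜ) ρ₂ (ρ₂ ᶜ) η₂ η₃))
      where
      value : Carrier → Carrier → Carrier → Carrier → Carrier → Carrier
      value o i p n m = x 0F * o + x 1F * p + r * (x 1F * o) + (ρ₁ * (x 2F * o) + ρ₁ ᶜ * (x 1F * i) + (ρ₂ * (x 3F * o) + ρ₂ ᶜ * (x 1F * o)))
          + (n * (x 2F * i) + (η₂ * (x 2F * o) + m * (x 3F * i)) + η₃ * (x 3F * o))
      substitute : ∀ {o o′ i i′ p p′ n n′ m m′} → o ≡ o′ → i ≡ i′ → p ≡ p′ → n ≡ n′ → m ≡ m′ → value o i p n m ≡ value o′ i′ p′ n′ m′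
      substitute refl refl refl refl refl = refl
    radical-vanishes : ∀ i → vector radical-coordinates i ≡ 0#
    radical-vanishes = A-nondegenerate (vector radical-coordinates) λ w →
      let x , w≗ = independent⇒spanning independent w
      in trans (hermForm≡h w (vector radical-coordinates)) (trans (h-cong {y = vector radical-coordinates} (λ i → sym (w≗ i)) (λ _ → refl)) (h-radical x))

  -- One of the old e₃ and e₂ completes the given vector to a basis of U: the former if y is
  -- nonzero, the latter otherwise.
  adapt : ∀ 𝓕 y x → ¬ (y ≡ 0# × x ≡ 0#) → Σ[ 𝓖 ∈ Frame ] Frame.e 𝓖 2F ≡ At.vector 𝓕 (vec 0# 0# y x)
  adapt 𝓕 y x nonzero with y ≟ 0#
  ... | no y≢0  = Rebase.replace-plane 𝓕 y x 0# 1# (λ det≡0 → y≢0 (trans (solve 2 (λ y x → y := y :* :1 :- x :* :0) refl y x) det≡0)) , refl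
  ... | yes y≡0 = Rebase.replace-plane 𝓕 y x 1# 0# (λ det≡0 → nonzero (y≡0 , trans (solve 2 (λ y x → x := :- (y :* :0 :- x :* :1)) refl y x) (trans (cong -_ det≡0) -0#≈0#))) , refl

  -- The Hermitian counterpart of `Q`: the value h(v, v) at v = ye₂ + xe₃.
  H : Frame → Carrier → Carrier → Carrier
  H 𝓕 y x = At.η₁ 𝓕 * (y * y ᶜ) + (At.η₂ 𝓕 * (y * x ᶜ) + At.η₂ 𝓕 ᶜ * (x * y ᶜ)) + At.η₃ 𝓕 * (x * x ᶜ)

  adapt-α₁ : ∀ 𝓕 𝓖 y x → Frame.e 𝓖 2F ≡ At.vector 𝓕 (vec 0# 0# y x) → At.α₁ 𝓖 ≡ At.Q 𝓕 y x
  adapt-α₁ 𝓕 𝓖 y x eq = trans (cong (λ v → β v v) eq) (Rebase.β-plane 𝓕 y x y x)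

  adapt-η₁ : ∀ 𝓕 𝓖 y x → Frame.e 𝓖 2F ≡ At.vector 𝓕 (vec 0# 0# y x) → At.η₁ 𝓖 ≡ H 𝓕 y x
  adapt-η₁ 𝓕 𝓖 y x eq = trans (cong (λ v → h v v) eq) (Rebase.h-plane 𝓕 y x y x)

  -- A nonzero common zero could be taken as e₂, and its whole GF(q²)-line would be isotropic for φ,
  -- against the nondegeneracy of `h`.
  no-common-isotropic : ∀ 𝓕 y x → At.Q 𝓕 y x ≡ 0# → H 𝓕 y x ≡ 0# → y ≡ 0# × x ≡ 0#
  no-common-isotropic 𝓕 y x Q≡0 H≡0 with zero-pair? y x
  ... | yes zeros = zeros
  ... | no nonzero =
    let 𝓖 , eq = adapt 𝓕 y x nonzero
        α₁≡0   = trans (adapt-α₁ 𝓕 𝓖 y x eq) Q≡0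
    in ⊥-elim (isotropic-line⇒⊥ 𝓖 (trans (adapt-η₁ 𝓕 𝓖 y x eq) H≡0) (trans (cong (λ a → a + a ᶜ) α₁≡0) (trans (+-identityˡ _) conj-0)))

  module _ (𝓕 : Frame) where
    open At 𝓕

    conj-δs : ∀ {s} → K s → (δ * s) ᶜ ≡ - δ * s
    conj-δs {s} s∈K = trans (conj-* δ s) (cong₂ _*_ conj-δ s∈K)

    conj-y+δz : ∀ {y z} → K y → K z → (y + δ * z) ᶜ ≡ y + - δ * z
    conj-y+δz y∈K z∈K = trans (conj-+ _ _) (cong₂ _+_ y∈K (conj-δs z∈K))

    δ²∈K : K (δ * δ)
    δ²∈K = trans (conj-* δ δ) (trans (cong₂ _*_ conj-δ conj-δ) (solve 1 (λ d → :- d :* :- d := d :* d) refl δ))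

    K-δ* : ∀ {x} → x ᶜ ≡ - x → K (δ * x)
    K-δ* {x} x-trace = trans (conj-* δ x) (trans (cong₂ _*_ conj-δ x-trace) (solve 2 (λ d x → :- d :* :- x := d :* x) refl δ x))

    η₃∈K : K η₃
    η₃∈K = sym (h-sym (e 3F) (e 3F))

    -- The vectors δs e₂ + (y + δz)e₃ form a three-dimensional space over `K`, on which φ is a
    -- ternary form. Since it contains no nonzero `K`-multiple of e₂, a new direction appears even
    -- when e₂ is already isotropic.
    isotropic-vector : ∃[ s ] ∃[ y ] ∃[ z ] (K s × K y × K z × ¬ (s ≡ 0# × y ≡ 0# × z ≡ 0#) ×
      2# * H 𝓕 (δ * s) (y + δ * z) ≡ Q (δ * s) (y + δ * z) + Q (δ * s) (y + δ * z) ᶜ)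
    isotropic-vector =
      -- The six arguments fix the coefficients of s², y², z², sy, sz and yz computed in `expand`;
      -- the factors δ move differences of conjugates into `K`.
      let s , y , z , s∈K , y∈K , z∈K , nontrivial , zero-eq = ternary-isotropic
            (K-neg (K-* δ²∈K (K-+ (K-* 2∈K η₁∈K) (K-trace α₁))))
            (K-+ (K-* 2∈K η₃∈K) (K-neg (K-trace α₃)))
            (K-neg (K-* δ²∈K (K-+ (K-* 2∈K η₃∈K) (K-trace α₃))))
            (K-* 2∈K (K-+ (K-δ* (conj-difference η₂)) (K-neg (K-δ* (conj-difference α₂)))))
            (K-neg (K-* (K-* 2∈K δ²∈K) (K-+ (K-trace η₂) (K-trace α₂))))
            (K-neg (K-* 2∈K (K-δ* (conj-difference α₃))))
      in s , y , z , s∈K , y∈K , z∈K , nontrivial , x-y≡0⇒x≡y (begin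
        2# * H 𝓕 (δ * s) (y + δ * z) + - (Q (δ * s) (y + δ * z) + Q (δ * s) (y + δ * z) ᶜ)
          ≡⟨ cong (λ t → 2# * H 𝓕 (δ * s) (y + δ * z) + - (Q (δ * s) (y + δ * z) + t)) (conj-Q (δ * s) (y + δ * z)) ⟩
        form-value (δ * s) ((δ * s) ᶜ) (y + δ * z) ((y + δ * z) ᶜ)
          ≡⟨ cong₂ (λ u v → form-value (δ * s) u (y + δ * z) v) (conj-δs s∈K) (conj-y+δz y∈K z∈K) ⟩
        form-value (δ * s) (- δ * s) (y + δ * z) (y + - δ * z)
          ≡⟨ expand δ s y z α₁ (α₁ ᶜ) α₂ (α₂ ᶜ) α₃ (α₃ ᶜ) η₁ η₂ (η₂ ᶜ) η₃ ⟩
        _ ≡⟨ zero-eq ⟩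
        0# ∎)
      where
      open ≡-Reasoning
      form-value : Carrier → Carrier → Carrier → Carrier → Carrier
      form-value y y′ x x′ = 2# * (η₁ * (y * y′) + (η₂ * (y * x′) + η₂ ᶜ * (x * y′)) + η₃ * (x * x′))
        + - ((α₁ * (y * y) + α₂ * (y * x + x * y) + α₃ * (x * x)) + (α₁ ᶜ * (y′ * y′) + α₂ ᶜ * (y′ * x′ + x′ * y′) + α₃ ᶜ * (x′ * x′)))
      expand : ∀ d s y z a a′ b b′ c c′ n m m′ l → let Y = d * s ; Y′ = - d * s ; X = y + d * z ; X′ = y + - d * z in
        2# * (n * (Y * Y′) + (m * (Y * X′) + m′ * (X * Y′)) + l * (X * X′)) + - ((a * (Y * Y) + b * (Y * X + X * Y) + c * (X * X)) + (a′ * (Y′ * Y′) + b′ * (Y′ * X′ + X′ * Y′) + c′ * (X′ * X′)))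
        ≡ - (d * d * (2# * n + (a + a′))) * (s * s) + (2# * l + - (c + c′)) * (y * y) + - (d * d * (2# * l + (c + c′))) * (z * z)
          + (2# * (d * (m + - m′) + - (d * (b + - b′)))) * (s * y) + - (2# * (d * d) * ((m + m′) + (b + b′))) * (s * z) + - (2# * (d * (c + - c′))) * (y * z)
      expand = solve 14 (λ d s y z a a′ b b′ c c′ n m m′ l → let Y = d :* s ; Y′ = :- d :* s ; X = y :+ d :* z ; X′ = y :+ :- d :* z in
        :2 :* (n :* (Y :* Y′) :+ (m :* (Y :* X′) :+ m′ :* (X :* Y′)) :+ l :* (X :* X′)) :- ((a :* (Y :* Y) :+ b :* (Y :* X :+ X :* Y) :+ c :* (X :* X)) :+ (a′ :* (Y′ :* Y′) :+ b′ :* (Y′ :* X′ :+ X′ :* Y′) :+ c′ :* (X′ :* X′)))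
        := :- (d :* d :* (:2 :* n :+ (a :+ a′))) :* (s :* s) :+ (:2 :* l :- (c :+ c′)) :* (y :* y) :+ :- (d :* d :* (:2 :* l :+ (c :+ c′))) :* (z :* z)
          :+ (:2 :* (d :* (m :- m′) :- d :* (b :- b′))) :* (s :* y) :+ :- (:2 :* (d :* d) :* ((m :+ m′) :+ (b :+ b′))) :* (s :* z) :+ :- (:2 :* (d :* (c :- c′))) :* (y :* z)) refl

    y+δz≡0 : ∀ {y z} → K y → K z → y + δ * z ≡ 0# → y ≡ 0# × z ≡ 0#
    y+δz≡0 {y} {z} y∈K z∈K eq =
      ( *-zero-product 1+1≢0 (trans (solve 3 (λ y d z → :2 :* y := (y :+ d :* z) :+ (y :+ :- d :* z)) refl y δ z) (trans (cong₂ _+_ eq eq′) (+-identityˡ 0#)))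
      , *-zero-product (*-nonzero 1+1≢0 δ≢0) (trans (solve 3 (λ y d z → :2 :* d :* z := (y :+ d :* z) :- (y :+ :- d :* z)) refl y δ z) (trans (cong₂ (λ u v → u + - v) eq eq′) (-‿inverseʳ 0#))) )
      where
      eq′ : y + - δ * z ≡ 0#
      eq′ = trans (sym (conj-y+δz y∈K z∈K)) (trans (cong _ᶜ eq) conj-0)

-- Frames adapted to the radical W.

module MatchedFrames (𝓒 : Configuration) where
  open TangentForms 𝓒
  open FrameChanges 𝓒
  open IsotropicPlanes 𝓒

  -- Exchanging e₂ and e₃ transfers results about the first plane vector to the second.
  swap : Frame → Frame
  swap 𝓕 = Rebase.replace-plane 𝓕 0# 1# 1# 0# (λ det≡0 → 0≢1 (sym (trans (solve 0 (:1 := :- (:0 :* :0 :- :1 :* :1)) refl) (trans (cong -_ det≡0) -0#≈0#))))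

  module _ (𝓕 : Frame) where
    open At 𝓕
    open Rebase 𝓕

    swap-α₁ : At.α₁ (swap 𝓕) ≡ α₃
    swap-α₁ = trans (β-plane 0# 1# 0# 1#) (solve 3 (λ a b c → a :* (:0 :* :0) :+ b :* (:0 :* :1 :+ :1 :* :0) :+ c :* (:1 :* :1) := c) refl α₁ α₂ α₃)

    swap-α₂ : At.α₂ (swap 𝓕) ≡ α₂
    swap-α₂ = trans (β-plane 0# 1# 1# 0#) (solve 3 (λ a b c → a :* (:0 :* :1) :+ b :* (:0 :* :0 :+ :1 :* :1) :+ c :* (:1 :* :0) := b) refl α₁ α₂ α₃)

    swap-α₃ : At.α₃ (swap 𝓕) ≡ α₁
    swap-α₃ = trans (β-plane 1# 0# 1# 0#) (solve 3 (λ a b c → a :* (:1 :* :1) :+ b :* (:1 :* :0 :+ :0 :* :1) :+ c :* (:0 :* :0) := a) refl α₁ α₂ α₃)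

    swap-η₁ : At.η₁ (swap 𝓕) ≡ η₃
    swap-η₁ = trans (h-plane 0# 1# 0# 1#) (trans (cong₂ (λ o i → η₁ * (0# * o) + (η₂ * (0# * i) + η₂ ᶜ * (1# * o)) + η₃ * (1# * i)) conj-0 conj-1)
      (solve 4 (λ a b b′ c → a :* (:0 :* :0) :+ (b :* (:0 :* :1) :+ b′ :* (:1 :* :0)) :+ c :* (:1 :* :1) := c) refl η₁ η₂ (η₂ ᶜ) η₃))

    swap-η₂ : At.η₂ (swap 𝓕) ≡ η₂ ᶜ
    swap-η₂ = trans (h-plane 0# 1# 1# 0#) (trans (cong₂ (λ o i → η₁ * (0# * i) + (η₂ * (0# * o) + η₂ ᶜ * (1# * i)) + η₃ * (1# * o)) conj-0 conj-1)
      (solve 4 (λ a b b′ c → a :* (:0 :* :1) :+ (b :* (:0 :* :0) :+ b′ :* (:1 :* :1)) :+ c :* (:1 :* :0) := b′) refl η₁ η₂ (η₂ ᶜ) η₃))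

    swap-η₃ : At.η₃ (swap 𝓕) ≡ η₁
    swap-η₃ = trans (h-plane 1# 0# 1# 0#) (trans (cong₂ (λ o i → η₁ * (1# * i) + (η₂ * (1# * o) + η₂ ᶜ * (0# * i)) + η₃ * (0# * o)) conj-0 conj-1)
      (solve 4 (λ a b b′ c → a :* (:1 :* :1) :+ (b :* (:1 :* :0) :+ b′ :* (:0 :* :1)) :+ c :* (:0 :* :0) := a) refl η₁ η₂ (η₂ ᶜ) η₃))

    swap-ρ₁ : At.ρ₁ (swap 𝓕) ≡ ρ₂
    swap-ρ₁ = trans (h-plane-e₁ 0# 1#) (solve 2 (λ a b → a :* :0 :+ b :* :1 := b) refl ρ₁ ρ₂)

    swap-r : At.r (swap 𝓕) ≡ r
    swap-r = h-e₁-e₁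

    swap-isotropic₁ : Isotropic₂ 𝓕 → Isotropic₁ (swap 𝓕)
    swap-isotropic₁ iso = trans (cong (2# *_) swap-η₁) (trans iso (cong (λ a → a + a ᶜ) (sym swap-α₁)))

    swap-isotropic₂ : Isotropic₁ 𝓕 → Isotropic₂ (swap 𝓕)
    swap-isotropic₂ iso = trans (cong (2# *_) swap-η₃) (trans iso (cong (λ a → a + a ᶜ) (sym swap-α₃)))

  -- Expresses that e₂ and e₃ lie in W, with `β` and `h` equal and real on their `K`-span. That `α₁`
  -- and `α₃` are real follows from h(v, v) being so.
  record Matched (𝓕 : Frame) : Set where
    open At 𝓕
    field
      α₁≡η₁ : α₁ ≡ η₁
      α₂≡η₂ : α₂ ≡ η₂
      α₃≡η₃ : α₃ ≡ η₃
      α₂∈K  : K α₂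
      conj-ρ₁ : ρ₁ ᶜ ≡ - ρ₁
      conj-ρ₂ : ρ₂ ᶜ ≡ - ρ₂

  trace-0⇒conj : ∀ {x} → x + x ᶜ ≡ 0# → x ᶜ ≡ - x
  trace-0⇒conj {x} eq = x-y≡0⇒x≡y (trans (solve 2 (λ x y → y :- (:- x) := x :+ y) refl x (x ᶜ)) eq)

  -- The facts about e₃ come from the swapped frame. One frame gives that `α₂` is the conjugate of
  -- `η₂`, the other that it is `η₂` itself, so it lies in `K`.
  matched : ∀ 𝓕 → Isotropic₁ 𝓕 → Isotropic₂ 𝓕 → Matched 𝓕
  matched 𝓕 iso₁ iso₂ = record
    { α₁≡η₁   = sym (x-y≡0⇒x≡y (A₁≡0 iso₁))
    ; α₂≡η₂   = α₂≡η₂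
    ; α₃≡η₃   = trans (sym (swap-α₁ 𝓕)) (trans (sym (x-y≡0⇒x≡y (At.A₁≡0 (swap 𝓕) (swap-isotropic₁ 𝓕 iso₂)))) (swap-η₁ 𝓕))
    ; α₂∈K    = trans (cong _ᶜ α₂≡η₂) η₂ᶜ≡α₂
    ; conj-ρ₁ = trace-0⇒conj (ρ₁-trace iso₁)
    ; conj-ρ₂ = trace-0⇒conj (subst (λ x → x + x ᶜ ≡ 0#) (swap-ρ₁ 𝓕) (At.ρ₁-trace (swap 𝓕) (swap-isotropic₁ 𝓕 iso₂)))
    }
    where
    open At 𝓕
    η₂ᶜ≡α₂ : η₂ ᶜ ≡ α₂
    η₂ᶜ≡α₂ = x-y≡0⇒x≡y (A₂≡0 iso₁)
    α₂≡η₂ : α₂ ≡ η₂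
    α₂≡η₂ = trans (sym (swap-α₂ 𝓕)) (trans (sym (x-y≡0⇒x≡y (At.A₂≡0 (swap 𝓕) (swap-isotropic₁ 𝓕 iso₂)))) (trans (cong _ᶜ (swap-η₂ 𝓕)) (conj-involutive η₂)))

  isotropic-frame₁ : Frame → Σ[ 𝓖 ∈ Frame ] Isotropic₁ 𝓖
  isotropic-frame₁ 𝓕 =
    let s , y , z , s∈K , y∈K , z∈K , nontrivial , iso = isotropic-vector 𝓕
        𝓖 , eq = adapt 𝓕 (δ * s) (y + δ * z) (λ (δs≡0 , x≡0) → nontrivial (*-zero-product δ≢0 δs≡0 , y+δz≡0 𝓕 y∈K z∈K x≡0))
    in 𝓖 , trans (cong ((1# + 1#) *_) (adapt-η₁ 𝓕 𝓖 _ _ eq)) (trans iso (sym (cong (λ a → a + a ᶜ) (adapt-α₁ 𝓕 𝓖 _ _ eq))))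

  -- The vector found by `isotropic-vector` has a nonzero e₃-coordinate: otherwise it is an
  -- imaginary multiple of e₂, and an entire GF(q²)-line would be isotropic. It can therefore
  -- replace e₃.
  isotropic-frame₂ : ∀ 𝓖 → Isotropic₁ 𝓖 → Σ[ 𝓗 ∈ Frame ] (Isotropic₁ 𝓗 × Isotropic₂ 𝓗)
  isotropic-frame₂ 𝓖 iso₁ = build (isotropic-vector 𝓖)
    where
    open At 𝓖
    open Rebase 𝓖
    Result : Set
    Result = Σ[ 𝓗 ∈ Frame ] (Isotropic₁ 𝓗 × Isotropic₂ 𝓗)
    H-axis : ∀ y → H 𝓖 y 0# ≡ η₁ * (y * y ᶜ)
    H-axis y = trans (cong (λ o → η₁ * (y * y ᶜ) + (η₂ * (y * o) + η₂ ᶜ * (0# * y ᶜ)) + η₃ * (0# * o)) conj-0)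
      (solve 6 (λ a b b′ c y y′ → a :* (y :* y′) :+ (b :* (y :* :0) :+ b′ :* (:0 :* y′)) :+ c :* (:0 :* :0) := a :* (y :* y′)) refl η₁ η₂ (η₂ ᶜ) η₃ y (y ᶜ))
    Q-axis : ∀ y → Q y 0# ≡ α₁ * (y * y)
    Q-axis = solve 4 (λ a b c y → a :* (y :* y) :+ b :* (y :* :0 :+ :0 :* y) :+ c :* (:0 :* :0) := a :* (y :* y)) refl α₁ α₂ α₃
    -- Passing from e₂ to ye₂ multiplies the trace of `β` by y² but `h` by -y², so isotropy of both
    -- vectors forces the trace of `α₁`, and with it `η₁`, to vanish.
    imaginary⇒⊥ : ∀ {y} → y ᶜ ≡ - y → y ≢ 0# → 2# * H 𝓖 y 0# ≡ Q y 0# + Q y 0# ᶜ → ⊥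
    imaginary⇒⊥ {y} conj-y y≢0 iso = isotropic-line⇒⊥ 𝓖 (*-zero-product 1+1≢0 (trans iso₁ Trα₁≡0)) Trα₁≡0
      where
      open ≡-Reasoning
      Q≡ : Q y 0# + Q y 0# ᶜ ≡ (α₁ + α₁ ᶜ) * (y * y)
      Q≡ = trans (cong (λ t → t + t ᶜ) (Q-axis y)) (trans (cong (α₁ * (y * y) +_) (trans (conj-* α₁ _) (cong (α₁ ᶜ *_) (trans (conj-* y y) (cong₂ _*_ conj-y conj-y)))))
        (solve 3 (λ a a′ y → a :* (y :* y) :+ a′ :* (:- y :* :- y) := (a :+ a′) :* (y :* y)) refl α₁ (α₁ ᶜ) y))
      Trα₁≡0 : α₁ + α₁ ᶜ ≡ 0#
      Trα₁≡0 = *-zero-product (*-nonzero y≢0 y≢0) (double-zero (begin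
        y * y * (α₁ + α₁ ᶜ)        ≡⟨ *-comm _ _ ⟩
        (α₁ + α₁ ᶜ) * (y * y)      ≡⟨ trans (sym Q≡) (sym iso) ⟩
        2# * H 𝓖 y 0#              ≡⟨ cong (2# *_) (trans (H-axis y) (cong (λ t → η₁ * (y * t)) conj-y)) ⟩
        2# * (η₁ * (y * - y))      ≡⟨ solve 2 (λ n y → :2 :* (n :* (y :* :- y)) := :- (y :* y :* (:2 :* n))) refl η₁ y ⟩
        - (y * y * (2# * η₁))      ≡⟨ cong (λ t → - (y * y * t)) iso₁ ⟩
        - (y * y * (α₁ + α₁ ᶜ))    ∎))
    build : ∃[ s ] ∃[ y ] ∃[ z ] (K s × K y × K z × ¬ (s ≡ 0# × y ≡ 0# × z ≡ 0#) ×
      2# * H 𝓖 (δ * s) (y + δ * z) ≡ Q (δ * s) (y + δ * z) + Q (δ * s) (y + δ * z) ᶜ) → Result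
    build (s , y , z , s∈K , y∈K , z∈K , nontrivial , iso) = extend (x ≟ 0#)
      where
      x : Carrier
      x = y + δ * z
      conj-y : (δ * s) ᶜ ≡ - (δ * s)
      conj-y = trans (conj-δs 𝓖 s∈K) (sym (-‿distribˡ-* δ s))
      extend : Dec (x ≡ 0#) → Result
      extend (yes x≡0) = ⊥-elim (imaginary⇒⊥ conj-y
        (λ δs≡0 → nontrivial (*-zero-product δ≢0 δs≡0 , y+δz≡0 𝓖 y∈K z∈K x≡0))
        (subst (λ x → 2# * H 𝓖 (δ * s) x ≡ Q (δ * s) x + Q (δ * s) x ᶜ) x≡0 iso))
      extend (no x≢0) = 𝓗 ,
        trans (cong (2# *_) (trans (adapt-η₁ 𝓖 𝓗 1# 0# refl) (trans (H-axis 1#) (trans (cong (λ t → η₁ * (1# * t)) conj-1) (unit η₁)))))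
          (trans iso₁ (sym (cong (λ a → a + a ᶜ) (trans (adapt-α₁ 𝓖 𝓗 1# 0# refl) (trans (Q-axis 1#) (unit α₁)))))) ,
        trans (cong (2# *_) (h-plane (δ * s) x (δ * s) x)) (trans iso (sym (cong (λ a → a + a ᶜ) (β-plane (δ * s) x (δ * s) x))))
        where
        unit : ∀ a → a * (1# * 1#) ≡ a
        unit = solve 1 (λ a → a :* (:1 :* :1) := a) refl
        𝓗 : Frame
        𝓗 = replace-plane 1# 0# (δ * s) x (λ det≡0 → x≢0 (trans (solve 2 (λ x y → x := :1 :* x :- :0 :* y) refl x (δ * s)) det≡0))

-- Normal frames: moving R to a zero of f.

module NormalFrames (𝓒 : Configuration) where
  open TangentForms 𝓒
  open FrameChanges 𝓒
  open IsotropicPlanes 𝓒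
  open MatchedFrames 𝓒
  open Configuration 𝓒 using (q-oddPrimePower; card)
  open TernaryForms F q q-oddPrimePower card using (ternary-isotropic)

  module _ {𝓕 : Frame} (m : Matched 𝓕) where
    open At 𝓕
    open Matched m

    α₁∈K : K α₁
    α₁∈K = trans (cong _ᶜ α₁≡η₁) (trans η₁∈K (sym α₁≡η₁))

    α₃∈K : K α₃
    α₃∈K = trans (cong _ᶜ α₃≡η₃) (trans (η₃∈K 𝓕) (sym α₃≡η₃))

    η₂ᶜ≡α₂ : η₂ ᶜ ≡ α₂
    η₂ᶜ≡α₂ = trans (cong _ᶜ (sym α₂≡η₂)) α₂∈K

    H-real : ∀ {y x} → K y → K x → H 𝓕 y x ≡ Q y x
    H-real {y} {x} y∈K x∈K = trans (substitute (sym α₁≡η₁) (sym α₂≡η₂) η₂ᶜ≡α₂ (sym α₃≡η₃) y∈K x∈K)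
      (solve 5 (λ a b c y x → a :* (y :* y) :+ (b :* (y :* x) :+ b :* (x :* y)) :+ c :* (x :* x) := a :* (y :* y) :+ b :* (y :* x :+ x :* y) :+ c :* (x :* x)) refl α₁ α₂ α₃ y x)
      where
      value : (a b b′ c y′ x′ : Carrier) → Carrier
      value a b b′ c y′ x′ = a * (y * y′) + (b * (y * x′) + b′ * (x * y′)) + c * (x * x′)
      substitute : ∀ {a a₁ b b₁ b′ b₁′ c c₁ y′ y₁ x′ x₁} → a ≡ a₁ → b ≡ b₁ → b′ ≡ b₁′ → c ≡ c₁ → y′ ≡ y₁ → x′ ≡ x₁ → value a b b′ c y′ x′ ≡ value a₁ b₁ b₁′ c₁ y₁ x₁
      substitute refl refl refl refl refl refl = refl

    -- On real coordinates the two forms agree, so a zero of `Q` is a common isotropic vector.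
    anisotropic : ∀ {y x} → K y → K x → Q y x ≡ 0# → y ≡ 0# × x ≡ 0#
    anisotropic y∈K x∈K Q≡0 = no-common-isotropic 𝓕 _ _ Q≡0 (trans (H-real y∈K x∈K) Q≡0)

    -- With equal and real Gram entries, the squares, conjugate squares and norms combine into -Q of
    -- the differences y - ȳ and x - x̄. In particular `f` is constant on cosets of the real plane.
    f-matched : ∀ y x → let S = y + - (y ᶜ) ; T = x + - (x ᶜ) in
      f y x ≡ - (α₁ * (S * S) + α₂ * (S * T + T * S) + α₃ * (T * T)) + 2# * (S * ρ₁ + T * ρ₂ + r)
    f-matched y x = trans (substitute α₁∈K α₂∈K α₃∈K (sym α₁≡η₁) (sym α₂≡η₂) η₂ᶜ≡α₂ (sym α₃≡η₃) conj-ρ₁ conj-ρ₂)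
      (solve 10 (λ a b c ρ σ r y y′ x x′ → let S = y :- y′ ; T = x :- x′ in
        :- (a :* (y :* y) :+ b :* (y :* x :+ x :* y) :+ c :* (x :* x)) :+ :- (a :* (y′ :* y′) :+ b :* (y′ :* x′ :+ x′ :* y′) :+ c :* (x′ :* x′))
          :+ :2 :* (a :* (y :* y′) :+ (b :* (y :* x′) :+ b :* (x :* y′)) :+ c :* (x :* x′) :+ (ρ :* y :+ :- ρ :* y′ :+ (σ :* x :+ :- σ :* x′)) :+ r)
        := :- (a :* (S :* S) :+ b :* (S :* T :+ T :* S) :+ c :* (T :* T)) :+ :2 :* (S :* ρ :+ T :* σ :+ r)) refl α₁ α₂ α₃ ρ₁ ρ₂ r y (y ᶜ) x (x ᶜ))
      where
      value : (a′ b′ c′ n u u′ l ρ′ σ′ : Carrier) → Carrier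
      value a′ b′ c′ n u u′ l ρ′ σ′ = - (α₁ * (y * y) + α₂ * (y * x + x * y) + α₃ * (x * x)) + - (a′ * (y ᶜ * y ᶜ) + b′ * (y ᶜ * x ᶜ + x ᶜ * y ᶜ) + c′ * (x ᶜ * x ᶜ))
        + 2# * (n * (y * y ᶜ) + (u * (y * x ᶜ) + u′ * (x * y ᶜ)) + l * (x * x ᶜ) + (ρ₁ * y + ρ′ * y ᶜ + (ρ₂ * x + σ′ * x ᶜ)) + r)
      substitute : ∀ {a a₁ b b₁ c c₁ n n₁ u u₁ u′ u₁′ l l₁ ρ ρ′ σ σ′} → a ≡ a₁ → b ≡ b₁ → c ≡ c₁ → n ≡ n₁ → u ≡ u₁ → u′ ≡ u₁′ → l ≡ l₁ → ρ ≡ ρ′ → σ ≡ σ′ →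
        value a b c n u u′ l ρ σ ≡ value a₁ b₁ c₁ n₁ u₁ u₁′ l₁ ρ′ σ′
      substitute refl refl refl refl refl refl refl refl refl = refl

    4# d : Carrier
    4# = 2# * 2#
    d = δ * δ

    -- The vectors with coordinates δX, δY represent the cosets of the real plane. The literal
    -- factors `1#` mark the places of the homogenising variable in `affine-zero`.
    f-imaginary : ∀ {X Y} → K X → K Y → f (δ * X) (δ * Y) ≡
      - (4# * d * α₁) * (X * X) + - (4# * d * α₃) * (Y * Y) + 2# * r * (1# * 1#) + - (2# * (4# * d) * α₂) * (X * Y) + 4# * (δ * ρ₁) * (X * 1#) + 4# * (δ * ρ₂) * (Y * 1#)
    f-imaginary {X} {Y} X∈K Y∈K = trans (f-matched (δ * X) (δ * Y)) (trans
      (cong₂ (λ u v → let S = δ * X + - u ; T = δ * Y + - v in - (α₁ * (S * S) + α₂ * (S * T + T * S) + α₃ * (T * T)) + 2# * (S * ρ₁ + T * ρ₂ + r)) (conj-δs 𝓕 X∈K) (conj-δs 𝓕 Y∈K))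
      (solve 9 (λ a b c ρ σ r e X Y → let S = e :* X :- :- e :* X ; T = e :* Y :- :- e :* Y ; :4 = :2 :* :2 in
        :- (a :* (S :* S) :+ b :* (S :* T :+ T :* S) :+ c :* (T :* T)) :+ :2 :* (S :* ρ :+ T :* σ :+ r)
        := :- (:4 :* (e :* e) :* a) :* (X :* X) :+ :- (:4 :* (e :* e) :* c) :* (Y :* Y) :+ :2 :* r :* (:1 :* :1) :+ :- (:2 :* (:4 :* (e :* e)) :* b) :* (X :* Y) :+ :4 :* (e :* ρ) :* (X :* :1) :+ :4 :* (e :* σ) :* (Y :* :1)) refl
        α₁ α₂ α₃ ρ₁ ρ₂ r δ X Y))

    -- The homogenised polynomial is a ternary form over `K` and has a nontrivial zero (X, Y, W). If
    -- W were 0, the anisotropic leading form would vanish at (X, Y); so division by W is possible.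
    affine-zero : ∃[ y ] ∃[ x ] f y x ≡ 0#
    affine-zero = build (ternary-isotropic
        (K-neg (K-* 4d∈K α₁∈K)) (K-neg (K-* 4d∈K α₃∈K)) (K-* 2∈K r∈K) (K-neg (K-* (K-* 2∈K 4d∈K) α₂∈K))
        (K-* 4∈K (K-δ* 𝓕 conj-ρ₁)) (K-* 4∈K (K-δ* 𝓕 conj-ρ₂)))
      where
      open ≡-Reasoning
      4∈K : K 4#
      4∈K = K-* 2∈K 2∈K
      4d∈K : K (4# * d)
      4d∈K = K-* 4∈K (δ²∈K 𝓕)
      r∈K : K r
      r∈K = sym (h-sym (e 1F) (e 1F))
      T : Carrier → Carrier → Carrier → Carrier
      T X Y W = - (4# * d * α₁) * (X * X) + - (4# * d * α₃) * (Y * Y) + 2# * r * (W * W) + - (2# * (4# * d) * α₂) * (X * Y) + 4# * (δ * ρ₁) * (X * W) + 4# * (δ * ρ₂) * (Y * W)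
      T-scale : ∀ i X Y W → T (X * i) (Y * i) (W * i) ≡ i * i * T X Y W
      T-scale = λ i X Y W → solve 10 (λ a b c k l m i X Y W → a :* (X :* i :* (X :* i)) :+ b :* (Y :* i :* (Y :* i)) :+ c :* (W :* i :* (W :* i)) :+ k :* (X :* i :* (Y :* i)) :+ l :* (X :* i :* (W :* i)) :+ m :* (Y :* i :* (W :* i))
        := i :* i :* (a :* (X :* X) :+ b :* (Y :* Y) :+ c :* (W :* W) :+ k :* (X :* Y) :+ l :* (X :* W) :+ m :* (Y :* W))) refl _ _ _ _ _ _ i X Y W
      build : ∃[ X ] ∃[ Y ] ∃[ W ] (K X × K Y × K W × ¬ (X ≡ 0# × Y ≡ 0# × W ≡ 0#) × T X Y W ≡ 0#) → ∃[ y ] ∃[ x ] f y x ≡ 0#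
      build (X , Y , W , X∈K , Y∈K , W∈K , nontrivial , zero-eq) = δ * (X * i) , δ * (Y * i) , (begin
        f (δ * (X * i)) (δ * (Y * i))   ≡⟨ f-imaginary (K-* X∈K i∈K) (K-* Y∈K i∈K) ⟩
        T (X * i) (Y * i) 1#            ≡⟨ cong (T (X * i) (Y * i)) (*-inverseʳ W≢0) ⟨
        T (X * i) (Y * i) (W * i)       ≡⟨ T-scale i X Y W ⟩
        i * i * T X Y W                 ≡⟨ trans (cong (i * i *_) zero-eq) (zeroʳ _) ⟩
        0#                              ∎)
        where
        W≢0 : W ≢ 0#
        W≢0 W≡0 =
          let X≡0 , Y≡0 = anisotropic X∈K Y∈K (*-zero-product (-‿nonzero (*-nonzero (*-nonzero 1+1≢0 1+1≢0) (*-nonzero δ≢0 δ≢0))) (begin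
                - (4# * d) * Q X Y  ≡⟨ solve 9 (λ e a b c X Y k l m → :- e :* (a :* (X :* X) :+ b :* (X :* Y :+ Y :* X) :+ c :* (Y :* Y))
                     := :- (e :* a) :* (X :* X) :+ :- (e :* c) :* (Y :* Y) :+ k :* (:0 :* :0) :+ :- (:2 :* e :* b) :* (X :* Y) :+ l :* (X :* :0) :+ m :* (Y :* :0)) refl (4# * d) α₁ α₂ α₃ X Y (2# * r) (4# * (δ * ρ₁)) (4# * (δ * ρ₂)) ⟩
                T X Y 0#            ≡⟨ cong (T X Y) W≡0 ⟨
                T X Y W             ≡⟨ zero-eq ⟩
                0#                  ∎))
          in nontrivial (X≡0 , Y≡0 , W≡0)
        i : Carrier
        i = W≢0 ⁻¹
        i∈K : K i
        i∈K = K-⁻¹ W≢0 W∈K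

  ½ : Carrier
  ½ = 1+1≢0 ⁻¹

  ½∈K : K ½
  ½∈K = K-⁻¹ 1+1≢0 (K-+ K-1 K-1)

  -- An Eichler transformation fixing `P`: R moves to half the point `coordinates s t`, and e₂, e₃
  -- receive the multiples of `P` that keep them orthogonal to the new R.
  module Recentre (𝓕 : Frame) (s t : Carrier) where
    open At 𝓕
    open Rebase 𝓕

    t₁ t₂ t₃ : Vec4 F
    t₁ = vec (- (½ * Q s t)) 1# s t
    t₂ = vec (- (α₁ * s + α₂ * t)) 0# 1# 0#
    t₃ = vec (- (α₂ * s + α₃ * t)) 0# 0# 1#

    recentre : Frame
    recentre = rebase t₁ t₂ t₃
      (solve 6 (λ a b c p s t → :1 :* :1 :+ :0 :* p :+ (a :* (:0 :* s) :+ b :* (:0 :* t :+ :0 :* s) :+ c :* (:0 :* t)) := :1) refl α₁ α₂ α₃ _ s t)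
      (trans (solve 6 (λ a b c i s t → let Q = a :* (s :* s) :+ b :* (s :* t :+ t :* s) :+ c :* (t :* t) in
          :- (i :* Q) :* :1 :+ :1 :* :- (i :* Q) :+ Q := Q :* (:1 :- :2 :* i)) refl α₁ α₂ α₃ ½ s t)
        (trans (cong (λ u → Q s t * (1# + - u)) (*-inverseʳ 1+1≢0)) (solve 1 (λ u → u :* (:1 :- :1) := :0) refl (Q s t))))
      (solve 4 (λ a b c p → p :* :0 :+ :0 :* :1 :+ (a :* (:1 :* :0) :+ b :* (:1 :* :0 :+ :0 :* :0) :+ c :* (:0 :* :0)) := :0) refl α₁ α₂ α₃ _)
      (solve 4 (λ a b c p → p :* :0 :+ :0 :* :1 :+ (a :* (:0 :* :0) :+ b :* (:0 :* :0 :+ :1 :* :0) :+ c :* (:1 :* :0)) := :0) refl α₁ α₂ α₃ _)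
      (solve 6 (λ a b c p s t → :- (a :* s :+ b :* t) :* :1 :+ :0 :* p :+ (a :* (:1 :* s) :+ b :* (:1 :* t :+ :0 :* s) :+ c :* (:0 :* t)) := :0) refl α₁ α₂ α₃ (- (½ * Q s t)) s t)
      (solve 6 (λ a b c p s t → :- (b :* s :+ c :* t) :* :1 :+ :0 :* p :+ (a :* (:0 :* s) :+ b :* (:0 :* t :+ :1 :* s) :+ c :* (:1 :* t)) := :0) refl α₁ α₂ α₃ (- (½ * Q s t)) s t)
      t-independent
      where
      t-independent : Independent (basis t₁ t₂ t₃)
      t-independent z vanishes = λ { 0F → z₀ ; 1F → z₁ ; 2F → z₂ ; 3F → z₃ }
        where
        at : ∀ i → ∑ F (λ j → basis t₁ t₂ t₃ j i * z j) ≡ 0#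
        at i = trans (sym (combination-explicit (basis t₁ t₂ t₃) z i)) (vanishes i)
        z₁ : z 1F ≡ 0#
        z₁ = trans (solve 4 (λ a b c d → b := :0 :* a :+ (:1 :* b :+ (:0 :* c :+ (:0 :* d :+ :0)))) refl (z 0F) (z 1F) (z 2F) (z 3F)) (at 1F)
        z₂ : z 2F ≡ 0#
        z₂ = trans (solve 5 (λ a b c d s → c := (:0 :* a :+ (s :* b :+ (:1 :* c :+ (:0 :* d :+ :0)))) :- s :* b) refl (z 0F) (z 1F) (z 2F) (z 3F) s)
          (trans (cong₂ (λ u v → u + - (s * v)) (at 2F) z₁) (solve 1 (λ s → :0 :- s :* :0 := :0) refl s))
        z₃ : z 3F ≡ 0#
        z₃ = trans (solve 5 (λ a b c d s → d := (:0 :* a :+ (s :* b :+ (:0 :* c :+ (:1 :* d :+ :0)))) :- s :* b) refl (z 0F) (z 1F) (z 2F) (z 3F) t)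
          (trans (cong₂ (λ u v → u + - (t * v)) (at 3F) z₁) (solve 1 (λ s → :0 :- s :* :0 := :0) refl t))
        z₀ : z 0F ≡ 0#
        z₀ = trans (solve 7 (λ a b c d p m n → a := (:1 :* a :+ (p :* b :+ (m :* c :+ (n :* d :+ :0)))) :- (p :* b :+ m :* c :+ n :* d)) refl (z 0F) (z 1F) (z 2F) (z 3F) (t₁ 0F) (t₂ 0F) (t₃ 0F))
          (trans (cong (_+ - (t₁ 0F * z 1F + t₂ 0F * z 2F + t₃ 0F * z 3F)) (at 0F)) (trans (substitute z₁ z₂ z₃) (solve 3 (λ p m n → :0 :- (p :* :0 :+ m :* :0 :+ n :* :0) := :0) refl (t₁ 0F) (t₂ 0F) (t₃ 0F))))
          where
          substitute : ∀ {b c d} → b ≡ 0# → c ≡ 0# → d ≡ 0# → 0# + - (t₁ 0F * b + t₂ 0F * c + t₃ 0F * d) ≡ 0# + - (t₁ 0F * 0# + t₂ 0F * 0# + t₃ 0F * 0#)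
          substitute refl refl refl = refl

    -- `P` is isotropic and orthogonal to U, for `h` as for `β`, so adding a multiple of it changes
    -- neither form on a vector of U and isotropy survives the move.
    recentre-β : ∀ p y x → β (vector (vec p 0# y x)) (vector (vec p 0# y x)) ≡ Q y x
    recentre-β p y x = trans (β-coordinates (vec p 0# y x) (vec p 0# y x)) (solve 2 (λ p u → p :* :0 :+ :0 :* p :+ u := u) refl p (Q y x))

    recentre-h : ∀ p y x → h (vector (vec p 0# y x)) (vector (vec p 0# y x)) ≡ H 𝓕 y x
    recentre-h p y x = trans (h-coordinates (vec p 0# y x) (vec p 0# y x)) (trans
      (cong (λ o → p * o + 0# * p ᶜ + r * (0# * o) + (ρ₁ * (y * o) + ρ₁ ᶜ * (0# * y ᶜ) + (ρ₂ * (x * o) + ρ₂ ᶜ * (0# * x ᶜ))) + H 𝓕 y x) conj-0)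
      (solve 12 (λ p p′ r ρ ρ′ σ σ′ y x y′ x′ u → p :* :0 :+ :0 :* p′ :+ r :* (:0 :* :0) :+ (ρ :* (y :* :0) :+ ρ′ :* (:0 :* y′) :+ (σ :* (x :* :0) :+ σ′ :* (:0 :* x′))) :+ u := u)
        refl p (p ᶜ) r ρ₁ (ρ₁ ᶜ) ρ₂ (ρ₂ ᶜ) y x (y ᶜ) (x ᶜ) (H 𝓕 y x)))

    recentre-isotropic : ∀ p y x → 2# * H 𝓕 y x ≡ Q y x + Q y x ᶜ → let v = vector (vec p 0# y x) in 2# * h v v ≡ β v v + β v v ᶜ
    recentre-isotropic p y x iso = trans (cong (2# *_) (recentre-h p y x)) (trans iso (sym (cong (λ a → a + a ᶜ) (recentre-β p y x))))

    recentre-isotropic₁ : Isotropic₁ 𝓕 → Isotropic₁ recentre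
    recentre-isotropic₁ iso = recentre-isotropic _ 1# 0# (trans (cong (2# *_) (trans (sym (h-plane 1# 0# 1# 0#)) (swap-η₃ 𝓕)))
      (trans iso (cong (λ a → a + a ᶜ) (trans (sym (swap-α₃ 𝓕)) (β-plane 1# 0# 1# 0#)))))

    recentre-isotropic₂ : Isotropic₂ 𝓕 → Isotropic₂ recentre
    recentre-isotropic₂ iso = recentre-isotropic _ 0# 1# (trans (cong (2# *_) (trans (sym (h-plane 0# 1# 0# 1#)) (swap-η₁ 𝓕)))
      (trans iso (cong (λ a → a + a ᶜ) (trans (sym (swap-α₁ 𝓕)) (β-plane 0# 1# 0# 1#)))))

    -- The new R is half of a vector on which the Hermitian form takes the value 2f(s, t).
    recentre-r : 2# * At.r recentre ≡ f s t
    recentre-r = trans (cong (2# *_) (h-coordinates t₁ t₁)) (trans (substitute conj-1 (trans (conj-neg _) (cong -_ (trans (conj-* ½ (Q s t)) (cong₂ _*_ ½∈K (conj-Q s t))))))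
      (trans (solve 11 (λ i Q Q′ r ρs ρs′ σt σt′ u v w → :2 :* (:- (i :* Q) :* :1 :+ :1 :* :- (i :* Q′) :+ r :* (:1 :* :1) :+ (ρs :* :1 :+ ρs′ :* :1 :+ (σt :* :1 :+ σt′ :* :1)) :+ (u :+ v :+ w))
          := :- (:2 :* i :* Q) :+ :- (:2 :* i :* Q′) :+ :2 :* (u :+ v :+ w :+ (ρs :+ ρs′ :+ (σt :+ σt′)) :+ r))
          refl ½ (Q s t) _ r (ρ₁ * s) (ρ₁ ᶜ * s ᶜ) (ρ₂ * t) (ρ₂ ᶜ * t ᶜ) (η₁ * (s * s ᶜ)) (η₂ * (s * t ᶜ) + η₂ ᶜ * (t * s ᶜ)) (η₃ * (t * t ᶜ)))
        (half (*-inverseʳ 1+1≢0))))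
      where
      Q′ R : Carrier
      Q′ = α₁ ᶜ * (s ᶜ * s ᶜ) + α₂ ᶜ * (s ᶜ * t ᶜ + t ᶜ * s ᶜ) + α₃ ᶜ * (t ᶜ * t ᶜ)
      R = η₁ * (s * s ᶜ) + (η₂ * (s * t ᶜ) + η₂ ᶜ * (t * s ᶜ)) + η₃ * (t * t ᶜ) + (ρ₁ * s + ρ₁ ᶜ * s ᶜ + (ρ₂ * t + ρ₂ ᶜ * t ᶜ)) + r
      substitute : ∀ {i p} → i ≡ 1# → p ≡ - (½ * Q′) →
        2# * (- (½ * Q s t) * i + 1# * p + r * (1# * i) + (ρ₁ * (s * i) + ρ₁ ᶜ * (1# * s ᶜ) + (ρ₂ * (t * i) + ρ₂ ᶜ * (1# * t ᶜ)))
          + (η₁ * (s * s ᶜ) + (η₂ * (s * t ᶜ) + η₂ ᶜ * (t * s ᶜ)) + η₃ * (t * t ᶜ)))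
        ≡ 2# * (- (½ * Q s t) * 1# + 1# * - (½ * Q′) + r * (1# * 1#) + (ρ₁ * s * 1# + ρ₁ ᶜ * s ᶜ * 1# + (ρ₂ * t * 1# + ρ₂ ᶜ * t ᶜ * 1#))
          + (η₁ * (s * s ᶜ) + (η₂ * (s * t ᶜ) + η₂ ᶜ * (t * s ᶜ)) + η₃ * (t * t ᶜ)))
      substitute refl refl = solve 10 (λ x ρ s ρ′ s′ σ t σ′ t′ y → :2 :* (x :+ (ρ :* (s :* :1) :+ ρ′ :* (:1 :* s′) :+ (σ :* (t :* :1) :+ σ′ :* (:1 :* t′))) :+ y)
        := :2 :* (x :+ (ρ :* s :* :1 :+ ρ′ :* s′ :* :1 :+ (σ :* t :* :1 :+ σ′ :* t′ :* :1)) :+ y)) refl _ ρ₁ s (ρ₁ ᶜ) (s ᶜ) ρ₂ t (ρ₂ ᶜ) (t ᶜ) _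
      half : ∀ {u} → u ≡ 1# → - (u * Q s t) + - (u * Q′) + 2# * R ≡ f s t
      half refl = solve 3 (λ u v w → :- (:1 :* u) :+ :- (:1 :* v) :+ w := :- u :+ :- v :+ w) refl (Q s t) Q′ (2# * R)

  module _ {𝓕 : Frame} (m : Matched 𝓕) (r≡0 : At.r 𝓕 ≡ 0#) where
    open At 𝓕
    open Matched m

    -- The imaginary parts vanish, and the constant term left is 2r = 0.
    real-points : ∀ {y x} → K y → K x → f y x ≡ 0#
    real-points {y} {x} y∈K x∈K = trans (f-matched m y x) (trans (substitute (trans (cong (λ t → y + - t) y∈K) (-‿inverseʳ y)) (trans (cong (λ t → x + - t) x∈K) (-‿inverseʳ x)) r≡0)
      (solve 5 (λ a b c ρ σ → :- (a :* (:0 :* :0) :+ b :* (:0 :* :0 :+ :0 :* :0) :+ c :* (:0 :* :0)) :+ :2 :* (:0 :* ρ :+ :0 :* σ :+ :0) := :0) refl α₁ α₂ α₃ ρ₁ ρ₂))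
      where
      value : Carrier → Carrier → Carrier → Carrier
      value S T r = - (α₁ * (S * S) + α₂ * (S * T + T * S) + α₃ * (T * T)) + 2# * (S * ρ₁ + T * ρ₂ + r)
      substitute : ∀ {S S′ T T′ r r′} → S ≡ S′ → T ≡ T′ → r ≡ r′ → value S T r ≡ value S′ T′ r′
      substitute refl refl refl = refl

    -- The q² real points, together with a further zero s = ρ₁/α₁ if ρ₁ ≠ 0, would be too many.
    ρ₁≡0 : ρ₁ ≡ 0#
    ρ₁≡0 = decide (ρ₁ ≟ 0#)
      where
      decide : Dec (ρ₁ ≡ 0#) → ρ₁ ≡ 0#
      decide (yes eq)  = eq
      decide (no ρ₁≢0) = ⊥-elim (no-large-family g g-injective g-zero)
        where
        open ≡-Reasoning
        α₁≢0 : α₁ ≢ 0#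
        α₁≢0 α₁≡0 = 0≢1 (sym (proj₁ (anisotropic m K-1 K-0 (trans (solve 3 (λ a b c → a :* (:1 :* :1) :+ b :* (:1 :* :0 :+ :0 :* :1) :+ c :* (:0 :* :0) := a) refl α₁ α₂ α₃) α₁≡0))))
        s : Carrier
        s = α₁≢0 ⁻¹ * ρ₁
        s≢0 : s ≢ 0#
        s≢0 = *-nonzero (⁻¹-nonzero α₁≢0) ρ₁≢0
        conj-s : s ᶜ ≡ - s
        conj-s = trans (conj-* (α₁≢0 ⁻¹) ρ₁) (trans (cong₂ _*_ (K-⁻¹ α₁≢0 (α₁∈K m)) conj-ρ₁) (sym (-‿distribʳ-* (α₁≢0 ⁻¹) ρ₁)))
        δ⁻¹ : Carrier
        δ⁻¹ = δ≢0 ⁻¹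
        conj-δ⁻¹ : δ⁻¹ ᶜ ≡ - δ⁻¹
        conj-δ⁻¹ = *-cancelˡ (-‿nonzero δ≢0) (begin
          - δ * δ⁻¹ ᶜ   ≡⟨ cong (_* δ⁻¹ ᶜ) conj-δ ⟨
          δ ᶜ * δ⁻¹ ᶜ   ≡⟨ conj-* δ δ⁻¹ ⟨
          (δ * δ⁻¹) ᶜ   ≡⟨ trans (cong _ᶜ (*-inverseʳ δ≢0)) conj-1 ⟩
          1#            ≡⟨ *-inverseʳ δ≢0 ⟨
          δ * δ⁻¹       ≡⟨ solve 2 (λ d i → d :* i := :- d :* :- i) refl δ δ⁻¹ ⟩
          - δ * - δ⁻¹   ∎)
        imaginary∈K : ∀ z → K (δ⁻¹ * (z + - (z ᶜ)))
        imaginary∈K z = trans (conj-* δ⁻¹ _) (trans (cong₂ _*_ conj-δ⁻¹ (conj-difference z)) (solve 2 (λ i u → :- i :* :- u := i :* u) refl δ⁻¹ (z + - (z ᶜ))))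
        -- The map z ↦ (z + z̄, (z - z̄)/δ) injects the field into `K` × `K` and thus lists q² real
        -- points; `nothing` is the further zero.
        g : Maybe Carrier → Carrier × Carrier
        g nothing  = s , 0#
        g (just z) = z + z ᶜ , δ⁻¹ * (z + - (z ᶜ))
        s∉K : ¬ K s
        s∉K s∈K = s≢0 (double-zero (trans (sym s∈K) conj-s))
        g-injective : ∀ m n → g m ≡ g n → m ≡ n
        g-injective nothing  nothing  _  = refl
        g-injective nothing  (just z) eq = ⊥-elim (s∉K (subst K (sym (cong proj₁ eq)) (K-trace z)))
        g-injective (just z) nothing  eq = ⊥-elim (s∉K (subst K (cong proj₁ eq) (K-trace z)))
        g-injective (just z) (just w) eq = cong just (*-cancelˡ 1+1≢0 (begin
          2# * z                               ≡⟨ double z (z ᶜ) ⟩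
          (z + z ᶜ) + (z + - (z ᶜ))            ≡⟨ cong₂ _+_ (cong proj₁ eq) (*-cancelˡ (⁻¹-nonzero δ≢0) (cong proj₂ eq)) ⟩
          (w + w ᶜ) + (w + - (w ᶜ))            ≡⟨ double w (w ᶜ) ⟨
          2# * w                               ∎))
          where
          double : ∀ z z′ → 2# * z ≡ (z + z′) + (z + - z′)
          double = solve 2 (λ z z′ → :2 :* z := (z :+ z′) :+ (z :- z′)) refl
        g-zero : ∀ m → f (proj₁ (g m)) (proj₂ (g m)) ≡ 0#
        g-zero (just z) = real-points (K-trace z) (imaginary∈K z)
        g-zero nothing  = trans (f-matched m s 0#) (trans (substitute (cong (λ t → s + - t) conj-s) conj-0 r≡0) (begin
          - (α₁ * (S * S) + α₂ * (S * T + T * S) + α₃ * (T * T)) + 2# * (S * ρ₁ + T * ρ₂ + 0#)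
            ≡⟨ solve 6 (λ a b c ρ σ s → let S = s :- :- s ; T = :0 :- :0 in :- (a :* (S :* S) :+ b :* (S :* T :+ T :* S) :+ c :* (T :* T)) :+ :2 :* (S :* ρ :+ T :* σ :+ :0)
                 := :2 :* :2 :* s :* (ρ :- a :* s)) refl α₁ α₂ α₃ ρ₁ ρ₂ s ⟩
          2# * 2# * s * (ρ₁ + - (α₁ * s))   ≡⟨ cong (λ t → 2# * 2# * s * (ρ₁ + - t)) (trans (sym (*-assoc α₁ _ ρ₁)) (trans (cong (_* ρ₁) (*-inverseʳ α₁≢0)) (*-identityˡ ρ₁))) ⟩
          2# * 2# * s * (ρ₁ + - ρ₁)         ≡⟨ solve 2 (λ s ρ → :2 :* :2 :* s :* (ρ :- ρ) := :0) refl s ρ₁ ⟩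
          0#                                ∎))
          where
          S T : Carrier
          S = s + - - s
          T = 0# + - 0#
          value : Carrier → Carrier → Carrier → Carrier
          value S o r = let T = 0# + - o in - (α₁ * (S * S) + α₂ * (S * T + T * S) + α₃ * (T * T)) + 2# * (S * ρ₁ + T * ρ₂ + r)
          substitute : ∀ {S S′ o o′ r r′} → S ≡ S′ → o ≡ o′ → r ≡ r′ → value S o r ≡ value S′ o′ r′
          substitute refl refl refl = refl

  record Normal (𝓕 : Frame) : Set where
    field
      isMatched : Matched 𝓕
      r≡0       : At.r 𝓕 ≡ 0#
      ρ₁≡0′     : At.ρ₁ 𝓕 ≡ 0#
      ρ₂≡0′     : At.ρ₂ 𝓕 ≡ 0#

  normal-frame : Frame → Σ[ 𝓝 ∈ Frame ] Normal 𝓝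
  normal-frame 𝓕 = 𝓝 , record { isMatched = matched-𝓝 ; r≡0 = r≡0 ; ρ₁≡0′ = ρ₁≡0 matched-𝓝 r≡0 ; ρ₂≡0′ = trans (sym (swap-ρ₁ 𝓝)) (ρ₁≡0 matched-swap (trans (swap-r 𝓝) r≡0)) }
    where
    first : Σ[ 𝓖 ∈ Frame ] Isotropic₁ 𝓖
    first = isotropic-frame₁ 𝓕
    second : Σ[ 𝓗 ∈ Frame ] (Isotropic₁ 𝓗 × Isotropic₂ 𝓗)
    second = isotropic-frame₂ (proj₁ first) (proj₂ first)
    𝓗 : Frame
    𝓗 = proj₁ second
    affine : ∃[ y ] ∃[ x ] At.f 𝓗 y x ≡ 0#
    affine = affine-zero (matched 𝓗 (proj₁ (proj₂ second)) (proj₂ (proj₂ second)))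
    open Recentre 𝓗 (proj₁ affine) (proj₁ (proj₂ affine))
    𝓝 : Frame
    𝓝 = recentre
    iso₁ : Isotropic₁ 𝓝
    iso₁ = recentre-isotropic₁ (proj₁ (proj₂ second))
    iso₂ : Isotropic₂ 𝓝
    iso₂ = recentre-isotropic₂ (proj₂ (proj₂ second))
    matched-𝓝 : Matched 𝓝
    matched-𝓝 = matched 𝓝 iso₁ iso₂
    matched-swap : Matched (swap 𝓝)
    matched-swap = matched (swap 𝓝) (swap-isotropic₁ 𝓝 iso₂) (swap-isotropic₂ 𝓝 iso₁)
    r≡0 : At.r 𝓝 ≡ 0#
    r≡0 = *-zero-product 1+1≢0 (trans recentre-r (proj₂ (proj₂ affine)))

-- Existence of a frame.

module InitialFrame (𝓒 : Configuration) where
  open TangentForms 𝓒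
  open Configuration 𝓒 using (P-isotropic)

  private
    βPP : β P P ≡ 0#
    βPP = trans (sym (quadForm≡form B P)) P-isotropic

  -- A multiple of a unit vector at a nonzero entry of BP pairs to 1 with `P`. Subtracting half its
  -- β-value times `P` makes it isotropic and, `P` being isotropic, keeps the pairing.
  isotropic-partner : NonZeroVec F (_·_ F B P) → Σ[ R ∈ Vec4 F ] (β R P ≡ 1# × β R R ≡ 0#)
  isotropic-partner BP≢0 = R , βRP , βRR
    where
    open ≡-Reasoning
    pivot : ∃[ i ] (_·_ F B P i ≢ 0#)
    pivot = Fin.¬∀⟶∃¬ 4 _ (λ i → _·_ F B P i ≟ 0#) BP≢0
    i : Fin 4
    i = proj₁ pivot
    R₀ : Vec4 F
    R₀ j = identityMatrix i j * proj₂ pivot ⁻¹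
    βR₀P : β R₀ P ≡ 1#
    βR₀P = begin
      β R₀ P                                                         ≡⟨ form-row B R₀ P ⟩
      (∑ F λ j → _·_ F B P j * (identityMatrix i j * proj₂ pivot ⁻¹))   ≡⟨ (∑-cong λ j → solve 3 (λ a b c → a :* (b :* c) := b :* (a :* c)) refl (_·_ F B P j) (identityMatrix i j) (proj₂ pivot ⁻¹)) ⟩
      (∑ F λ j → identityMatrix i j * (_·_ F B P j * proj₂ pivot ⁻¹))   ≡⟨ ∑-identityˡ i (λ j → _·_ F B P j * proj₂ pivot ⁻¹) ⟩
      _·_ F B P i * proj₂ pivot ⁻¹                                    ≡⟨ *-inverseʳ (proj₂ pivot) ⟩
      1#                                                             ∎
    u : Carrier
    u = - (1+1≢0 ⁻¹ * β R₀ R₀)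
    R : Vec4 F
    R j = R₀ j + u * P j
    βRP : β R P ≡ 1#
    βRP = trans (form-lineˡ B u R₀ P P) (trans (cong₂ (λ a b → a + u * b) βR₀P βPP) (solve 1 (λ u → :1 :+ u :* :0 := :1) refl u))
    βRR : β R R ≡ 0#
    βRR = begin
      β R R                          ≡⟨ form-lineˡ B u R₀ P R ⟩
      β R₀ R + u * β P R             ≡⟨ cong₂ (λ a b → a + u * b) (trans (β-sym R₀ R) (form-lineˡ B u R₀ P R₀)) (trans (β-sym P R) βRP) ⟩
      β R₀ R₀ + u * β P R₀ + u * 1#  ≡⟨ cong (λ a → β R₀ R₀ + u * a + u * 1#) (trans (β-sym P R₀) βR₀P) ⟩
      β R₀ R₀ + u * 1# + u * 1#      ≡⟨ solve 2 (λ b i → b :+ :- (i :* b) :* :1 :+ :- (i :* b) :* :1 := b :* (:1 :- :2 :* i)) refl (β R₀ R₀) (1+1≢0 ⁻¹) ⟩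
      β R₀ R₀ * (1# + - ((1# + 1#) * 1+1≢0 ⁻¹))  ≡⟨ cong (λ t → β R₀ R₀ * (1# + - t)) (*-inverseʳ 1+1≢0) ⟩
      β R₀ R₀ * (1# + - 1#)          ≡⟨ solve 1 (λ b → b :* (:1 :- :1) := :0) refl (β R₀ R₀) ⟩
      0#                             ∎

  -- Orthogonality to `P` and R leaves a nonzero a. The third condition on b, vanishing at a
  -- coordinate where a does not, separates it from a. In a linear relation, pairing with `P` and R
  -- first removes the coefficients of R and `P`.
  complete : ∀ {R} → β R P ≡ 1# → β R R ≡ 0# → Frame
  complete {R} βRP βRR = record
    { e = e ; e₀≗P = λ _ → refl ; β₀₁ = βPR ; β₁₁ = βRR
    ; β₂₀ = βaP ; β₃₀ = βbP ; β₂₁ = βaR ; β₃₁ = βbR ; independent = independent }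
    where
    βPR : β P R ≡ 1#
    βPR = trans (β-sym P R) βRP
    rows : Fin 2 → Fin 4 → Carrier
    rows 0F = _·_ F B P
    rows 1F = _·_ F B R
    a-spec : Σ[ a ∈ Vec4 F ] (¬ (∀ j → a j ≡ 0#) × (∀ i → ∑ F (λ j → rows i j * a j) ≡ 0#))
    a-spec = underdetermined (s≤s (s≤s (s≤s z≤n))) rows
    a : Vec4 F
    a = proj₁ a-spec
    βaP : β a P ≡ 0#
    βaP = trans (form-row B a P) (proj₂ (proj₂ a-spec) 0F)
    βaR : β a R ≡ 0#
    βaR = trans (form-row B a R) (proj₂ (proj₂ a-spec) 1F)
    a-pivot : ∃[ k ] (a k ≢ 0#)
    a-pivot = Fin.¬∀⟶∃¬ 4 _ (λ i → a i ≟ 0#) (proj₁ (proj₂ a-spec))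
    k : Fin 4
    k = proj₁ a-pivot
    rows′ : Fin 3 → Fin 4 → Carrier
    rows′ 0F = _·_ F B P
    rows′ 1F = _·_ F B R
    rows′ 2F = identityMatrix k
    b-spec : Σ[ b ∈ Vec4 F ] (¬ (∀ j → b j ≡ 0#) × (∀ i → ∑ F (λ j → rows′ i j * b j) ≡ 0#))
    b-spec = underdetermined (s≤s (s≤s (s≤s (s≤s z≤n)))) rows′
    b : Vec4 F
    b = proj₁ b-spec
    βbP : β b P ≡ 0#
    βbP = trans (form-row B b P) (proj₂ (proj₂ b-spec) 0F)
    βbR : β b R ≡ 0#
    βbR = trans (form-row B b R) (proj₂ (proj₂ b-spec) 1F)
    bk≡0 : b k ≡ 0#
    bk≡0 = trans (sym (∑-identityˡ k b)) (proj₂ (proj₂ b-spec) 2F)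
    b-pivot : ∃[ l ] (b l ≢ 0#)
    b-pivot = Fin.¬∀⟶∃¬ 4 _ (λ i → b i ≟ 0#) (proj₁ (proj₂ b-spec))
    e : Fin 4 → Vec4 F
    e 0F = P
    e 1F = R
    e 2F = a
    e 3F = b
    independent : Independent e
    independent z vanishes = λ { 0F → z₀ ; 1F → z₁ ; 2F → z₂ ; 3F → z₃ }
      where
      pairing : ∀ y → ∑ F (λ k → z k * β (e k) y) ≡ 0#
      pairing y = trans (sym (form-combinationˡ B e z y)) (trans (form-cong B vanishes (λ _ → refl)) (form-zeroˡ B y))
      coordinate : ∀ i → P i * z 0F + (R i * z 1F + (a i * z 2F + (b i * z 3F + 0#))) ≡ 0#
      coordinate i = trans (sym (combination-explicit e z i)) (vanishes i)
      substitute : ∀ {p p′ r r′ s s′ t t′} → p ≡ p′ → r ≡ r′ → s ≡ s′ → t ≡ t′ →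
        z 0F * p + (z 1F * r + (z 2F * s + (z 3F * t + 0#))) ≡ z 0F * p′ + (z 1F * r′ + (z 2F * s′ + (z 3F * t′ + 0#)))
      substitute refl refl refl refl = refl
      z₁ : z 1F ≡ 0#
      z₁ = trans (solve 4 (λ p r s t → r := p :* :0 :+ (r :* :1 :+ (s :* :0 :+ (t :* :0 :+ :0)))) refl (z 0F) (z 1F) (z 2F) (z 3F))
        (trans (sym (substitute βPP βRP βaP βbP)) (pairing P))
      z₀ : z 0F ≡ 0#
      z₀ = trans (solve 4 (λ p r s t → p := p :* :1 :+ (r :* :0 :+ (s :* :0 :+ (t :* :0 :+ :0)))) refl (z 0F) (z 1F) (z 2F) (z 3F))
        (trans (sym (substitute βPR βRR βaR βbR)) (pairing R))
      plane : ∀ i → a i * z 2F + b i * z 3F ≡ 0#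
      plane i = trans (solve 4 (λ p r s t → s :+ t := p :* :0 :+ (r :* :0 :+ (s :+ (t :+ :0)))) refl (P i) (R i) (a i * z 2F) (b i * z 3F))
        (trans (sym (cong₂ (λ u v → P i * u + (R i * v + (a i * z 2F + (b i * z 3F + 0#)))) z₀ z₁)) (coordinate i))
      z₂ : z 2F ≡ 0#
      z₂ = *-zero-product (proj₂ a-pivot) (trans (solve 2 (λ s t → s := s :+ :0 :* t) refl (a k * z 2F) (z 3F)) (trans (cong (λ t → a k * z 2F + t * z 3F) (sym bk≡0)) (plane k)))
      z₃ : z 3F ≡ 0#
      z₃ = *-zero-product (proj₂ b-pivot) (trans (solve 2 (λ s t → t := s :* :0 :+ t) refl (a l) (b l * z 3F)) (trans (cong (λ t → a l * t + b l * z 3F) (sym z₂)) (plane l)))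
        where
        l : Fin 4
        l = proj₁ b-pivot

  initial-frame : NonZeroVec F (_·_ F B P) → Frame
  initial-frame BP≢0 =
    let R , βRP , βRR = isotropic-partner BP≢0
    in complete βRP βRR

-- The intersection as a set of real points.

module NormalForm (𝓒 : Configuration) where
  open TangentForms 𝓒
  open FrameChanges 𝓒
  open IsotropicPlanes 𝓒
  open MatchedFrames 𝓒
  open NormalFrames 𝓒

  K-vec : ∀ {a b c d} → K a → K b → K c → K d → SubfieldVec F q (vec a b c d)
  K-vec a∈K b∈K c∈K d∈K 0F = a∈K
  K-vec a∈K b∈K c∈K d∈K 1F = b∈K
  K-vec a∈K b∈K c∈K d∈K 2F = c∈K
  K-vec a∈K b∈K c∈K d∈K 3F = d∈K

  module InNormalFrame {𝓝 : Frame} (normal : Normal 𝓝) where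
    open At 𝓝
    open Rebase 𝓝 using (b)
    open Normal normal
    open Matched isMatched

    frame-matrix : Matrix F
    frame-matrix i j = e j i

    ·≡vector : ∀ x i → _·_ F frame-matrix x i ≡ vector x i
    ·≡vector x i = sym (combination-explicit e x i)

    quadForm-β-gram : ∀ x → quadForm F β-gram x ≡ b x x
    quadForm-β-gram x = trans (quadForm≡form β-gram x) (trans (sym (form-matrix-cong β-gram-correct x x)) (trans (sym (form-gram B e e x x)) (β-coordinates x x)))

    β-gram∈K : ∀ i j → K (β-gram i j)
    β-gram∈K 0F = K-vec K-0 K-1 K-0 K-0
    β-gram∈K 1F = K-vec K-1 K-0 K-0 K-0
    β-gram∈K 2F = K-vec K-0 K-0 (α₁∈K isMatched) α₂∈K
    β-gram∈K 3F = K-vec K-0 K-0 α₂∈K (α₃∈K isMatched)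

    β-gram-symmetric : IsSymmetric F β-gram
    β-gram-symmetric i j = trans (sym (β-gram-correct i j)) (trans (β-sym (e i) (e j)) (β-gram-correct j i))

    h-normal : ∀ x → h (vector x) (vector x) ≡ x 0F * x 1F ᶜ + x 1F * x 0F ᶜ + H 𝓝 (x 2F) (x 3F)
    h-normal x = trans (h-coordinates x x) (trans (substitute r≡0 ρ₁≡0′ (trans (cong _ᶜ ρ₁≡0′) conj-0) ρ₂≡0′ (trans (cong _ᶜ ρ₂≡0′) conj-0))
      (solve 8 (λ u v x₁ x₂ x₃ y₁ w t → u :+ v :+ :0 :* w :+ (:0 :* x₁ :+ :0 :* x₂ :+ (:0 :* x₃ :+ :0 :* y₁)) :+ t := u :+ v :+ t) refl
        (x 0F * x 1F ᶜ) (x 1F * x 0F ᶜ) (x 2F * x 1F ᶜ) (x 1F * x 2F ᶜ) (x 3F * x 1F ᶜ) (x 1F * x 3F ᶜ) (x 1F * x 1F ᶜ) (H 𝓝 (x 2F) (x 3F))))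
      where
      value : (r ρ ρ′ σ σ′ : Carrier) → Carrier
      value r ρ ρ′ σ σ′ = x 0F * x 1F ᶜ + x 1F * x 0F ᶜ + r * (x 1F * x 1F ᶜ)
        + (ρ * (x 2F * x 1F ᶜ) + ρ′ * (x 1F * x 2F ᶜ) + (σ * (x 3F * x 1F ᶜ) + σ′ * (x 1F * x 3F ᶜ))) + H 𝓝 (x 2F) (x 3F)
      substitute : ∀ {r r₁ ρ ρ₀ ρ′ ρ₀′ σ σ₀ σ′ σ₀′} → r ≡ r₁ → ρ ≡ ρ₀ → ρ′ ≡ ρ₀′ → σ ≡ σ₀ → σ′ ≡ σ₀′ → value r ρ ρ′ σ σ′ ≡ value r₁ ρ₀ ρ₀′ σ₀ σ₀′
      substitute refl refl refl refl refl = refl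

    -- Conjugation fixes the coordinates, and the Gram matrices of the two forms coincide.
    h-real : ∀ {x} → SubfieldVec F q x → h (vector x) (vector x) ≡ b x x
    h-real {x} x∈K = trans (h-normal x) (trans (cong₂ (λ u v → x 0F * u + x 1F * v + H 𝓝 (x 2F) (x 3F)) (x∈K 1F) (x∈K 0F))
      (cong (x 0F * x 1F + x 1F * x 0F +_) (H-real isMatched (x∈K 2F) (x∈K 3F))))

    Represented : Vec4 F → Set
    Represented v = Σ[ x ∈ Vec4 F ] (SubfieldVec F q x × NonZeroVec F x × quadForm F β-gram x ≡ 0# ×
      Σ[ c ∈ Carrier ] (c ≢ 0# × (∀ i → v i ≡ _×ₛ_ F c (_·_ F frame-matrix x) i)))

    represented⇒onHQ : ∀ {v} → Represented v → OnHQ F q A B v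
    represented⇒onHQ {v} (x , x∈K , _ , Bx≡0 , c , c≢0 , v≗) = onHQ v
      (trans (form-cong B v≗cx v≗cx) (trans (form-scale B c c (vector x) (vector x)) (trans (cong (c * c *_) (trans (β-coordinates x x) bx≡0)) (zeroʳ _))))
      (trans (h-cong v≗cx v≗cx) (trans (form-cong A (λ _ → refl) (λ i → conj-* c (vector x i))) (trans (form-scale A c (c ᶜ) (vector x) (λ i → vector x i ᶜ))
        (trans (cong (c * c ᶜ *_) (trans (h-real x∈K) bx≡0)) (zeroʳ _)))))
      where
      v≗cx : ∀ i → v i ≡ c * vector x i
      v≗cx i = trans (v≗ i) (cong (c *_) (·≡vector x i))
      bx≡0 : b x x ≡ 0#
      bx≡0 = trans (sym (quadForm-β-gram x)) Bx≡0

    -- Multiplication by δ carries trace-zero coordinates into `K` and multiplies `Q` by δ².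
    imaginary-anisotropic : ∀ {S T} → S ᶜ ≡ - S → T ᶜ ≡ - T → Q S T ≡ 0# → S ≡ 0# × T ≡ 0#
    imaginary-anisotropic {S} {T} conj-S conj-T QST≡0 =
      let δS≡0 , δT≡0 = anisotropic isMatched (K-δ* 𝓝 conj-S) (K-δ* 𝓝 conj-T)
            (trans (solve 6 (λ a b c d S T → a :* (d :* S :* (d :* S)) :+ b :* (d :* S :* (d :* T) :+ d :* T :* (d :* S)) :+ c :* (d :* T :* (d :* T))
                := d :* d :* (a :* (S :* S) :+ b :* (S :* T :+ T :* S) :+ c :* (T :* T))) refl α₁ α₂ α₃ δ S T)
              (trans (cong (δ * δ *_) QST≡0) (zeroʳ _)))
      in *-zero-product δ≢0 δS≡0 , *-zero-product δ≢0 δT≡0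

    -- The two equations express `Q` and `H` at (z₂, z₃) through z₀ and its conjugate, and together
    -- they say f(z₂, z₃) = 0. In a normal frame this is -Q of the imaginary parts, which vanish by
    -- anisotropy; then z₀ = -Q/2 is real too.
    affine-real : ∀ z₀ z₂ z₃ → let z = vec z₀ 1# z₂ z₃ in b z z ≡ 0# → h (vector z) (vector z) ≡ 0# → SubfieldVec F q z
    affine-real z₀ z₂ z₃ bz≡0 hz≡0 = K-vec z₀∈K K-1 z₂∈K z₃∈K
      where
      open ≡-Reasoning
      z : Vec4 F
      z = vec z₀ 1# z₂ z₃
      Q≡ : Q z₂ z₃ ≡ - (2# * z₀)
      Q≡ = x-y≡0⇒x≡y (trans (solve 2 (λ z u → u :- (:- (:2 :* z)) := z :* :1 :+ :1 :* z :+ u) refl z₀ (Q z₂ z₃)) bz≡0)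
      H≡ : H 𝓝 z₂ z₃ ≡ - (z₀ + z₀ ᶜ)
      H≡ = x-y≡0⇒x≡y (trans (solve 3 (λ z z′ u → u :- (:- (z :+ z′)) := z :* :1 :+ :1 :* z′ :+ u) refl z₀ (z₀ ᶜ) (H 𝓝 z₂ z₃))
        (trans (cong (λ i → z₀ * i + 1# * z₀ ᶜ + H 𝓝 z₂ z₃) (sym conj-1)) (trans (sym (h-normal z)) hz≡0)))
      f≡0 : f z₂ z₃ ≡ 0#
      f≡0 = trans (cong (λ t → - Q z₂ z₃ + - t + 2# * (H 𝓝 z₂ z₃ + (ρ₁ * z₂ + ρ₁ ᶜ * z₂ ᶜ + (ρ₂ * z₃ + ρ₂ ᶜ * z₃ ᶜ)) + r)) (sym (conj-Q z₂ z₃)))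
        (trans (substitute Q≡ (trans (cong _ᶜ Q≡) (trans (conj-neg _) (cong -_ (trans (conj-* 2# z₀) (cong (_* z₀ ᶜ) 2∈K))))) H≡ ρ₁≡0′ (trans (cong _ᶜ ρ₁≡0′) conj-0) ρ₂≡0′ (trans (cong _ᶜ ρ₂≡0′) conj-0) r≡0)
          (solve 6 (λ z z′ z₂ z₂′ z₃ z₃′ → :- :- (:2 :* z) :+ :- :- (:2 :* z′) :+ :2 :* (:- (z :+ z′) :+ (:0 :* z₂ :+ :0 :* z₂′ :+ (:0 :* z₃ :+ :0 :* z₃′)) :+ :0) := :0) refl z₀ (z₀ ᶜ) z₂ (z₂ ᶜ) z₃ (z₃ ᶜ)))
        where
        value : (u u′ v ρ ρ′ σ σ′ r : Carrier) → Carrier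
        value u u′ v ρ ρ′ σ σ′ r = - u + - u′ + 2# * (v + (ρ * z₂ + ρ′ * z₂ ᶜ + (σ * z₃ + σ′ * z₃ ᶜ)) + r)
        substitute : ∀ {u u₁ u′ u₁′ v v₁ ρ ρ₀ ρ′ ρ₀′ σ σ₀ σ′ σ₀′ r r₁} → u ≡ u₁ → u′ ≡ u₁′ → v ≡ v₁ → ρ ≡ ρ₀ → ρ′ ≡ ρ₀′ → σ ≡ σ₀ → σ′ ≡ σ₀′ → r ≡ r₁ →
          value u u′ v ρ ρ′ σ σ′ r ≡ value u₁ u₁′ v₁ ρ₀ ρ₀′ σ₀ σ₀′ r₁
        substitute refl refl refl refl refl refl refl refl = refl
      S T : Carrier
      S = z₂ + - (z₂ ᶜ)
      T = z₃ + - (z₃ ᶜ)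
      QST≡0 : Q S T ≡ 0#
      QST≡0 = trans (sym (-‿involutive _)) (trans (cong -_ (begin
        - Q S T                                       ≡⟨ solve 3 (λ u S T → :- u := :- u :+ :2 :* (S :* :0 :+ T :* :0 :+ :0)) refl (Q S T) S T ⟩
        - Q S T + 2# * (S * 0# + T * 0# + 0#)         ≡⟨ substitute (sym ρ₁≡0′) (sym ρ₂≡0′) (sym r≡0) ⟩
        - Q S T + 2# * (S * ρ₁ + T * ρ₂ + r)          ≡⟨ f-matched isMatched z₂ z₃ ⟨
        f z₂ z₃                                       ≡⟨ f≡0 ⟩
        0#                                            ∎)) -0#≈0#)
        where
        substitute : ∀ {ρ ρ₀ σ σ₀ r r₁} → ρ ≡ ρ₀ → σ ≡ σ₀ → r ≡ r₁ → - Q S T + 2# * (S * ρ + T * σ + r) ≡ - Q S T + 2# * (S * ρ₀ + T * σ₀ + r₁)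
        substitute refl refl refl = refl
      ST≡0 : S ≡ 0# × T ≡ 0#
      ST≡0 = imaginary-anisotropic (conj-difference z₂) (conj-difference z₃) QST≡0
      z₂∈K : K z₂
      z₂∈K = sym (x-y≡0⇒x≡y (proj₁ ST≡0))
      z₃∈K : K z₃
      z₃∈K = sym (x-y≡0⇒x≡y (proj₂ ST≡0))
      Q∈K : K (Q z₂ z₃)
      Q∈K = K-+ (K-+ (K-* (α₁∈K isMatched) (K-* z₂∈K z₂∈K)) (K-* α₂∈K (K-+ (K-* z₂∈K z₃∈K) (K-* z₃∈K z₂∈K)))) (K-* (α₃∈K isMatched) (K-* z₃∈K z₃∈K))
      z₀≡ : z₀ ≡ - (½ * Q z₂ z₃)
      z₀≡ = sym (begin
        - (½ * Q z₂ z₃)        ≡⟨ cong (λ u → - (½ * u)) Q≡ ⟩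
        - (½ * - (2# * z₀))    ≡⟨ solve 2 (λ i z → :- (i :* :- (:2 :* z)) := (:2 :* i) :* z) refl ½ z₀ ⟩
        2# * ½ * z₀            ≡⟨ trans (cong (_* z₀) (*-inverseʳ 1+1≢0)) (*-identityˡ z₀) ⟩
        z₀                     ∎)
      z₀∈K : K z₀
      z₀∈K = subst K (sym z₀≡) (K-neg (K-* ½∈K Q∈K))

    -- In the tangent plane, y₁ = 0, the component in U is a zero of both `Q` and `H`, hence zero,
    -- and the point is `P`. Elsewhere division by y₁ leads to `affine-real`.
    onHQ⇒represented : ∀ {v} → NonZeroVec F v → OnHQ F q A B v → Represented v
    onHQ⇒represented {v} v≢0 (v∈H , v∈Q) = decide (y 1F ≟ 0#)
      where
      y : Vec4 F
      y = proj₁ (independent⇒spanning independent v)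
      v≗ : ∀ i → vector y i ≡ v i
      v≗ = proj₂ (independent⇒spanning independent v)
      by≡0 : b y y ≡ 0#
      by≡0 = trans (sym (β-coordinates y y)) (trans (form-cong B v≗ v≗) (trans (sym (quadForm≡form B v)) v∈Q))
      hy≡0 : h (vector y) (vector y) ≡ 0#
      hy≡0 = trans (h-cong v≗ v≗) (trans (sym (hermForm≡h v v)) v∈H)
      decide : Dec (y 1F ≡ 0#) → Represented v
      decide (yes y₁≡0) = vec 1# 0# 0# 0# , K-vec K-1 K-0 K-0 K-0 , (λ zeros → 0≢1 (sym (zeros 0F))) ,
          trans (quadForm-β-gram (vec 1# 0# 0# 0#)) (solve 3 (λ a b c → :1 :* :0 :+ :0 :* :1 :+ (a :* (:0 :* :0) :+ b :* (:0 :* :0 :+ :0 :* :0) :+ c :* (:0 :* :0)) := :0) refl α₁ α₂ α₃) ,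
          y 0F , y₀≢0 , λ i → trans (sym (v≗ i)) (trans (coordinatewise i) (sym (trans (cong (y 0F *_) (·≡vector (vec 1# 0# 0# 0#) i)) (combination-scale e (y 0F) (vec 1# 0# 0# 0#) i))))
        where
        plane : y 2F ≡ 0# × y 3F ≡ 0#
        plane = no-common-isotropic 𝓝 (y 2F) (y 3F)
          (trans (solve 2 (λ p u → u := p :* :0 :+ :0 :* p :+ u) refl (y 0F) (Q (y 2F) (y 3F)))
            (trans (cong (λ t → y 0F * t + t * y 0F + Q (y 2F) (y 3F)) (sym y₁≡0)) by≡0))
          (trans (solve 3 (λ p p′ u → u := p :* :0 :+ :0 :* p′ :+ u) refl (y 0F) (y 0F ᶜ) (H 𝓝 (y 2F) (y 3F)))
            (trans (cong₂ (λ t t′ → y 0F * t′ + t * y 0F ᶜ + H 𝓝 (y 2F) (y 3F)) (sym y₁≡0) (sym (trans (cong _ᶜ y₁≡0) conj-0))) (trans (sym (h-normal y)) hy≡0)))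
        y≗ : ∀ j → y j ≡ y 0F * vec 1# 0# 0# 0# j
        y≗ 0F = sym (*-identityʳ (y 0F))
        y≗ 1F = trans y₁≡0 (sym (zeroʳ (y 0F)))
        y≗ 2F = trans (proj₁ plane) (sym (zeroʳ (y 0F)))
        y≗ 3F = trans (proj₂ plane) (sym (zeroʳ (y 0F)))
        coordinatewise : ∀ i → vector y i ≡ vector (λ j → y 0F * vec 1# 0# 0# 0# j) i
        coordinatewise i = trans (combination-explicit e y i) (trans (∑-cong λ j → cong (e j i *_) (y≗ j)) (sym (combination-explicit e (λ j → y 0F * vec 1# 0# 0# 0# j) i)))
        y₀≢0 : y 0F ≢ 0#
        y₀≢0 y₀≡0 = v≢0 λ i → trans (sym (v≗ i)) (trans (coordinatewise i) (trans (sym (combination-scale e (y 0F) (vec 1# 0# 0# 0#) i)) (trans (cong (_* vector (vec 1# 0# 0# 0#) i) y₀≡0) (zeroˡ _))))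
      decide (no y₁≢0) = z , affine-real (z 0F) (z 2F) (z 3F) bz≡0 hz≡0 , (λ zeros → 0≢1 (sym (zeros 1F))) , trans (quadForm-β-gram z) bz≡0 ,
          y 1F , y₁≢0 , λ i → trans (sym (v≗ i)) (trans (coordinatewise i) (sym (cong (y 1F *_) (·≡vector z i))))
        where
        i₁ : Carrier
        i₁ = y₁≢0 ⁻¹
        z : Vec4 F
        z = vec (y 0F * i₁) 1# (y 2F * i₁) (y 3F * i₁)
        rescale : ∀ u → u ≡ y 1F * (u * i₁)
        rescale u = sym (trans (solve 3 (λ a u i → a :* (u :* i) := u :* (a :* i)) refl (y 1F) u i₁) (trans (cong (u *_) (*-inverseʳ y₁≢0)) (*-identityʳ u)))
        y≗ : ∀ j → y j ≡ y 1F * z j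
        y≗ 0F = rescale (y 0F)
        y≗ 1F = sym (*-identityʳ (y 1F))
        y≗ 2F = rescale (y 2F)
        y≗ 3F = rescale (y 3F)
        coordinatewise : ∀ i → vector y i ≡ y 1F * vector z i
        coordinatewise i = trans (combination-explicit e y i) (trans (∑-cong λ j → cong (e j i *_) (y≗ j)) (trans (sym (combination-explicit e (λ j → y 1F * z j) i)) (sym (combination-scale e (y 1F) z i))))
        bz≡0 : b z z ≡ 0#
        bz≡0 = *-zero-product (*-nonzero y₁≢0 y₁≢0) (trans (cong (y 1F * y 1F *_) (sym (β-coordinates z z)))
          (trans (sym (form-scale B (y 1F) (y 1F) (vector z) (vector z))) (trans (sym (form-cong B coordinatewise coordinatewise)) (trans (β-coordinates y y) by≡0))))
        hz≡0 : h (vector z) (vector z) ≡ 0#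
        hz≡0 = *-zero-product (*-nonzero y₁≢0 (conj-nonzero y₁≢0)) (trans (sym (form-scale A (y 1F) (y 1F ᶜ) (vector z) (λ i → vector z i ᶜ)))
          (trans (form-cong A (λ _ → refl) (λ i → sym (conj-* (y 1F) (vector z i)))) (trans (sym (h-cong coordinatewise coordinatewise)) hy≡0)))

-- Elliptic over GF(q), hyperbolic over GF(q²).

module QuadricTypes (𝓒 : Configuration) where
  open TangentForms 𝓒
  open FrameChanges 𝓒
  open IsotropicPlanes 𝓒
  open MatchedFrames 𝓒
  open NormalFrames 𝓒
  open NormalForm 𝓒

  module InNormalFrameTypes {𝓝 : Frame} (normal : Normal 𝓝) where
    open At 𝓝
    open Rebase 𝓝 using (b)
    open Normal normal
    open Matched isMatched
    open InNormalFrame normal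

    α₁≢0 : α₁ ≢ 0#
    α₁≢0 α₁≡0 = 0≢1 (sym (proj₁ (anisotropic isMatched K-1 K-0 (trans (solve 3 (λ a b c → a :* (:1 :* :1) :+ b :* (:1 :* :0 :+ :0 :* :1) :+ c :* (:0 :* :0) := a) refl α₁ α₂ α₃) α₁≡0))))

    -- Constants of the completed square Q = α₁((y + κx)² - Dx²), with D = (α₂² - α₁α₃)/α₁².
    ι κ D : Carrier
    ι = α₁≢0 ⁻¹
    κ = ι * α₂
    D = κ * κ + - (ι * α₃)

    ι∈K : K ι
    ι∈K = K-⁻¹ α₁≢0 (α₁∈K isMatched)

    κ∈K : K κ
    κ∈K = K-* ι∈K α₂∈K

    D∈K : K D
    D∈K = K-+ (K-* κ∈K κ∈K) (K-neg (K-* ι∈K (α₃∈K isMatched)))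

    Q-diagonal : ∀ y x → Q y x ≡ α₁ * ((y + κ * x) * (y + κ * x) + - (D * x * x))
    Q-diagonal y x = sym (trans
      (solve 6 (λ a i b c y x → let k = i :* b in a :* ((y :+ k :* x) :* (y :+ k :* x) :- (k :* k :- i :* c) :* x :* x)
        := a :* (y :* y) :+ a :* i :* b :* (y :* x :+ x :* y) :+ a :* i :* c :* (x :* x)) refl α₁ ι α₂ α₃ y x)
      (trans (cong (λ u → α₁ * (y * y) + u * α₂ * (y * x + x * y) + u * α₃ * (x * x)) (*-inverseʳ α₁≢0))
        (solve 5 (λ a b c y x → a :* (y :* y) :+ :1 :* b :* (y :* x :+ x :* y) :+ :1 :* c :* (x :* x) := a :* (y :* y) :+ b :* (y :* x :+ x :* y) :+ c :* (x :* x)) refl α₁ α₂ α₃ y x)))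

    -- A root y in `K` would make (y - κ, 1) a real zero of `Q`.
    D-nonsquare : ¬ (Σ[ y ∈ Carrier ] (K y × y * y ≡ D))
    D-nonsquare (y , y∈K , y²≡D) = 0≢1 (sym (proj₂ (anisotropic isMatched (K-+ y∈K (K-neg κ∈K)) K-1 (begin
      Q (y + - κ) 1#                                                    ≡⟨ Q-diagonal (y + - κ) 1# ⟩
      α₁ * ((y + - κ + κ * 1#) * (y + - κ + κ * 1#) + - (D * 1# * 1#))  ≡⟨ solve 4 (λ a y k d → a :* ((y :- k :+ k :* :1) :* (y :- k :+ k :* :1) :- d :* :1 :* :1) := a :* (y :* y :- d)) refl α₁ y κ D ⟩
      α₁ * (y * y + - D)                                                ≡⟨ trans (cong (λ u → α₁ * (u + - D)) y²≡D) (trans (cong (α₁ *_) (-‿inverseʳ D)) (zeroʳ α₁)) ⟩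
      0#                                                                ∎))))
      where open ≡-Reasoning

    -- The factor ½α₁ in the second coordinate turns the hyperbolic term into α₁x₀x₁, so that α₁
    -- comes out of the whole form. Coordinates enter through equations so that both bases below can
    -- use it.
    b-diagonal : ∀ {y : Vec4 F} {x₀ x₁ y₂ y₃ : Carrier} → y 0F ≡ x₀ → y 1F ≡ ½ * α₁ * x₁ → y 2F ≡ y₂ → y 3F ≡ y₃ →
      b y y ≡ α₁ * (x₀ * x₁ + ((y₂ + κ * y₃) * (y₂ + κ * y₃) + - (D * y₃ * y₃)))
    b-diagonal {y} {x₀} {x₁} {y₂} {y₃} e₀ e₁ e₂ e₃ = trans (substitute e₀ e₁ e₂ e₃) (trans (cong (λ u → x₀ * (½ * α₁ * x₁) + ½ * α₁ * x₁ * x₀ + u) (Q-diagonal y₂ y₃))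
      (trans (solve 5 (λ i a x y u → x :* (i :* a :* y) :+ i :* a :* y :* x :+ a :* u := a :* (:2 :* i :* (x :* y) :+ u)) refl ½ α₁ x₀ x₁ _)
        (trans (cong (λ u → α₁ * (u * (x₀ * x₁) + ((y₂ + κ * y₃) * (y₂ + κ * y₃) + - (D * y₃ * y₃)))) (*-inverseʳ 1+1≢0)) (cong (λ u → α₁ * (u + ((y₂ + κ * y₃) * (y₂ + κ * y₃) + - (D * y₃ * y₃)))) (*-identityˡ (x₀ * x₁))))))
      where
      substitute : ∀ {a a′ c c′ d d′ e e′} → a ≡ a′ → c ≡ c′ → d ≡ d′ → e ≡ e′ → a * c + c * a + Q d e ≡ a′ * c′ + c′ * a′ + Q d′ e′
      substitute refl refl refl refl = refl

    elliptic-basis hyperbolic-basis : Fin 4 → Vec4 F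

    elliptic-basis 0F = vec 1# 0# 0# 0#
    elliptic-basis 1F = vec 0# (½ * α₁) 0# 0#
    elliptic-basis 2F = vec 0# 0# 1# 0#
    elliptic-basis 3F = vec 0# 0# (- κ) 1#

    ½α₁≢0 : ½ * α₁ ≢ 0#
    ½α₁≢0 = *-nonzero (⁻¹-nonzero 1+1≢0) α₁≢0

    first-coordinate : ∀ (x : Vec4 F) → 1# * x 0F + (0# * x 1F + (0# * x 2F + (0# * x 3F + 0#))) ≡ x 0F
    first-coordinate x = solve 4 (λ a b c d → :1 :* a :+ (:0 :* b :+ (:0 :* c :+ (:0 :* d :+ :0))) := a) refl (x 0F) (x 1F) (x 2F) (x 3F)

    second-coordinate : ∀ m (x : Vec4 F) → 0# * x 0F + (m * x 1F + (0# * x 2F + (0# * x 3F + 0#))) ≡ m * x 1F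
    second-coordinate m x = solve 5 (λ m a b c d → :0 :* a :+ (m :* b :+ (:0 :* c :+ (:0 :* d :+ :0))) := m :* b) refl m (x 0F) (x 1F) (x 2F) (x 3F)

    plane-coordinate : ∀ m n (x : Vec4 F) → 0# * x 0F + (0# * x 1F + (m * x 2F + (n * x 3F + 0#))) ≡ m * x 2F + n * x 3F
    plane-coordinate m n x = solve 6 (λ m n a b c d → :0 :* a :+ (:0 :* b :+ (m :* c :+ (n :* d :+ :0))) := m :* c :+ n :* d) refl m n (x 0F) (x 1F) (x 2F) (x 3F)

    elliptic-independent : Independent elliptic-basis
    elliptic-independent z vanishes = λ { 0F → z₀ ; 1F → z₁ ; 2F → z₂ ; 3F → z₃ }
      where
      at : ∀ i → ∑ F (λ j → elliptic-basis j i * z j) ≡ 0#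
      at i = trans (sym (combination-explicit elliptic-basis z i)) (vanishes i)
      z₀ : z 0F ≡ 0#
      z₀ = trans (sym (first-coordinate z)) (at 0F)
      z₁ : z 1F ≡ 0#
      z₁ = *-zero-product ½α₁≢0 (trans (sym (second-coordinate (½ * α₁) z)) (at 1F))
      z₃ : z 3F ≡ 0#
      z₃ = trans (solve 2 (λ a b → b := :0 :* a :+ :1 :* b) refl (z 2F) (z 3F)) (trans (sym (plane-coordinate 0# 1# z)) (at 3F))
      z₂ : z 2F ≡ 0#
      z₂ = trans (solve 2 (λ a k → a := :1 :* a :+ :- k :* :0) refl (z 2F) κ) (trans (cong (λ t → 1# * z 2F + - κ * t) (sym z₃)) (trans (sym (plane-coordinate 1# (- κ) z)) (at 2F)))

    elliptic : IsEllipticOverSubfield F q β-gram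
    elliptic = (λ i j → elliptic-basis j i) , basis∈K , independent⇒invertible elliptic-independent ,
      α₁ , α₁∈K isMatched , α₁≢0 , D , D∈K , D-nonsquare , λ x _ →
        trans (quadForm-β-gram (_·_ F (λ i j → elliptic-basis j i) x)) (trans (b-diagonal {y = _·_ F (λ i j → elliptic-basis j i) x} (first-coordinate x) (second-coordinate (½ * α₁) x) (plane-coordinate 1# (- κ) x) (plane-coordinate 0# 1# x))
          (solve 7 (λ a k d x₀ x₁ x₂ x₃ → let y₂ = :1 :* x₂ :+ :- k :* x₃ ; y₃ = :0 :* x₂ :+ :1 :* x₃ in
            a :* (x₀ :* x₁ :+ ((y₂ :+ k :* y₃) :* (y₂ :+ k :* y₃) :- d :* y₃ :* y₃)) := a :* (x₀ :* x₁ :+ x₂ :* x₂ :+ :- (d :* x₃ :* x₃))) refl α₁ κ D (x 0F) (x 1F) (x 2F) (x 3F)))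
      where
      basis∈K : ∀ i j → K (elliptic-basis j i)
      basis∈K i 0F = K-vec K-1 K-0 K-0 K-0 i
      basis∈K i 1F = K-vec K-0 (K-* ½∈K (α₁∈K isMatched)) K-0 K-0 i
      basis∈K i 2F = K-vec K-0 K-0 K-1 K-0 i
      basis∈K i 3F = K-vec K-0 K-0 (K-neg κ∈K) K-1 i

    s : Carrier
    s = proj₁ (sqrt D∈K)

    s²≡D : s * s ≡ D
    s²≡D = proj₂ (sqrt D∈K)

    s≢0 : s ≢ 0#
    s≢0 s≡0 = D-nonsquare (0# , K-0 , trans (cong (λ t → t * t) (sym s≡0)) s²≡D)

    -- From X₂ = x₂ - s x₃ and X₃ = x₂ + s x₃ one recovers x₃ = (X₃ - X₂)/(2s).
    g : Carrier
    g = ½ * s≢0 ⁻¹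

    g≢0 : g ≢ 0#
    g≢0 = *-nonzero (⁻¹-nonzero 1+1≢0) (⁻¹-nonzero s≢0)

    -- X₂ = x₂ − s x₃ and X₃ = x₂ + s x₃ factor the anisotropic part x₂² − D x₃² over F.
    hyperbolic-basis 0F = vec 1# 0# 0# 0#
    hyperbolic-basis 1F = vec 0# (½ * α₁) 0# 0#
    hyperbolic-basis 2F = vec 0# 0# (½ + κ * g) (- g)
    hyperbolic-basis 3F = vec 0# 0# (½ + - (κ * g)) g

    hyperbolic-independent : Independent hyperbolic-basis
    hyperbolic-independent z vanishes = λ { 0F → z₀ ; 1F → z₁ ; 2F → z₂ ; 3F → trans z₃≡z₂ z₂ }
      where
      open ≡-Reasoning
      at : ∀ i → ∑ F (λ j → hyperbolic-basis j i * z j) ≡ 0#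
      at i = trans (sym (combination-explicit hyperbolic-basis z i)) (vanishes i)
      z₀ : z 0F ≡ 0#
      z₀ = trans (sym (first-coordinate z)) (at 0F)
      z₁ : z 1F ≡ 0#
      z₁ = *-zero-product ½α₁≢0 (trans (sym (second-coordinate (½ * α₁) z)) (at 1F))
      z₃≡z₂ : z 3F ≡ z 2F
      z₃≡z₂ = x-y≡0⇒x≡y (*-zero-product g≢0 (trans (solve 3 (λ g a b → g :* (b :- a) := :- g :* a :+ g :* b) refl g (z 2F) (z 3F)) (trans (sym (plane-coordinate (- g) g z)) (at 3F))))
      z₂ : z 2F ≡ 0#
      z₂ = begin
        z 2F                                                      ≡⟨ *-identityˡ (z 2F) ⟨
        1# * z 2F                                                 ≡⟨ cong (_* z 2F) (*-inverseʳ 1+1≢0) ⟨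
        2# * ½ * z 2F                                             ≡⟨ solve 3 (λ i m a → :2 :* i :* a := (i :+ m) :* a :+ (i :- m) :* a) refl ½ (κ * g) (z 2F) ⟩
        (½ + κ * g) * z 2F + (½ + - (κ * g)) * z 2F               ≡⟨ cong (λ t → (½ + κ * g) * z 2F + (½ + - (κ * g)) * t) z₃≡z₂ ⟨
        (½ + κ * g) * z 2F + (½ + - (κ * g)) * z 3F               ≡⟨ plane-coordinate _ _ z ⟨
        _                                                         ≡⟨ at 2F ⟩
        0#                                                        ∎

    hyperbolic : IsHyperbolic F B
    hyperbolic = (λ i j → vector (hyperbolic-basis j) i) , independent⇒invertible composite-independent , α₁ , α₁≢0 , λ x → begin
        quadForm F B (M·x x)                     ≡⟨ quadForm≡form B (M·x x) ⟩
        β (M·x x) (M·x x)                        ≡⟨ form-cong B (M·x≗ x) (M·x≗ x) ⟩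
        β (vector (y x)) (vector (y x))          ≡⟨ β-coordinates (y x) (y x) ⟩
        b (y x) (y x)                            ≡⟨ b-diagonal {y = y x} (trans (combination-explicit hyperbolic-basis x 0F) (first-coordinate x)) (trans (combination-explicit hyperbolic-basis x 1F) (second-coordinate _ x))
                                                      (trans (combination-explicit hyperbolic-basis x 2F) (plane-coordinate _ _ x)) (trans (combination-explicit hyperbolic-basis x 3F) (plane-coordinate _ _ x)) ⟩
        α₁ * (x 0F * x 1F + ((Y₂ x + κ * Y₃ x) * (Y₂ x + κ * Y₃ x) + - (D * Y₃ x * Y₃ x)))
          ≡⟨ cong (λ d → α₁ * (x 0F * x 1F + ((Y₂ x + κ * Y₃ x) * (Y₂ x + κ * Y₃ x) + - (d * Y₃ x * Y₃ x)))) (sym s²≡D) ⟩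
        α₁ * (x 0F * x 1F + ((Y₂ x + κ * Y₃ x) * (Y₂ x + κ * Y₃ x) + - (s * s * Y₃ x * Y₃ x)))
          ≡⟨ cong (λ u → α₁ * (x 0F * x 1F + u)) (factor x) ⟩
        α₁ * (x 0F * x 1F + x 2F * x 3F)         ∎
      where
      open ≡-Reasoning
      M·x : Vec4 F → Vec4 F
      M·x x = _·_ F (λ i j → vector (hyperbolic-basis j) i) x
      y : Vec4 F → Vec4 F
      y x = combination hyperbolic-basis x
      Y₂ Y₃ : Vec4 F → Carrier
      Y₂ x = (½ + κ * g) * x 2F + (½ + - (κ * g)) * x 3F
      Y₃ x = - g * x 2F + g * x 3F
      M·x≗ : ∀ x i → M·x x i ≡ vector (y x) i
      M·x≗ x i = trans (sym (combination-explicit (λ k → vector (hyperbolic-basis k)) x i)) (combination-combination e hyperbolic-basis x i)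
      composite-independent : Independent (λ k → vector (hyperbolic-basis k))
      composite-independent x vanishes = hyperbolic-independent x (independent (y x) (λ i → trans (sym (combination-combination e hyperbolic-basis x i)) (vanishes i)))
      factor : ∀ x → (Y₂ x + κ * Y₃ x) * (Y₂ x + κ * Y₃ x) + - (s * s * Y₃ x * Y₃ x) ≡ x 2F * x 3F
      factor x = begin
        (Y₂ x + κ * Y₃ x) * (Y₂ x + κ * Y₃ x) + - (s * s * Y₃ x * Y₃ x)
          ≡⟨ solve 6 (λ i k j s a c → let g = i :* j ; y₂ = (i :+ k :* g) :* a :+ (i :- k :* g) :* c ; y₃ = :- g :* a :+ g :* c in
               (y₂ :+ k :* y₃) :* (y₂ :+ k :* y₃) :- s :* s :* y₃ :* y₃
               := i :* i :* ((a :+ c) :* (a :+ c) :- (s :* j) :* (s :* j) :* ((c :- a) :* (c :- a)))) refl ½ κ (s≢0 ⁻¹) s (x 2F) (x 3F) ⟩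
        ½ * ½ * ((x 2F + x 3F) * (x 2F + x 3F) + - (s * s≢0 ⁻¹ * (s * s≢0 ⁻¹) * ((x 3F + - x 2F) * (x 3F + - x 2F))))
          ≡⟨ cong (λ u → ½ * ½ * ((x 2F + x 3F) * (x 2F + x 3F) + - (u * u * ((x 3F + - x 2F) * (x 3F + - x 2F))))) (*-inverseʳ s≢0) ⟩
        ½ * ½ * ((x 2F + x 3F) * (x 2F + x 3F) + - (1# * 1# * ((x 3F + - x 2F) * (x 3F + - x 2F))))
          ≡⟨ solve 3 (λ i a c → i :* i :* ((a :+ c) :* (a :+ c) :- :1 :* :1 :* ((c :- a) :* (c :- a))) := (:2 :* i) :* (:2 :* i) :* (a :* c)) refl ½ (x 2F) (x 3F) ⟩
        2# * ½ * (2# * ½) * (x 2F * x 3F)   ≡⟨ cong (λ u → u * u * (x 2F * x 3F)) (*-inverseʳ 1+1≢0) ⟩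
        1# * 1# * (x 2F * x 3F)             ≡⟨ solve 1 (λ u → :1 :* :1 :* u := u) refl (x 2F * x 3F) ⟩
        x 2F * x 3F                         ∎

    -- The subgeometry consists of the points with real coordinates in the normal frame, so the
    -- collineation is linear, with identity automorphism.
    baer-elliptic : EllipticInBaerSubgeometry F q A B
    baer-elliptic = frame-matrix , (λ x → x) , independent⇒invertible independent ,
      ((λ _ _ → refl) , (λ _ _ → refl) , refl , (λ x → x) , (λ _ → refl) , (λ _ → refl)) ,
      β-gram , β-gram∈K , β-gram-symmetric , elliptic , λ v v≢0 → mk⇔ (onHQ⇒represented v≢0) represented⇒onHQ

-- Rescaling the quadric.

module Rescaling (F : FiniteField) (q : ℕ) (q-oddPrimePower : IsOddPrimePower q) (card : length (FiniteField.elements F) ≡ q ℕ.* q)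
  (A B : Matrix F) (l : FiniteField.Carrier F) (l≢0 : l ≢ FiniteField.0# F) where
  open QuadraticExtension F q q-oddPrimePower card
  open LinearAlgebra F
  open Forms F
  open PointCounting F

  -- Here l is the factor relating the two tangent plane equations at `P`; absorbing it into B
  -- changes neither the point set nor the type of the quadric.
  rescaled : Matrix F
  rescaled i j = l * B i j

  quadForm-rescaled : ∀ x → quadForm F rescaled x ≡ l * quadForm F B x
  quadForm-rescaled x = trans (quadForm≡form rescaled x) (trans (form-matrix-scale B l x x) (cong (l *_) (sym (quadForm≡form B x))))

  onHQ-rescaled : ∀ v → OnHQ F q A B v → OnHQ F q A rescaled v
  onHQ-rescaled v (v∈H , v∈Q) = v∈H , trans (quadForm-rescaled v) (trans (cong (l *_) v∈Q) (zeroʳ l))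

  onHQ-unscaled : ∀ v → OnHQ F q A rescaled v → OnHQ F q A B v
  onHQ-unscaled v (v∈H , v∈Q) = v∈H , *-zero-product l≢0 (trans (sym (quadForm-rescaled v)) v∈Q)

  onHQ-multiple : ∀ v w → Multiple v w → OnHQ F q A B v → OnHQ F q A B w
  onHQ-multiple v w (c , _ , w≗cv) (v∈H , v∈Q) =
    ( trans (sym (form-explicit A w (λ i → w i ᶜ))) (trans (form-cong A w≗cv (λ i → trans (cong _ᶜ (w≗cv i)) (conj-* c (v i))))
        (trans (form-scale A c (c ᶜ) v (λ i → v i ᶜ)) (trans (cong (c * c ᶜ *_) (trans (form-explicit A v (λ i → v i ᶜ)) v∈H)) (zeroʳ _))))
    , trans (quadForm≡form B w) (trans (form-cong B w≗cv w≗cv) (trans (form-scale B c c v v) (trans (cong (c * c *_) (trans (sym (quadForm≡form B v)) v∈Q)) (zeroʳ _)))) )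

  few-points : ∀ {n} → card-H∩Q F q A B ≡ n → ∀ {vs} → All (λ v → NonZeroVec F v × OnHQ F q A rescaled v) vs →
    AllPairs (λ v w → ¬ Proportional v w) vs → length vs ℕ.≤ n
  few-points {n} count {vs} points distinct = subst (length vs ℕ.≤_) count
    (numPoints-≥ {OnHQ F q A B} (onHQ? F q A B) (λ {v} {w} → onHQ-multiple v w) (All.map (λ {v} (v≢0 , v∈HQ) → v≢0 , onHQ-unscaled v v∈HQ) points) distinct)

  rescaled-· : ∀ (P : Vec4 F) i → ∑ F (λ j → rescaled i j * P j) ≡ l * ∑ F (λ j → B i j * P j)
  rescaled-· P i = trans (∑-cong λ j → *-assoc l (B i j) (P j)) (∑-*ˡ l (λ j → B i j * P j))

  nonsingular-rescaled : ∀ P → NonsingularPoint F B P → NonZeroVec F (_·_ F rescaled P)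
  nonsingular-rescaled P nonsingular vanishes = nonsingular λ i → *-zero-product l≢0 (trans (sym (rescaled-· P i)) (vanishes i))

  hyperbolic-unscaled : IsHyperbolic F rescaled → IsHyperbolic F B
  hyperbolic-unscaled (M , M-invertible , c , c≢0 , eq) = M , M-invertible , l≢0 ⁻¹ * c , *-nonzero (⁻¹-nonzero l≢0) c≢0 , λ x →
    *-cancelˡ l≢0 (trans (sym (quadForm-rescaled (_·_ F M x))) (trans (eq x) (sym (absorb (x 0F * x 1F + x 2F * x 3F)))))
    where
    absorb : ∀ u → l * (l≢0 ⁻¹ * c * u) ≡ c * u
    absorb u = trans (solve 4 (λ l i c u → l :* (i :* c :* u) := (l :* i) :* (c :* u)) refl l (l≢0 ⁻¹) c u) (trans (cong (_* (c * u)) (*-inverseʳ l≢0)) (*-identityˡ (c * u)))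

  baer-unscaled : EllipticInBaerSubgeometry F q A rescaled → EllipticInBaerSubgeometry F q A B
  baer-unscaled (M , σ , M-invertible , σ-automorphism , B′ , B′∈K , B′-symmetric , B′-elliptic , points) =
    M , σ , M-invertible , σ-automorphism , B′ , B′∈K , B′-symmetric , B′-elliptic , λ v v≢0 →
      mk⇔ (λ v∈HQ → Equivalence.to (points v v≢0) (onHQ-rescaled v v∈HQ)) (λ x → onHQ-unscaled v (Equivalence.from (points v v≢0) x))

theorem7 : (F : FiniteField) (q : ℕ) → IsOddPrimePower q →
    length (FiniteField.elements F) ≡ q ℕ.* q →
    (A B : Matrix F) →
    IsHermitian F q A → NonDegenerateHermitian F q A →
    IsSymmetric F B → IrreducibleQuadric F B →
    (Σ[ P ∈ Vec4 F ] (NonZeroVec F P × OnHQ F q A B P ×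
    NonsingularPoint F B P × SameTangentPlane F q A B P)) →
    card-H∩Q F q A B ≡ q ℕ.* q ℕ.+ 1 →
    IsHyperbolic F B × EllipticInBaerSubgeometry F q A B
theorem7 F q q-oddPrimePower card A B A-hermitian A-nondegenerate B-symmetric _ (P , P≢0 , (_ , P∈Q) , nonsingular , l , l≢0 , tangent) count =
  hyperbolic-unscaled hyperbolic , baer-unscaled baer-elliptic
  where
  open Rescaling F q q-oddPrimePower card A B l l≢0
  𝓒 : Configuration
  𝓒 = record
    { F = F ; q = q ; q-oddPrimePower = q-oddPrimePower ; card = card ; A = A ; B = rescaled
    ; A-hermitian = A-hermitian ; A-nondegenerate = A-nondegenerate
    ; B-symmetric = λ i j → cong (FiniteField._*_ F l) (B-symmetric i j)
    ; P = P ; P-isotropic = trans (quadForm-rescaled P) (trans (cong (FiniteField._*_ F l) P∈Q) (FieldArithmetic.zeroʳ F l))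
    ; tangent = λ i → trans (tangent i) (sym (rescaled-· P i))
    ; few-points = few-points count
    }
  normal : Σ[ 𝓝 ∈ TangentForms.Frame 𝓒 ] NormalFrames.Normal 𝓒 𝓝
  normal = NormalFrames.normal-frame 𝓒 (InitialFrame.initial-frame 𝓒 (nonsingular-rescaled P nonsingular))
  open QuadricTypes.InNormalFrameTypes 𝓒 (proj₂ normal)
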